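{- Let $n$ be a positive integer, let $\lambda\vdash k$, and let $\nu$ be a weak composition of $nk$ with $m$ parts. Then $$\left(\mathrm{COF}(n\lambda,\nu),\ \langle\phi\rangle,\ [\mathrm{m}_\nu]\,\mathrm{E}_{n\lambda}(\mathbf{x};q,0)\right)$$ exhibits the cyclic sieving phenomenon, where $\langle\phi\rangle$ is regarded as a cyclic group of order $n$.
   Context: For a partition $\lambda=(\lambda_1,\dots,\lambda_\ell)$, $n\lambda=(n\lambda_1,\dots,n\lambda_\ell)$. A weak composition of $N$ with $m$ parts is a tuple of $m$ non-negative integers with sum $N$. Diagrams are in English notation with matrix coordinates: box $(i,j)$ lies in row $i$ (from the top) and column $j$ (from the left), and $\lambda$ has $\lambda_i$ left-justified boxes in row $i$. Coinversion-free fillings. Let $F:\lambda\to[m]$ be a filling. Three boxes $a,b,c$ form a triple if $a$ is immediately to the left of $b$ (same row) and $c$ is somewhere below $b$ (same column). The triple is an inversion-triple if the entries increase counter-clockwise (cyclic direction $b\to a\to c\to b$), where among equal entries $a$ counts as larger than $c$, and $c$ as larger than $b$; explicitly, $F(b)\le F(a)<F(c)$, or $F(a)<F(c)<F(b)$, or $F(c)<F(b)\le F(a)$. $F$ is coinversion-free if every triple is an inversion-triple and the first column is strictly decreasing from top to bottom. $\mathrm{COF}(\lambda,m)$ is the set of coinversion-free fillings of $\lambda$ with entries in $[m]$, and $\mathrm{COF}(\lambda,\nu)$ is the subset of those with content $\nu$, i.e. with exactly $\nu_i$ entries equal to $i$ for each $i\in[m]$. For any choice of subsets $S_1,S_2,\dots$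 of $[m]$ with $|S_j|=\lambda'_j$ there is a unique coinversion-free filling of $\lambda$ whose column $j$ has entry set $S_j$ for all $j$ (and the entries in each column of a coinversion-free filling are distinct). Major index. A descent of $F$ is a box $(i,j)$ with $j\ge2$ and $F(i,j-1)<F(i,j)$; $\mathrm{leg}(i,j)=\lambda_i-j$; $\mathrm{maj}(F)=\sum_{b\text{ descent}}(\mathrm{leg}(b)+1)$. The specialized non-symmetric Macdonald polynomial is $\mathrm{E}_\lambda(x_1,\dots,x_m;q,0)=\sum_{F\in\mathrm{COF}(\lambda,m)}q^{\mathrm{maj}(F)}\prod_{(i,j)\in\lambda}x_{F(i,j)}$; it is symmetric in the $x_i$. $[\mathrm{m}_\nu]f$ denotes the coefficient of the monomial symmetric function $\mathrm{m}_\nu$ in $f$, equivalently the coefficient of $x_1^{\nu_1}\cdots x_m^{\nu_m}$; it is a polynomial in $q$. The action $\phi$. Divide the columns of $n\lambda$ into consecutive blocks of $n$ columns (all columns in a block have the same height). $\phi$ maps a coinversion-free filling $F$ of $n\lambda$ to the unique coinversion-free filling whose column sets are obtained from those of $F$ by cyclically shifting the column sets one step to the right within each block. It preserves content and defines an action of the cyclic group $C_n$ of order $n$, a generator acting as $\phi$. Cyclic sieving. For a finite set $X$ with an action of $C_n=\langle g\rangle$ and $f(q)\in\mathbb{N}[q]$, the triple $(X,C_n,f(q))$ exhibits the cyclic sieving phenomenon if $\#\{x\in X: g^d\cdot x=x\}=f(\xi^d)$ for all $d\in\mathbb{Z}$, where $\xi$ is a primitive $n$-th root of unity. -}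

module Defs where

open import Algebra.Apartness.Bundles using (HeytingField; HeytingCommutativeRing)
open import Algebra.Bundles using (CommutativeRing; Semiring)
import Algebra.Definitions.RawSemiring as RawSemiringDefinitions
open import Data.Bool.Base using (true; false; if_then_else_)
open import Data.Empty using (⊥-elim)
open import Data.Fin.Base as Fin using (Fin; zero; suc; toℕ; fromℕ<)
import Data.Fin.Properties as Fin
open import Data.Fin.Subset using (Subset; ∣_∣; _∈_; _-_; ⊥; ⁅_⁆; Nonempty)
open import Data.Fin.Subset.Properties
  using ( _∈?_; nonempty?; Empty-unique; ∣⊥∣≡0; ∉⊥; ⊆-antisym; p─⊥≡p; p─q⊆p
        ; x∈p∧x≢y⇒x∈p-y)
open import Data.Integer.Base using (ℤ; +_; -[1+_])
open import Data.Irrelevant using ([_])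
open import Data.List.Base as List
  using (List; []; _∷_; _++_; length; filter; replicate; foldr; cartesianProductWith)
import Data.List.Membership.Propositional as List
import Data.List.Membership.Propositional.Properties as List
open import Data.List.Membership.Propositional.Properties.WithK using (unique∧set⇒bag)
open import Data.List.Properties using (filter-accept; filter-reject; filter-≐; length-map)
open import Data.List.Relation.Binary.BagAndSetEquality using (∼bag⇒↭)
open import Data.List.Relation.Binary.Permutation.Propositional.Properties using (↭-length)
open import Data.List.Relation.Unary.All as All using (All; []; _∷_)
import Data.List.Relation.Unary.All.Properties as All
open import Data.List.Relation.Unary.AllPairs using ([]; _∷_)
open import Data.List.Relation.Unary.Any using (here; there)
open import Data.List.Relation.Unary.Linked using (Linked)
open import Data.List.Relation.Unary.Unique.Propositional using (Unique)
import Data.List.Relation.Unary.Unique.Propositional.Properties as Unique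
open import Data.Maybe.Base using (Maybe; just; nothing)
open import Data.Nat hiding (∣_-_∣; _⊔_)
open import Data.Nat.ListAction using (sum)
open import Data.Nat.DivMod
open import Data.Nat.Divisibility using (divides-refl)
import Data.Nat.Properties as ℕ
open import Data.Product using (Σ-syntax; ∃; ∃-syntax; ∃!; _×_; _,_; proj₁; proj₂)
open import Data.Refinement using (Refinement-syntax; value; _,_)
import Data.Refinement.Properties as Refinement
open import Data.Sum.Base using (_⊎_; inj₁; inj₂)
open import Data.Vec.Base as Vec using (Vec; []; _∷_; here; there)
import Data.Vec.Properties as Vec
open import Function.Base using (_∘_)
open import Function.Bundles using (_↔_; _⇔_; mk⇔; mk↔ₛ′; Inverse; Equivalence)
import Function.Endo.Propositional
open import Level using (Setω; _⊔_)
open import Relation.Binary.Definitions using (DecidableEquality; tri<; tri≈; tri>)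
open import Relation.Binary.PropositionalEquality
open import Relation.Nullary using (Dec; does; yes; no; ¬_; _×-dec_; _⊎-dec_; _→-dec_; recompute)
open import Relation.Nullary.Decidable using (map′; dec-true)
open import Relation.Unary using (Decidable; Pred)

private
  variable
    m : ℕ
    μ : List ℕ

infix 4 _⊢_

record _⊢_ (μ : List ℕ) (k : ℕ) : Set where
  field
    decreasing : Linked _≥_ μ
    positive   : All (0 <_) μ
    size       : sum μ ≡ k

infixr 7 _·_

_·_ : ℕ → List ℕ → List ℕ
n · μ = List.map (n *_) μ

-- Rows and columns are counted from 0 throughout, so that `height μ j` is
-- the part j + 1 of the conjugate partition of μ.
height : List ℕ → ℕ → ℕ
height μ j = length (filter (j <?_) μ)

record Box (μ : List ℕ) : Set where
  constructor _,_
  field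
    row : Fin (length μ)
    col : Fin (List.lookup μ row)

open Box public

infix 4 _LeftOf_ _Below_

_LeftOf_ : Box μ → Box μ → Set
a LeftOf b = row a ≡ row b × suc (toℕ (col a)) ≡ toℕ (col b)

_Below_ : Box μ → Box μ → Set
c Below b = row b Fin.< row c × toℕ (col c) ≡ toℕ (col b)

leg : Box μ → ℕ
leg {μ} b = List.lookup μ (row b) ∸ suc (toℕ (col b))

next-row : ∀ {r} → Box μ → Box (r ∷ μ)
next-row (i , j) = suc i , j

boxes : (μ : List ℕ) → List (Box μ)
boxes []      = []
boxes (r ∷ μ) = List.map (zero ,_) (List.allFin r) ++ List.map next-row (boxes μ)

-- A filling is the list of its rows; the entry t : Fin m stands for t + 1 ∈ [m].
Filling : List ℕ → ℕ → Set
Filling μ m = All (Vec (Fin m)) μ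

infix 8 _!_

_!_ : Filling μ m → Box μ → Fin m
F ! b = Vec.lookup (All.lookup F (List.∈-lookup (row b))) (col b)

content : Filling μ m → Vec ℕ m
content {μ} F = Vec.tabulate λ t → length (filter (λ b → F ! b Fin.≟ t) (boxes μ))

InColumn : Filling μ m → ℕ → Fin m → Set
InColumn F j t = ∃[ b ] toℕ (col b) ≡ j × F ! b ≡ t

-- `Inversion x y z` is the condition on the entries x = F(a), y = F(b), z = F(c).
Inversion : (x y z : Fin m) → Set
Inversion x y z = (y Fin.≤ x × x Fin.< z)
                ⊎ (x Fin.< z × z Fin.< y)
                ⊎ (z Fin.< y × y Fin.≤ x)

record CoinversionFree (F : Filling μ m) : Set where
  field
    triples     : ∀ a b c → a LeftOf b → c Below b → Inversion (F ! a) (F ! b) (F ! c)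
    firstColumn : ∀ b c → toℕ (col b) ≡ 0 → c Below b → F ! c Fin.< F ! b

open CoinversionFree public

Descent : Filling μ m → Box μ → Set
Descent F b = ∃[ a ] a LeftOf b × F ! a Fin.< F ! b

allBox? : ∀ {p} {P : Pred (Box μ) p} → Decidable P → Dec (∀ b → P b)
allBox? P? = map′ (λ h b → h (row b) (col b)) (λ h i j → h (i , j))
  (Fin.all? λ i → Fin.all? λ j → P? (i , j))

anyBox? : ∀ {p} {P : Pred (Box μ) p} → Decidable P → Dec (∃ P)
anyBox? P? = map′ (λ (i , j , p) → (i , j) , p) (λ ((i , j) , p) → i , j , p)
  (Fin.any? λ i → Fin.any? λ j → P? (i , j))

leftOf? : (a b : Box μ) → Dec (a LeftOf b)
leftOf? a b = row a Fin.≟ row b ×-dec suc (toℕ (col a)) ≟ toℕ (col b)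

below? : (c b : Box μ) → Dec (c Below b)
below? c b = row b Fin.<? row c ×-dec toℕ (col c) ≟ toℕ (col b)

inversion? : (x y z : Fin m) → Dec (Inversion x y z)
inversion? x y z = (y Fin.≤? x ×-dec x Fin.<? z)
             ⊎-dec (x Fin.<? z ×-dec z Fin.<? y)
             ⊎-dec (z Fin.<? y ×-dec y Fin.≤? x)

coinversionFree? : (F : Filling μ m) → Dec (CoinversionFree F)
coinversionFree? F = map′
  (λ (t , f) → record { triples = t ; firstColumn = f })
  (λ h → triples h , firstColumn h)
  ( (allBox? λ a → allBox? λ b → allBox? λ c →
       leftOf? a b →-dec (below? c b →-dec inversion? (F ! a) (F ! b) (F ! c)))
  ×-dec
    (allBox? λ b → allBox? λ c →
       (toℕ (col b) ≟ 0) →-dec (below? c b →-dec F ! c Fin.<? F ! b)))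

descent? : (F : Filling μ m) → Decidable (Descent F)
descent? F b = anyBox? λ a → leftOf? a b ×-dec F ! a Fin.<? F ! b

inColumn? : (F : Filling μ m) (j : ℕ) → Decidable (InColumn F j)
inColumn? F j t = anyBox? λ b → toℕ (col b) ≟ j ×-dec F ! b Fin.≟ t

maj : Filling μ m → ℕ
maj {μ} F = sum (List.map (λ b → suc (leg b)) (filter (descent? F) (boxes μ)))

columnSet : Filling μ m → ℕ → Subset m
columnSet F j = Vec.tabulate (does ∘ inColumn? F j)

infix 4 _≟ᶠ_

_≟ᶠ_ : DecidableEquality (Filling μ m)
[]      ≟ᶠ []      = yes refl
(v ∷ F) ≟ᶠ (w ∷ G) = map′ (λ { (refl , refl) → refl }) (λ { refl → refl , refl })
  (Vec.≡-dec Fin._≟_ v w ×-dec F ≟ᶠ G)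

record Finite (X : Set) : Set where
  field
    elements : List X
    complete : ∀ x → x List.∈ elements
    unique   : Unique elements
    _≟ᵉ_     : DecidableEquality X

  count : ∀ {p} {P : Pred X p} → Decidable P → ℕ
  count P? = length (filter P? elements)

module _ {X : Set} {P : X → Set} (P? : Decidable P) where

  select : List X → List [ x ∈ X ∣ P x ]
  select []       = []
  select (x ∷ xs) with P? x
  ... | yes p = (x , [ p ]) ∷ select xs
  ... | no  _ = select xs

  ∈-select : ∀ {xs} (v : [ x ∈ X ∣ P x ]) → value v List.∈ xs → v List.∈ select xs
  ∈-select {x ∷ xs} v i with P? x
  ∈-select {x ∷ xs} v (here refl) | yes p = here refl
  ∈-select {x ∷ xs} v (there i)   | yes p = there (∈-select v i)
  ∈-select {x ∷ xs} (v , [ p ]) (here refl) | no ¬p = ⊥-elim (¬p (recompute (P? v) p))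
  ∈-select {x ∷ xs} v (there i)   | no ¬p = ∈-select v i

  select-≢ : ∀ {xs} (v : [ x ∈ X ∣ P x ]) → All (value v ≢_) xs → All (v ≢_) (select xs)
  select-≢ v []           = []
  select-≢ {x ∷ xs} v (v≢x ∷ v≢xs) with P? x
  ... | yes p = (λ { refl → v≢x refl }) ∷ select-≢ v v≢xs
  ... | no  _ = select-≢ v v≢xs

  select-unique : ∀ {xs} → Unique xs → Unique (select xs)
  select-unique [] = []
  select-unique {x ∷ xs} (x∉ ∷ u) with P? x
  ... | yes p = select-≢ _ x∉ ∷ select-unique u
  ... | no  _ = select-unique u

  finite-refinement : Finite X → Finite [ x ∈ X ∣ P x ]
  finite-refinement fin = record
    { elements = select elements
    ; complete = λ v → ∈-select v (complete (value v))
    ; unique   = select-unique unique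
    ; _≟ᵉ_     = Refinement._≟_ _≟ᵉ_
    }
    where open Finite fin

words : (m r : ℕ) → List (Vec (Fin m) r)
words m zero    = [] ∷ []
words m (suc r) = cartesianProductWith _∷_ (List.allFin m) (words m r)

words-complete : ∀ {r} (v : Vec (Fin m) r) → v List.∈ words m r
words-complete []      = here refl
words-complete (x ∷ v) = List.∈-cartesianProductWith⁺ _∷_ (List.∈-allFin x) (words-complete v)

words-unique : ∀ m r → Unique (words m r)
words-unique m zero    = [] ∷ []
words-unique m (suc r) = Unique.cartesianProductWith⁺ _∷_ Vec.∷-injective
  (Unique.allFin⁺ m) (words-unique m r)

fillings : (μ : List ℕ) (m : ℕ) → List (Filling μ m)
fillings []      m = [] ∷ []
fillings (r ∷ μ) m = cartesianProductWith _∷_ (words m r) (fillings μ m)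

fillings-complete : (F : Filling μ m) → F List.∈ fillings μ m
fillings-complete []      = here refl
fillings-complete (v ∷ F) =
  List.∈-cartesianProductWith⁺ _∷_ (words-complete v) (fillings-complete F)

fillings-unique : ∀ μ m → Unique (fillings μ m)
fillings-unique []      m = [] ∷ []
fillings-unique (r ∷ μ) m = Unique.cartesianProductWith⁺ _∷_
  (λ { refl → refl , refl }) (words-unique m r) (fillings-unique μ m)

Filling-finite : ∀ μ m → Finite (Filling μ m)
Filling-finite μ m = record
  { elements = fillings μ m
  ; complete = fillings-complete
  ; unique   = fillings-unique μ m
  ; _≟ᵉ_     = _≟ᶠ_
  }

COF : List ℕ → ℕ → Set
COF μ m = [ F ∈ Filling μ m ∣ CoinversionFree F ]

COF-finite : ∀ μ m → Finite (COF μ m)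
COF-finite μ m = finite-refinement coinversionFree? (Filling-finite μ m)

COF[_,_] : List ℕ → Vec ℕ m → Set
COF[_,_] {m} μ ν = [ F ∈ Filling μ m ∣ CoinversionFree F × content F ≡ ν ]

inCOF? : (ν : Vec ℕ m) → Decidable (λ (F : Filling μ m) → CoinversionFree F × content F ≡ ν)
inCOF? ν F = coinversionFree? F ×-dec Vec.≡-dec _≟_ (content F) ν

COF[,]-finite : ∀ μ (ν : Vec ℕ m) → Finite COF[ μ , ν ]
COF[,]-finite μ ν = finite-refinement (inCOF? ν) (Filling-finite μ _)

-- Coefficient lists, constant coefficient first.
ℕ[q] : Set
ℕ[q] = List ℕ

infixl 6 _⊕_

_⊕_ : ℕ[q] → ℕ[q] → ℕ[q]
[]      ⊕ g       = g
(a ∷ f) ⊕ []      = a ∷ f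
(a ∷ f) ⊕ (b ∷ g) = (a + b) ∷ (f ⊕ g)

q^_ : ℕ → ℕ[q]
q^ k = replicate k 0 ++ (1 ∷ [])

-- Polynomials in x₁, …, x_m over ℕ[q]: the coefficient of each monomial x^α.
ℕ[q][x_] : ℕ → Set
ℕ[q][x m ] = Vec ℕ m → ℕ[q]

-- q^k x^α
term : ℕ → Vec ℕ m → ℕ[q][x m ]
term k α β = if does (Vec.≡-dec _≟_ α β) then q^ k else []

∑ : List ℕ[q][x m ] → ℕ[q][x m ]
∑ fs β = foldr (λ f g → f β ⊕ g) [] fs

-- The product of the variables x_{F(b)} over all boxes b is x^{content F}.
E : (μ : List ℕ) (m : ℕ) → ℕ[q][x m ]
E μ m = ∑ (List.map (λ F → term (maj (value F)) (content (value F)))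
                    (Finite.elements (COF-finite μ m)))

-- The coefficient of 𝐦_ν in a symmetric polynomial f, that is, the coefficient
-- of x^ν; for a composition ν, 𝐦_ν is indexed by the sorted ν.
[𝐦_]_ : Vec ℕ m → ℕ[q][x m ] → ℕ[q]
[𝐦 ν ] f = f ν

-- A coinversion-free filling is determined by its column sets, which can be
-- prescribed arbitrarily.  The filling is built row by row: each entry is
-- forced by its left neighbour and the set of entries still available in
-- its column.

maximum : ∀ {p m} {P : Pred (Fin m) p} → Decidable P → ∃ P →
          ∃[ c ] P c × (∀ {d} → P d → d Fin.≤ c)
maximum {m = suc m} {P} P? (x , px) with Fin.any? (P? ∘ suc)
... | yes ∃p = let (c , pc , c-max) = maximum (P? ∘ suc) ∃p in
  suc c , pc , λ { {zero} _ → z≤n ; {suc d} pd → s≤s (c-max pd) }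
... | no ∄p with x
...   | zero  = zero , px , λ { {zero} _ → z≤n ; {suc d} pd → ⊥-elim (∄p (d , pd)) }
...   | suc y = ⊥-elim (∄p (y , px))

-- The condition on an entry z below an entry y, where y has the given left
-- neighbour, or is in the first column.
Admissible : Maybe (Fin m) → (y z : Fin m) → Set
Admissible nothing  y z = z Fin.< y
Admissible (just x) y z = Inversion x y z

Best : Maybe (Fin m) → Subset m → Fin m → Set
Best p S y = y ∈ S × (∀ {z} → z ∈ S → z ≢ y → Admissible p y z)

best-exists : ∀ p (S : Subset m) → Nonempty S → ∃ (Best p S)
best-exists nothing S ne =
  let (y , y∈S , y-max) = maximum (_∈? S) ne in
  y , y∈S , λ z∈S z≢y → Fin.≤∧≢⇒< (y-max z∈S) z≢y
best-exists (just x) S ne with Fin.any? (λ z → z ∈? S ×-dec z Fin.≤? x)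
... | yes ∃z = y , y∈S , adm
  where
  best = maximum (λ z → z ∈? S ×-dec z Fin.≤? x) ∃z
  y = proj₁ best
  y∈S = proj₁ (proj₁ (proj₂ best))
  y≤x = proj₂ (proj₁ (proj₂ best))
  adm : ∀ {z} → z ∈ S → z ≢ y → Inversion x y z
  adm {z} z∈S z≢y with z Fin.≤? x
  ... | yes z≤x = inj₂ (inj₂ (Fin.≤∧≢⇒< (proj₂ (proj₂ best) (z∈S , z≤x)) z≢y , y≤x))
  ... | no  z≰x = inj₁ (y≤x , ℕ.≰⇒> z≰x)
... | no ∄z =
  let (y , y∈S , y-max) = maximum (_∈? S) ne in
  y , y∈S , λ {z} z∈S z≢y →
    inj₂ (inj₁ (ℕ.≰⇒> (λ z≤x → ∄z (z , z∈S , z≤x)) , Fin.≤∧≢⇒< (y-max z∈S) z≢y))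

admissible-asym : ∀ p {y z : Fin m} → Admissible p y z → ¬ Admissible p z y
admissible-asym nothing y>z z>y = ℕ.<-asym y>z z>y
admissible-asym (just x) (inj₁ (y≤x , x<z)) (inj₁ (z≤x , x<y)) = ℕ.<⇒≱ x<z z≤x
admissible-asym (just x) (inj₁ (y≤x , x<z)) (inj₂ (inj₁ (x<y , y<z))) = ℕ.<⇒≱ x<y y≤x
admissible-asym (just x) (inj₁ (y≤x , x<z)) (inj₂ (inj₂ (y<z , z≤x))) = ℕ.<⇒≱ x<z z≤x
admissible-asym (just x) (inj₂ (inj₁ (x<z , z<y))) (inj₁ (z≤x , x<y)) = ℕ.<⇒≱ x<z z≤x
admissible-asym (just x) (inj₂ (inj₁ (x<z , z<y))) (inj₂ (inj₁ (x<y , y<z))) = ℕ.<-asym z<y y<z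
admissible-asym (just x) (inj₂ (inj₁ (x<z , z<y))) (inj₂ (inj₂ (y<z , z≤x))) = ℕ.<-asym z<y y<z
admissible-asym (just x) (inj₂ (inj₂ (z<y , y≤x))) (inj₁ (z≤x , x<y)) = ℕ.<⇒≱ x<y y≤x
admissible-asym (just x) (inj₂ (inj₂ (z<y , y≤x))) (inj₂ (inj₁ (x<y , y<z))) = ℕ.<-asym z<y y<z
admissible-asym (just x) (inj₂ (inj₂ (z<y , y≤x))) (inj₂ (inj₂ (y<z , z≤x))) = ℕ.<-asym z<y y<z

best-unique : ∀ p {S : Subset m} {y z} → Best p S y → Best p S z → y ≡ z
best-unique p {y = y} {z} (y∈S , y-best) (z∈S , z-best) with y Fin.≟ z
... | yes y≡z = y≡z
... | no  y≢z = ⊥-elim (admissible-asym p (y-best z∈S (y≢z ∘ sym)) (z-best y∈S y≢z))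

previous : ∀ {r} → Maybe (Fin m) → Vec (Fin m) r → Fin r → Maybe (Fin m)
previous p (x ∷ v) zero    = p
previous p (x ∷ v) (suc i) = previous (just x) v i

previous-zero : ∀ {r} {p} (v : Vec (Fin m) r) i → toℕ i ≡ 0 → previous p v i ≡ p
previous-zero (x ∷ v) zero _ = refl

previous-suc : ∀ {r} {p} (v : Vec (Fin m) r) i j → suc (toℕ i) ≡ toℕ j →
               previous p v j ≡ just (Vec.lookup v i)
previous-suc (x ∷ y ∷ v) zero    (suc zero) refl = refl
previous-suc (x ∷ v) (suc i) (suc j) eq   = previous-suc v i j (ℕ.suc-injective eq)

RowFits : ∀ {r} → Maybe (Fin m) → (ℕ → Subset m) → Vec (Fin m) r → Set
RowFits p S v = ∀ i → Best (previous p v i) (S (toℕ i)) (Vec.lookup v i)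

row-exists : ∀ p (S : ℕ → Subset m) r → (∀ {j} → j < r → Nonempty (S j)) →
             Σ[ v ∈ Vec (Fin m) r ] RowFits p S v
row-exists p S zero    ne = [] , λ ()
row-exists p S (suc r) ne =
  let (x , x-best) = best-exists p (S 0) (ne z<s)
      (v , v-fits) = row-exists (just x) (S ∘ suc) r (ne ∘ s<s)
  in x ∷ v , λ { zero → x-best ; (suc i) → v-fits i }

row-unique : ∀ {p r} {S : ℕ → Subset m} {v w : Vec (Fin m) r} →
             RowFits p S v → RowFits p S w → v ≡ w
row-unique {v = []}    {[]}    _ _ = refl
row-unique {p = p} {S = S} {v = x ∷ v} {y ∷ w} f g with best-unique p {y = x} {y} (f zero) (g zero)
... | refl = cong (x ∷_) (row-unique {S = S ∘ suc} {v} {w} (f ∘ suc) (g ∘ suc))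

remove : ∀ {r} → (ℕ → Subset m) → Vec (Fin m) r → ℕ → Subset m
remove S []      j       = S j
remove S (x ∷ v) zero    = S 0 - x
remove S (x ∷ v) (suc j) = remove (S ∘ suc) v j

remove-in : ∀ {r} {S : ℕ → Subset m} (v : Vec (Fin m) r) i →
            remove S v (toℕ i) ≡ S (toℕ i) - Vec.lookup v i
remove-in (x ∷ v) zero    = refl
remove-in (x ∷ v) (suc i) = remove-in v i

remove-out : ∀ {r} {S : ℕ → Subset m} (v : Vec (Fin m) r) {j} → r ≤ j → remove S v j ≡ S j
remove-out []      _         = refl
remove-out (x ∷ v) (s≤s r≤j) = remove-out v r≤j

remove-⊆ : ∀ {r} {S : ℕ → Subset m} (v : Vec (Fin m) r) j {t} → t ∈ remove S v j → t ∈ S j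
remove-⊆ []          j       t∈ = t∈
remove-⊆ {S = S} (x ∷ v) zero    t∈ = p─q⊆p (S 0) ⁅ x ⁆ t∈
remove-⊆ (x ∷ v)     (suc j) t∈ = remove-⊆ v j t∈

x∉p-x : ∀ {p : Subset m} {x} → ¬ x ∈ p - x
x∉p-x {p = true ∷ p} {zero} ()
x∉p-x {p = false ∷ p} {zero} ()
x∉p-x {p = _ ∷ p} {suc x} (there h) = x∉p-x h

∣p-x∣ : ∀ {p : Subset m} {x} → x ∈ p → suc ∣ p - x ∣ ≡ ∣ p ∣
∣p-x∣ {p = .true ∷ p}  {zero} here       = cong (suc ∘ ∣_∣) (p─⊥≡p p)
∣p-x∣ {p = true ∷ p}  {suc x} (there h) = cong suc (∣p-x∣ h)
∣p-x∣ {p = false ∷ p} {suc x} (there h) = ∣p-x∣ h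

∣p∣≡0⇒p≡⊥ : ∀ {p : Subset m} → ∣ p ∣ ≡ 0 → p ≡ ⊥
∣p∣≡0⇒p≡⊥ {p = []}        _  = refl
∣p∣≡0⇒p≡⊥ {p = false ∷ p} eq = cong (false ∷_) (∣p∣≡0⇒p≡⊥ eq)

∣p∣≡suc⇒Nonempty : ∀ {k} {p : Subset m} → ∣ p ∣ ≡ suc k → Nonempty p
∣p∣≡suc⇒Nonempty {m = m} {p = p} eq with nonempty? p
... | yes ne = ne
... | no ¬ne with trans (sym eq) (trans (cong ∣_∣ (Empty-unique ¬ne)) (∣⊥∣≡0 m))
...   | ()

height-in : ∀ {r j} → j < r → height (r ∷ μ) j ≡ suc (height μ j)
height-in {j = j} j<r = cong length (filter-accept (j <?_) j<r)

height-out : ∀ {r j} → ¬ j < r → height (r ∷ μ) j ≡ height μ j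
height-out {j = j} j≮r = cong length (filter-reject (j <?_) j≮r)

∣remove∣ : ∀ {r p j} (S : ℕ → Subset m) (v : Vec (Fin m) r) → RowFits p S v → j < r →
           suc ∣ remove S v j ∣ ≡ ∣ S j ∣
∣remove∣ {j = j} S v fits j<r =
  subst (λ j → suc ∣ remove S v j ∣ ≡ ∣ S j ∣) (Fin.toℕ-fromℕ< j<r)
    (trans (cong (suc ∘ ∣_∣) (remove-in v i)) (∣p-x∣ (proj₁ (fits i))))
  where i = fromℕ< j<r

Fits : (ℕ → Subset m) → Filling μ m → Set
Fits S []      = ∀ j → S j ≡ ⊥
Fits S (v ∷ F) = RowFits nothing S v × Fits (remove S v) F

fits-exists : ∀ μ (S : ℕ → Subset m) → (∀ j → ∣ S j ∣ ≡ height μ j) →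
              Σ[ F ∈ Filling μ m ] Fits S F
fits-exists []      S h = [] , λ j → ∣p∣≡0⇒p≡⊥ (h j)
fits-exists (r ∷ μ) S h =
  let (v , v-fits) = row-exists nothing S r
                       (λ {j} j<r → ∣p∣≡suc⇒Nonempty (trans (h j) (height-in j<r)))
      (F , F-fits) = fits-exists μ (remove S v) (rest v v-fits)
  in v ∷ F , v-fits , F-fits
  where
  rest : ∀ v → RowFits nothing S v → ∀ j → ∣ remove S v j ∣ ≡ height μ j
  rest v v-fits j with j <? r
  ... | yes j<r = ℕ.suc-injective
    (trans (∣remove∣ S v v-fits j<r) (trans (h j) (height-in j<r)))
  ... | no  j≮r = trans (cong ∣_∣ (remove-out {S = S} v (ℕ.≮⇒≥ j≮r))) (trans (h j) (height-out j≮r))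

fits-unique : ∀ {S} {F G : Filling μ m} → Fits S F → Fits S G → F ≡ G
fits-unique {F = []}    {[]}    _ _ = refl
fits-unique {S = S} {v ∷ F} {w ∷ G} (f , fs) (g , gs) with row-unique {S = S} {v = v} {w} f g
... | refl = cong (v ∷_) (fits-unique fs gs)

fits-height : ∀ {S} {F : Filling μ m} → Fits S F → ∀ j → ∣ S j ∣ ≡ height μ j
fits-height {m = m} {F = []} fits j = trans (cong ∣_∣ (fits j)) (∣⊥∣≡0 m)
fits-height {μ = r ∷ μ} {S = S} {F = v ∷ F} (v-fits , F-fits) j with j <? r | fits-height F-fits j
... | yes j<r | ih = trans (sym (∣remove∣ S v v-fits j<r)) (trans (cong suc ih) (sym (height-in j<r)))
... | no  j≮r | ih = trans (cong ∣_∣ (sym (remove-out {S = S} v (ℕ.≮⇒≥ j≮r))))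
                           (trans ih (sym (height-out j≮r)))

HasColumns : Filling μ m → (ℕ → Subset m) → Set
HasColumns F S = ∀ j t → t ∈ S j ⇔ InColumn F j t

fits⇒hasColumns : ∀ {S} {F : Filling μ m} → Fits S F → HasColumns F S
fits⇒hasColumns {F = []} fits j t = mk⇔
  (λ t∈ → ⊥-elim (∉⊥ (subst (t ∈_) (fits j) t∈)))
  (λ { ((() , _) , _) })
fits⇒hasColumns {μ = r ∷ μ} {S = S} {F = v ∷ F} (v-fits , F-fits) j t = mk⇔ to from
  where
  ih = fits⇒hasColumns F-fits

  later : t ∈ remove S v j → InColumn (v ∷ F) j t
  later t∈ = let (b , eq) = Equivalence.to (ih j t) t∈ in next-row b , eq

  to : t ∈ S j → InColumn (v ∷ F) j t
  to t∈ with j <? r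
  ... | no j≮r = later (subst (t ∈_) (sym (remove-out {S = S} v (ℕ.≮⇒≥ j≮r))) t∈)
  ... | yes j<r with Fin.toℕ-fromℕ< j<r
  ...   | eq with Vec.lookup v (fromℕ< j<r) Fin.≟ t
  ...     | yes vᵢ≡t = (zero , fromℕ< j<r) , eq , vᵢ≡t
  ...     | no  vᵢ≢t = later (subst (λ j → t ∈ remove S v j) eq
              (subst (t ∈_) (sym (remove-in {S = S} v (fromℕ< j<r)))
                (x∈p∧x≢y⇒x∈p-y (subst (λ j → t ∈ S j) (sym eq) t∈) (vᵢ≢t ∘ sym))))

  from : InColumn (v ∷ F) j t → t ∈ S j
  from ((zero , i) , refl , refl)   = proj₁ (v-fits i)
  from ((suc i , c) , eq , t≡)      = remove-⊆ v j (Equivalence.from (ih j t) ((i , c) , eq , t≡))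

fits⇒coinversionFree : ∀ {S} {F : Filling μ m} → Fits S F → CoinversionFree F
fits⇒coinversionFree {F = []} _ = record { triples = λ { (() , _) } ; firstColumn = λ { (() , _) } }
fits⇒coinversionFree {μ = r ∷ μ} {S = S} {F = v ∷ F} (v-fits , F-fits) = record
  { triples = tri ; firstColumn = first }
  where
  ih = fits⇒coinversionFree F-fits

  admissible : ∀ i (b : Box μ) → toℕ (col b) ≡ toℕ i →
               Admissible (previous nothing v i) (Vec.lookup v i) (F ! b)
  admissible i b eq = proj₂ (v-fits i) (remove-⊆ v (toℕ i) Fb∈)
      (λ Fb≡ → x∉p-x (subst (_∈ S (toℕ i) - Vec.lookup v i) Fb≡ (subst (F ! b ∈_) (remove-in v i) Fb∈)))
    where
    Fb∈ : F ! b ∈ remove S v (toℕ i)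
    Fb∈ = Equivalence.from (fits⇒hasColumns F-fits (toℕ i) (F ! b)) (b , eq , refl)

  tri : ∀ a b c → a LeftOf b → c Below b → Inversion ((v ∷ F) ! a) ((v ∷ F) ! b) ((v ∷ F) ! c)
  tri (zero , i) (zero , j) (suc k , l) (refl , eq) (_ , eq′) =
    subst (λ p → Admissible p (Vec.lookup v j) (F ! (k , l)))
      (previous-suc v i j eq) (admissible j (k , l) eq′)
  tri (suc x , i) (suc .x , j) (suc k , l) (refl , eq) (s≤s lt , eq′) =
    triples ih (x , i) (x , j) (k , l) (refl , eq) (lt , eq′)

  first : ∀ b c → toℕ (col b) ≡ 0 → c Below b → (v ∷ F) ! c Fin.< (v ∷ F) ! b
  first (zero , j) (suc k , l) eq (_ , eq′) =
    subst (λ p → Admissible p (Vec.lookup v j) (F ! (k , l)))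
      (previous-zero v j eq) (admissible j (k , l) eq′)
  first (suc x , j) (suc k , l) eq (s≤s lt , eq′) =
    firstColumn ih (x , j) (k , l) eq (lt , eq′)

left-neighbour : ∀ (b : Box μ) {k} → toℕ (col b) ≡ suc k → ∃[ a ] a LeftOf b
left-neighbour {μ} b {k} eq = (row b , fromℕ< k<) , refl , trans (cong suc (Fin.toℕ-fromℕ< k<)) (sym eq)
  where
  k< : k < List.lookup μ (row b)
  k< = ℕ.<-trans (ℕ.≤-reflexive (sym eq)) (Fin.toℕ<n (col b))

inversion-≢ : ∀ {x y z : Fin m} → Inversion x y z → z ≢ y
inversion-≢ (inj₁ (y≤x , x<z))      refl = ℕ.<⇒≱ x<z y≤x
inversion-≢ (inj₂ (inj₁ (_ , z<y))) refl = ℕ.<-irrefl refl z<y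
inversion-≢ (inj₂ (inj₂ (z<y , _))) refl = ℕ.<-irrefl refl z<y

below-≢ : {F : Filling μ m} → CoinversionFree F → ∀ {b c} → c Below b → F ! c ≢ F ! b
below-≢ {F = F} cof {b} {c} c-below = go (toℕ (col b)) refl
  where
  go : ∀ j → toℕ (col b) ≡ j → F ! c ≢ F ! b
  go zero    colb eq = ℕ.<-irrefl (cong toℕ eq) (firstColumn cof b c colb c-below)
  go (suc k) colb =
    let (a , a-left) = left-neighbour b colb in
    inversion-≢ (triples cof a b c a-left c-below)

column-injective : {F : Filling μ m} → CoinversionFree F → ∀ {b c} →
                   toℕ (col b) ≡ toℕ (col c) → F ! b ≡ F ! c → b ≡ c
column-injective cof {b} {c} eq F≡ with Fin.<-cmp (row b) (row c)
... | tri< lt _ _ = ⊥-elim (below-≢ cof (lt , sym eq) (sym F≡))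
... | tri> _ _ lt = ⊥-elim (below-≢ cof (lt , eq) F≡)
column-injective cof {i , j} {.i , k} eq F≡ | tri≈ _ refl _ = cong (i ,_) (Fin.toℕ-injective eq)

coinversionFree-tail : ∀ {r} {v : Vec (Fin m) r} {F : Filling μ m} →
                       CoinversionFree {μ = r ∷ μ} (v ∷ F) → CoinversionFree F
coinversionFree-tail cof = record
  { triples = λ a b c (eq , eq′) (lt , eq″) →
      triples cof (next-row a) (next-row b) (next-row c) (cong suc eq , eq′) (s≤s lt , eq″)
  ; firstColumn = λ b c eq (lt , eq′) →
      firstColumn cof (next-row b) (next-row c) eq (s≤s lt , eq′)
  }

fits-complete : ∀ {S} {F : Filling μ m} → CoinversionFree F → HasColumns F S → Fits S F
fits-complete {F = []} cof cols j =
  Empty-unique λ { (t , t∈) → absurd (Equivalence.to (cols j t) t∈) }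
  where
  absurd : ∀ {t} → InColumn [] j t → _
  absurd ((() , _) , _)
fits-complete {μ = r ∷ μ} {m = m} {S = S} {F = v ∷ F} cof cols =
  v-fits , fits-complete (coinversionFree-tail cof) rest
  where
  admissible : ∀ i (b : Box μ) → toℕ (col b) ≡ toℕ i →
               Admissible (previous nothing v i) (Vec.lookup v i) (F ! b)
  admissible zero b eq =
    subst (λ p → Admissible p (Vec.lookup v zero) (F ! b)) (sym (previous-zero v zero refl))
      (firstColumn cof (zero , zero) (next-row b) refl (z<s , eq))
  admissible (suc i) b eq =
    subst (λ p → Admissible p (Vec.lookup v (suc i)) (F ! b))
      (sym (previous-suc v (Fin.inject₁ i) (suc i) left))
      (triples cof (zero , Fin.inject₁ i) (zero , suc i) (next-row b) (refl , left) (z<s , eq))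
    where
    left : suc (toℕ (Fin.inject₁ i)) ≡ toℕ (suc i)
    left = cong suc (Fin.toℕ-inject₁ i)

  v-fits : RowFits nothing S v
  v-fits i = Equivalence.from (cols (toℕ i) (Vec.lookup v i)) ((zero , i) , refl , refl)
           , λ {t} t∈ t≢ → best t≢ (Equivalence.to (cols (toℕ i) t) t∈)
    where
    best : ∀ {t} → t ≢ Vec.lookup v i → InColumn (v ∷ F) (toℕ i) t →
           Admissible (previous nothing v i) (Vec.lookup v i) t
    best t≢ ((zero , k) , eq , refl) = ⊥-elim (t≢ (cong (Vec.lookup v) (Fin.toℕ-injective eq)))
    best t≢ ((suc k , l) , eq , refl) = admissible i (k , l) eq

  rest : HasColumns F (remove S v)
  rest j t = mk⇔ to from
    where
    to : t ∈ remove S v j → InColumn F j t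
    to t∈ with Equivalence.to (cols j t) (remove-⊆ v j t∈)
    ... | (zero , i) , refl , refl = ⊥-elim (x∉p-x (subst (t ∈_) (remove-in v i) t∈))
    ... | (suc i , k) , eqs        = (i , k) , eqs

    from : InColumn F j t → t ∈ remove S v j
    from (b , eq , Fb≡t) with j <? r
    ... | no j≮r = subst (t ∈_) (sym (remove-out v (ℕ.≮⇒≥ j≮r)))
                     (Equivalence.from (cols j t) (next-row b , eq , Fb≡t))
    ... | yes j<r = subst (λ j → t ∈ remove S v j) eqᵢ
                      (subst (t ∈_) (sym (remove-in v i))
                        (x∈p∧x≢y⇒x∈p-y
                          (subst (λ j → t ∈ S j) (sym eqᵢ) (Equivalence.from (cols j t) (next-row b , eq , Fb≡t)))
                          (λ t≡ → below-≢ cof {b = zero , i} {c = next-row b}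
                             (z<s , trans eq (sym eqᵢ)) (trans Fb≡t t≡))))
      where
      i = fromℕ< j<r
      eqᵢ = Fin.toℕ-fromℕ< j<r

∈-columnSet : (F : Filling μ m) → HasColumns F (columnSet F)
∈-columnSet F j t = mk⇔
  (λ t∈ → does-true (inColumn? F j t)
    (trans (sym (Vec.lookup∘tabulate (does ∘ inColumn? F j) t)) (Vec.[]=⇒lookup t∈)))
  (λ h → Vec.lookup⇒[]= t (columnSet F j)
    (trans (Vec.lookup∘tabulate (does ∘ inColumn? F j) t) (dec-true (inColumn? F j t) h)))
  where
  does-true : ∀ {a} {A : Set a} (a? : Dec A) → does a? ≡ true → A
  does-true (yes a) _ = a

hasColumns⇒≡ : ∀ (F : Filling μ m) {S} → HasColumns F S → ∀ j → columnSet F j ≡ S j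
hasColumns⇒≡ F cols j = ⊆-antisym
  (λ {t} → Equivalence.from (cols j t) ∘ Equivalence.to (∈-columnSet F j t))
  (λ {t} → Equivalence.from (∈-columnSet F j t) ∘ Equivalence.to (cols j t))

≡⇒hasColumns : ∀ (F : Filling μ m) {S} → (∀ j → columnSet F j ≡ S j) → HasColumns F S
≡⇒hasColumns F eq j t = subst (λ s → t ∈ s ⇔ InColumn F j t) (eq j) (∈-columnSet F j t)

opaque

  cof-exists-unique : ∀ μ (S : ℕ → Subset m) → (∀ j → ∣ S j ∣ ≡ height μ j) →
    ∃! _≡_ λ (F : Filling μ m) → CoinversionFree F × (∀ j → columnSet F j ≡ S j)
  cof-exists-unique μ S h =
    let (F , F-fits) = fits-exists μ S h in
    F , (fits⇒coinversionFree F-fits , hasColumns⇒≡ F (fits⇒hasColumns F-fits))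
      , λ {G} (cof , eq) → fits-unique F-fits (fits-complete cof (≡⇒hasColumns G eq))

∣columnSet∣ : {F : Filling μ m} → CoinversionFree F → ∀ j → ∣ columnSet F j ∣ ≡ height μ j
∣columnSet∣ {F = F} cof = fits-height (fits-complete cof (∈-columnSet F))

columnSets-injective : {F G : Filling μ m} → CoinversionFree F → CoinversionFree G →
                       (∀ j → columnSet F j ≡ columnSet G j) → F ≡ G
columnSets-injective {F = F} {G} f g eq =
  fits-unique (fits-complete f (∈-columnSet F)) (fits-complete g (≡⇒hasColumns G (sym ∘ eq)))

-- The column whose entries are moved to column j when the columns of each
-- block of n columns are cyclically shifted one step to the right.
source : (n : ℕ) .{{_ : NonZero n}} → ℕ → ℕ
source n j = (j / n) * n + (j + (n ∸ 1)) % n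

infixr 8 _^∘_

_^∘_ : ∀ {a} {X : Set a} → (X → X) → ℕ → X → X
_^∘_ {X = X} = Function.Endo.Propositional._^_ X

module _ (n : ℕ) .{{_ : NonZero n}} where

  private
    p = n ∸ 1

    [q*n+s]/n≡q : ∀ q {s} → s < n → (q * n + s) / n ≡ q
    [q*n+s]/n≡q q {s} s<n = begin
      (q * n + s) / n    ≡⟨ +-distrib-/-∣ˡ s (divides-refl q) ⟩
      q * n / n + s / n  ≡⟨ cong₂ _+_ (m*n/n≡m q n) (m<n⇒m/n≡0 s<n) ⟩
      q + 0              ≡⟨ ℕ.+-identityʳ q ⟩
      q                  ∎
      where open ≡-Reasoning

    [q*n+x%n+y]%n : ∀ q x y → (q * n + x % n + y) % n ≡ (x + y) % n
    [q*n+x%n+y]%n q x y = begin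
      (q * n + x % n + y) % n    ≡⟨ cong (_% n) (trans (ℕ.+-assoc (q * n) (x % n) y) (ℕ.+-comm (q * n) _)) ⟩
      (x % n + y + q * n) % n    ≡⟨ [m+kn]%n≡m%n (x % n + y) q n ⟩
      (x % n + y) % n            ≡⟨ %-distribˡ-+ (x % n) y n ⟩
      (x % n % n + y % n) % n    ≡⟨ cong (λ z → (z + y % n) % n) (m%n%n≡m%n x n) ⟩
      (x % n + y % n) % n        ≡⟨ %-distribˡ-+ x y n ⟨
      (x + y) % n                ∎
      where open ≡-Reasoning

  source-/ : ∀ j → source n j / n ≡ j / n
  source-/ j = [q*n+s]/n≡q (j / n) (m%n<n (j + p) n)

  source^ : ∀ k j → (source n ^∘ k) j ≡ (j / n) * n + (j + k * p) % n
  source^ zero j = begin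
    j                              ≡⟨ m≡m%n+[m/n]*n j n ⟩
    j % n + j / n * n              ≡⟨ ℕ.+-comm (j % n) _ ⟩
    j / n * n + j % n              ≡⟨ cong (λ z → j / n * n + z % n) (ℕ.+-identityʳ j) ⟨
    j / n * n + (j + 0) % n        ∎
    where open ≡-Reasoning
  source^ (suc k) j = begin
    source n ((source n ^∘ k) j)             ≡⟨ cong (source n) (source^ k j) ⟩
    source n (j / n * n + (j + k * p) % n)       ≡⟨ cong₂ (λ y z → y * n + z)
                                                      ([q*n+s]/n≡q (j / n) (m%n<n (j + k * p) n))
                                                      ([q*n+x%n+y]%n (j / n) (j + k * p) p) ⟩
    j / n * n + (j + k * p + p) % n              ≡⟨ cong (λ z → j / n * n + z % n)
                                                      (trans (ℕ.+-assoc j (k * p) p)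
                                                        (cong (λ z → j + z) (ℕ.+-comm (k * p) p))) ⟩
    j / n * n + (j + suc k * p) % n              ∎
    where open ≡-Reasoning

  source^n : ∀ j → (source n ^∘ n) j ≡ j
  source^n j = begin
    (source n ^∘ n) j              ≡⟨ source^ n j ⟩
    j / n * n + (j + n * p) % n        ≡⟨ cong (λ z → j / n * n + (j + z) % n) (ℕ.*-comm n p) ⟩
    j / n * n + (j + p * n) % n        ≡⟨ cong (λ z → j / n * n + z) ([m+kn]%n≡m%n j p n) ⟩
    j / n * n + j % n                  ≡⟨ ℕ.+-comm _ (j % n) ⟩
    j % n + j / n * n                  ≡⟨ m≡m%n+[m/n]*n j n ⟨
    j                                  ∎
    where open ≡-Reasoning

  /-≡⇒< : ∀ {i j} r → i / n ≡ j / n → i < n * r → j < n * r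
  /-≡⇒< {i} {j} r eq i<nr = begin-strict
    j                  ≡⟨ m≡m%n+[m/n]*n j n ⟩
    j % n + j / n * n  <⟨ ℕ.+-monoˡ-< (j / n * n) (m%n<n j n) ⟩
    suc (j / n) * n    ≤⟨ ℕ.*-monoˡ-≤ n (subst (_< r) eq (m<n*o⇒m/o<n (subst (i <_) (ℕ.*-comm n r) i<nr))) ⟩
    r * n              ≡⟨ ℕ.*-comm r n ⟩
    n * r              ∎
    where open ℕ.≤-Reasoning

  height-block : ∀ μ {i j} → i / n ≡ j / n → height (n · μ) i ≡ height (n · μ) j
  height-block []      eq = refl
  height-block (r ∷ μ) {i} {j} eq with i <? n * r
  ... | yes i< = trans (height-in {n · μ} i<)
    (trans (cong suc (height-block μ eq)) (sym (height-in {n · μ} (/-≡⇒< r eq i<))))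
  ... | no i≮ = trans (height-out {n · μ} i≮)
    (trans (height-block μ eq) (sym (height-out {n · μ} (i≮ ∘ /-≡⇒< r (sym eq)))))

fⁿ∘f : ∀ {a} {X : Set a} (f : X → X) k x → (f ^∘ k) (f x) ≡ (f ^∘ suc k) x
fⁿ∘f f zero    x = refl
fⁿ∘f f (suc k) x = cong f (fⁿ∘f f k x)

iterate-equivariant : ∀ {a b c} {X : Set a} {I : Set b} {C : Set c} (f : X → X) (s : I → I)
                      (h : X → I → C) → (∀ x i → h (f x) i ≡ h x (s i)) →
                      ∀ k x i → h ((f ^∘ k) x) i ≡ h x ((s ^∘ k) i)
iterate-equivariant f s h eq zero    x i = refl
iterate-equivariant f s h eq (suc k) x i = trans (eq ((f ^∘ k) x) i)
  (trans (iterate-equivariant f s h eq k x (s i)) (cong (h x) (fⁿ∘f s k i)))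

-- `f ^∘ n` is f composed with (n - 1) copies of itself, on either side.
f∘fⁿ⁻¹ : ∀ {a} {X : Set a} (f : X → X) n .{{_ : NonZero n}} x →
         f ((f ^∘ (n ∸ 1)) x) ≡ (f ^∘ n) x
f∘fⁿ⁻¹ f (suc n) x = refl

fⁿ⁻¹∘f : ∀ {a} {X : Set a} (f : X → X) n .{{_ : NonZero n}} x →
         (f ^∘ (n ∸ 1)) (f x) ≡ (f ^∘ n) x
fⁿ⁻¹∘f f (suc n) x = fⁿ∘f f n x

-- If f has order dividing n, its inverse is its (n - 1)st power.
finite-order-↔ : ∀ {a} {X : Set a} (f : X → X) n .{{_ : NonZero n}} →
                 (∀ x → (f ^∘ n) x ≡ x) → X ↔ X
finite-order-↔ f n f^n = mk↔ₛ′ f (f ^∘ (n ∸ 1))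
  (λ x → trans (f∘fⁿ⁻¹ f n x) (f^n x)) (λ x → trans (fⁿ⁻¹∘f f n x) (f^n x))

-- Content can be read off the column sets: the boxes with entry t correspond
-- to the columns whose set contains t.

boxes-complete : (b : Box μ) → b List.∈ boxes μ
boxes-complete {r ∷ μ} (zero , j)  = List.∈-++⁺ˡ (List.∈-map⁺ (zero ,_) (List.∈-allFin j))
boxes-complete {r ∷ μ} (suc i , j) =
  List.∈-++⁺ʳ _ (List.∈-map⁺ next-row (boxes-complete (i , j)))

boxes-unique : ∀ μ → Unique (boxes μ)
boxes-unique []      = []
boxes-unique (r ∷ μ) = Unique.++⁺
  (Unique.map⁺ (λ { refl → refl }) (Unique.allFin⁺ r))
  (Unique.map⁺ (λ { {_ , _} {_ , _} refl → refl }) (boxes-unique μ))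
  (λ (∈₁ , ∈₂) → disjoint (List.∈-map⁻ (zero ,_) ∈₁) (List.∈-map⁻ next-row ∈₂))
  where
  disjoint : ∀ {b} → (∃ λ j → j List.∈ List.allFin r × b ≡ (zero , j)) →
             ¬ (∃ λ c → c List.∈ boxes μ × b ≡ next-row c)
  disjoint (_ , _ , refl) ((_ , _) , _ , ())

unique-map : ∀ {a b} {A : Set a} {B : Set b} {f : A → B} {xs : List A} →
             (∀ {x y} → x List.∈ xs → y List.∈ xs → f x ≡ f y → x ≡ y) →
             Unique xs → Unique (List.map f xs)
unique-map inj []        = []
unique-map inj (x∉ ∷ u) =
  All.map⁺ (All.tabulate λ y∈ eq → All.lookup x∉ y∈ (inj (here refl) (there y∈) eq))
  ∷ unique-map (λ x∈ y∈ → inj (there x∈) (there y∈)) u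

module _ (F : Filling μ m) (t : Fin m) where

  occurrences : List (Box μ)
  occurrences = filter (λ b → F ! b Fin.≟ t) (boxes μ)

  columnsWith : List ℕ
  columnsWith = List.map (toℕ ∘ col) occurrences

  columnsWith-unique : CoinversionFree F → Unique columnsWith
  columnsWith-unique cof = unique-map
    (λ b∈ c∈ eq → column-injective cof eq (trans (at b∈) (sym (at c∈))))
    (Unique.filter⁺ (λ b → F ! b Fin.≟ t) (boxes-unique μ))
    where
    at : ∀ {b} → b List.∈ occurrences → F ! b ≡ t
    at b∈ = proj₂ (List.∈-filter⁻ (λ b → F ! b Fin.≟ t) {xs = boxes μ} b∈)

  ∈-columnsWith : ∀ {j} → j List.∈ columnsWith ⇔ t ∈ columnSet F j
  ∈-columnsWith {j} = mk⇔ to from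
    where
    to : j List.∈ columnsWith → t ∈ columnSet F j
    to j∈ with List.∈-map⁻ (toℕ ∘ col) j∈
    ... | b , b∈ , eq = Equivalence.from (∈-columnSet F j t)
      (b , sym eq , proj₂ (List.∈-filter⁻ (λ b → F ! b Fin.≟ t) {xs = boxes μ} b∈))

    from : t ∈ columnSet F j → j List.∈ columnsWith
    from t∈ with Equivalence.to (∈-columnSet F j t) t∈
    ... | b , refl , Fb≡t = List.∈-map⁺ (toℕ ∘ col)
      (List.∈-filter⁺ (λ b → F ! b Fin.≟ t) (boxes-complete b) Fb≡t)

content-permuted : (σ : ℕ ↔ ℕ) {F G : Filling μ m} → CoinversionFree F → CoinversionFree G →
                   (∀ j → columnSet G j ≡ columnSet F (Inverse.to σ j)) → content G ≡ content F
content-permuted σ {F} {G} f g eq = Vec.tabulate-cong λ t → begin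
  length (occurrences G t)              ≡⟨ length-map (toℕ ∘ col) (occurrences G t) ⟨
  length (columnsWith G t)              ≡⟨ length-map to (columnsWith G t) ⟨
  length (List.map to (columnsWith G t)) ≡⟨ ↭-length (∼bag⇒↭ (unique∧set⇒bag
                                            (Unique.map⁺ injective (columnsWith-unique G t g))
                                            (columnsWith-unique F t f) (same t))) ⟩
  length (columnsWith F t)              ≡⟨ length-map (toℕ ∘ col) (occurrences F t) ⟩
  length (occurrences F t)              ∎
  where
  open ≡-Reasoning
  open Inverse σ using (to; from; strictlyInverseˡ; strictlyInverseʳ)

  injective : ∀ {i j} → to i ≡ to j → i ≡ j
  injective {i} {j} e =
    trans (sym (strictlyInverseʳ i)) (trans (cong from e) (strictlyInverseʳ j))

  same : ∀ t {i} → i List.∈ List.map to (columnsWith G t) ⇔ i List.∈ columnsWith F t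
  same t {i} = mk⇔ fwd bwd
    where
    fwd : i List.∈ List.map to (columnsWith G t) → i List.∈ columnsWith F t
    fwd i∈ with List.∈-map⁻ to i∈
    ... | j , j∈ , refl = Equivalence.from (∈-columnsWith F t)
      (subst (t ∈_) (eq j) (Equivalence.to (∈-columnsWith G t) j∈))

    bwd : i List.∈ columnsWith F t → i List.∈ List.map to (columnsWith G t)
    bwd i∈ = subst (List._∈ List.map to (columnsWith G t)) (strictlyInverseˡ i)
      (List.∈-map⁺ to (Equivalence.from (∈-columnsWith G t)
        (subst (t ∈_) (sym (trans (eq (from i)) (cong (columnSet F) (strictlyInverseˡ i))))
          (Equivalence.to (∈-columnsWith F t) i∈))))

record CyclicAction (n : ℕ) (X : Set) : Set where
  field
    generator : X ↔ X
    order     : ∀ x → (Inverse.to generator ^∘ n) x ≡ x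

  -- The action of the power g^d of the generator g.
  act : ℤ → X → X
  act (+ k)     = Inverse.to generator ^∘ k
  act -[1+ k ]  = Inverse.from generator ^∘ suc k

module _ (n : ℕ) .{{_ : NonZero n}} (μ : List ℕ) where

  shift-exists-unique : {F : Filling (n · μ) m} → CoinversionFree F →
    ∃! _≡_ λ (G : Filling (n · μ) m) →
      CoinversionFree G × (∀ j → columnSet G j ≡ columnSet F (source n j))
  shift-exists-unique {F = F} cof = cof-exists-unique (n · μ) (columnSet F ∘ source n)
    λ j → trans (∣columnSet∣ cof (source n j)) (height-block n μ (source-/ n j))

  module _ (ν : Vec ℕ m) where

    coinversionFree : (x : COF[ n · μ , ν ]) → CoinversionFree (value x)
    coinversionFree (F , [ h ]) = proj₁ (recompute (inCOF? ν F) h)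

    content≡ : (x : COF[ n · μ , ν ]) → content (value x) ≡ ν
    content≡ (F , [ h ]) = proj₂ (recompute (inCOF? ν F) h)

    φ : COF[ n · μ , ν ] → COF[ n · μ , ν ]
    φ x = let (G , (cof , cols) , _) = shift-exists-unique (coinversionFree x) in
      G , [ cof , trans (content-permuted (finite-order-↔ (source n) n (source^n n))
                          (coinversionFree x) cof cols)
                        (content≡ x) ]

    columnSet-φ : ∀ x j → columnSet (value (φ x)) j ≡ columnSet (value x) (source n j)
    columnSet-φ x = let (_ , (_ , cols) , _) = shift-exists-unique (coinversionFree x) in cols

    columnSet-φ^ : ∀ k x j → columnSet (value ((φ ^∘ k) x)) j ≡
                             columnSet (value x) ((source n ^∘ k) j)
    columnSet-φ^ = iterate-equivariant φ (source n) (λ x → columnSet (value x)) columnSet-φ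

    φ^n : ∀ x → (φ ^∘ n) x ≡ x
    φ^n x = Refinement.value-injective (columnSets-injective
      (coinversionFree ((φ ^∘ n) x)) (coinversionFree x)
      λ j → trans (columnSet-φ^ n x j) (cong (columnSet (value x)) (source^n n j)))

    ⟨φ⟩ : CyclicAction n COF[ n · μ , ν ]
    ⟨φ⟩ = record { generator = finite-order-↔ φ n φ^n ; order = φ^n }

module _ {c ℓ₁ ℓ₂} (K : HeytingField c ℓ₁ ℓ₂) where

  open HeytingField K using (Carrier; _≈_; 0#; 1#; heytingCommutativeRing)
    renaming (_+_ to infixl 6 _+ᴷ_; _*_ to infixl 7 _*ᴷ_)
  open HeytingCommutativeRing heytingCommutativeRing using (commutativeRing)
  open RawSemiringDefinitions (Semiring.rawSemiring (CommutativeRing.semiring commutativeRing)) using ()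
    renaming (_×_ to infixr 8 _×ᴷ_; _^_ to infixr 8 _^ᴷ_)

  fromℕ : ℕ → Carrier
  fromℕ k = k ×ᴷ 1#

  CharacteristicZero : Set ℓ₁
  CharacteristicZero = ∀ k → ¬ fromℕ (suc k) ≈ 0#

  record PrimitiveRoot (n : ℕ) : Set (c ⊔ ℓ₁) where
    field
      ξ ξ⁻¹     : Carrier
      inverse   : ξ *ᴷ ξ⁻¹ ≈ 1#
      root      : ξ ^ᴷ n ≈ 1#
      minimal   : ∀ k → 0 < k → k < n → ¬ ξ ^ᴷ k ≈ 1#

    power : ℤ → Carrier
    power (+ k)    = ξ ^ᴷ k
    power -[1+ k ] = ξ⁻¹ ^ᴷ suc k

  evaluate : ℕ[q] → Carrier → Carrier
  evaluate []      x = 0#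
  evaluate (a ∷ f) x = fromℕ a +ᴷ x *ᴷ evaluate f x

-- ℂ is replaced by an arbitrary field of characteristic zero that has a
-- primitive n-th root of unity.
ExhibitsCyclicSieving : ∀ {n X} → Finite X → CyclicAction n X → ℕ[q] → Setω
ExhibitsCyclicSieving {n} {X} finite action f =
  ∀ {c ℓ₁ ℓ₂} (K : HeytingField c ℓ₁ ℓ₂) → CharacteristicZero K → (ζ : PrimitiveRoot K n) →
  let open HeytingField K using (_≈_)
      open PrimitiveRoot ζ using (power)
      open Finite finite using (count; _≟ᵉ_)
      open CyclicAction action using (act)
  in ∀ (d : ℤ) → fromℕ K (count (λ x → act d x ≟ᵉ x)) ≈ evaluate K f (power d)

{-# OPTIONS --safe #-}

-- For sets S, T of letters let d(S, T) = max_t (∣S ∩ [t]∣ − ∣T ∩ [t]∣).  If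
-- adjacent columns of equal height of a coinversion-free filling have sets S and T,
-- there are exactly d(S, T) descents between them; and leg + 1 of a descent in column
-- j (counted from 0) is −j modulo every divisor o of n.  So if z = y⁻¹ is a root of
-- unity of order o ∣ n, then z^maj = y^(Σ j d(Sⱼ₋₁, Sⱼ)).  The terms with o ∣ j drop out,
-- and the sum over all fillings factors over blocks of o columns of equal height h.
--
-- For one block let L(g) = Σ y^(Σ j d) g(content) over all o-tuples of h-sets.
-- Exchanging two adjacent letters preserves L; renaming the smallest letter to the
-- largest one changes Σ j d by its multiplicity, modulo o.  Moving all letters but the
-- smallest once around the cycle therefore gives L(g) = L(y^c g), where c is the
-- multiplicity of the smallest letter: only contents with c ∈ {0, o} contribute.  By
-- symmetry this holds for every letter, and only constant tuples remain.
--
-- Hence the coefficient at z counts the fillings whose columns are constant on blocks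
-- of o columns.  The fillings fixed by a power of φ of order o are those whose columns
-- have period n / o within each block of n columns, and reading such a block as an
-- o × (n / o) array in the two possible orders matches the two kinds of fillings.
module Submission where

open import Algebra.Apartness.Bundles using (HeytingField; HeytingCommutativeRing)
open import Algebra.Bundles using (CommutativeRing)
import Algebra.Properties.CommutativeSemigroup as CommutativeSemigroupProperties
import Algebra.Solver.Ring.NaturalCoefficients.Default as RingSolver
open import Data.Bool.Base using (Bool; true; false; if_then_else_)
import Data.Bool.Properties as Bool
open import Data.Empty using (⊥-elim) renaming (⊥ to Empty)
open import Data.Fin.Base as Fin using (Fin; zero; suc; toℕ; inject₁)
import Data.Fin.Induction as Fin
import Data.Fin.Properties as Fin
open import Data.Fin.Subset using (Subset; ∣_∣; _∈_; _-_; _─_; ⊥)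
open import Data.Fin.Subset.Properties using (_∈?_; ∣⊥∣≡0; ∉⊥; p─⊥≡p; Empty-unique)
open import Data.Irrelevant using ([_])
open import Data.List.Base as List using (List; []; _∷_; filter; length; applyUpTo; upTo; cartesianProductWith)
import Data.List.Membership.Propositional as List
import Data.List.Membership.Propositional.Properties as List
open import Data.List.Membership.Propositional.Properties.WithK using (unique∧set⇒bag)
import Data.List.Properties as List
open import Data.List.Relation.Binary.BagAndSetEquality using (∼bag⇒↭)
open import Data.List.Relation.Binary.Permutation.Propositional using (_↭_; ↭⇒↭ₛ)
open import Data.List.Relation.Binary.Permutation.Propositional.Properties using (↭-length)
import Data.List.Relation.Binary.Permutation.Setoid.Properties as Permutationₛ
open import Data.List.Relation.Unary.All as All using (All; []; _∷_)
import Data.List.Relation.Unary.All.Properties as All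
open import Data.List.Relation.Unary.AllPairs using ([]; _∷_)
open import Data.List.Relation.Unary.Any using (here; there)
open import Data.List.Relation.Unary.Unique.Propositional using (Unique)
import Data.List.Relation.Unary.Unique.Propositional.Properties as Unique
open import Data.Maybe.Base using (Maybe; just; nothing)
open import Data.Nat as ℕ using (ℕ; zero; suc; _≤_; _<_; s≤s; z≤n; NonZero; _∸_)
open import Data.Nat.DivMod
open import Data.Nat.Divisibility
open import Data.Nat.GCD
import Data.Nat.ListAction as ℕ
open import Data.Nat.ListAction.Properties using (sum-++)
import Data.Nat.Properties as ℕ
open import Data.Nat.Tactic.RingSolver using (solve-∀)
open import Data.Product.Base using (_×_; _,_; proj₁; proj₂; ∃)
open import Data.Refinement using (value; _,_)
import Data.Refinement.Properties as Refinement
open import Data.Sum.Base using (_⊎_; inj₁; inj₂)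
open import Data.Unit.Base using (⊤; tt)
open import Data.Vec.Base as Vec using (Vec; []; _∷_; here; there; _∷ʳ_; _++_)
import Data.Vec.Properties as Vec
open import Data.Vec.Relation.Unary.All as AllV using ([]; _∷_)
import Data.Vec.Relation.Unary.All.Properties as AllV
open import Function.Base using (_∘_; const; id)
open import Function.Bundles using (_↔_; _⇔_; mk⇔; mk↔ₛ′; Equivalence; Inverse)
open import Level using (Level)
open import Relation.Binary.Definitions using (tri<; tri≈; tri>)
import Relation.Binary.PropositionalEquality as ≡
open ≡ using (_≡_; _≢_)
open import Relation.Nullary using (Dec; does; yes; no; ¬_; _×-dec_; _⊎-dec_; recompute)
open import Relation.Nullary.Decidable using (dec-true; dec-false; does-⇔)
open import Relation.Unary using (Decidable)
open import Defs

-- The delicate step is the exchange of two adjacent letters. For a fixed preceding column the sum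
-- over its continuations need not be symmetric in them, so a column containing just one of the two
-- letters is summed together with its mirror image; the claims for a single starting column and for
-- such a pair are proved by simultaneous induction on the number of remaining columns. Among the
-- transitions between mixed columns only one, from the smaller letter alone to the larger alone,
-- has an excess of its own, because the truncation at 0 shows there. Its contribution is symmetric
-- by itself and can be subtracted.
--
-- L is treated as a linear functional on all functions of the content, not coefficient by
-- coefficient: a factor y^c or a restriction of c is then absorbed into the test function, and
-- statements for all g can be iterated.
--
-- The e-th power of φ reads every column e(n - 1) places further on, which is -e modulo n. With y =
-- ξ^(e(n - 1)) the shift and y are governed by the same number gcd(e(n - 1), n), and y is the
-- inverse of ξ^e. The field enters the block argument only through cancellation: y^k a = a with 0 <
-- k < o forces a = 0.

private variable
  ℓᵃ ℓᵇ : Level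
  A : Set ℓᵃ
  B : Set ℓᵇ
  m r : ℕ
  μ : List ℕ

module _ where

  open import Data.Nat hiding (∣_-_∣)
  open import Data.Nat.ListAction using (sum)
  open import Relation.Binary.PropositionalEquality hiding ([_])
  open CommutativeSemigroupProperties ℕ.+-commutativeSemigroup using (x∙yz≈y∙xz)

  -- The excess of a column over the next one

  bit : Bool → ℕ
  bit true  = 1
  bit false = 0

  -- The maximum over t ≥ 0 of ∣S ∩ [t]∣ − ∣T ∩ [t]∣; truncation at 0 accounts for t = 0.
  excess : Subset m → Subset m → ℕ
  excess []          []          = 0
  excess (true ∷ S)  (true ∷ T)  = excess S T
  excess (true ∷ S)  (false ∷ T) = suc (excess S T)
  excess (false ∷ S) (true ∷ T)  = pred (excess S T)
  excess (false ∷ S) (false ∷ T) = excess S T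

  excess-refl : (S : Subset m) → excess S S ≡ 0
  excess-refl []          = refl
  excess-refl (true ∷ S)  = excess-refl S
  excess-refl (false ∷ S) = excess-refl S

  excess-⊥ : (S : Subset m) → excess S ⊥ ≡ ∣ S ∣
  excess-⊥ []          = refl
  excess-⊥ (true ∷ S)  = cong suc (excess-⊥ S)
  excess-⊥ (false ∷ S) = excess-⊥ S

  -- Truncation is harmless: `suc (a ∸ b)` and `suc a ∸ b` differ only if `a < b`, and then both
  -- sides are `suc e`.
  suc-⊔-∸ : ∀ e a b → suc (e ⊔ (a ∸ b)) ≡ suc e ⊔ (suc a ∸ b)
  suc-⊔-∸ e a       zero    = refl
  suc-⊔-∸ e zero    (suc b) = trans (cong suc (ℕ.⊔-identityʳ e))
    (sym (trans (cong (suc e ⊔_) (ℕ.0∸n≡0 b)) (ℕ.⊔-identityʳ (suc e))))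
  suc-⊔-∸ e (suc a) (suc b) = suc-⊔-∸ e a b

  pred-⊔-∸ : ∀ e a b → pred (e ⊔ (a ∸ b)) ≡ pred e ⊔ (a ∸ suc b)
  pred-⊔-∸ e a b = trans (ℕ.mono-≤-distrib-⊔ ℕ.pred-mono-≤ e (a ∸ b))
    (cong (pred e ⊔_) (ℕ.pred[m∸n]≡m∸[1+n] a b))

  -- A new largest letter adds one value of t to the maximum, at which both sets are counted in
  -- full.
  excess-∷ʳ : (S T : Subset m) (a b : Bool) →
              excess (S ∷ʳ a) (T ∷ʳ b) ≡ excess S T ⊔ (bit a + ∣ S ∣ ∸ (bit b + ∣ T ∣))
  excess-∷ʳ []          []          true  true  = refl
  excess-∷ʳ []          []          true  false = refl
  excess-∷ʳ []          []          false true  = refl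
  excess-∷ʳ []          []          false false = refl
  excess-∷ʳ (true ∷ S)  (true ∷ T)  a b rewrite ℕ.+-suc (bit a) ∣ S ∣ | ℕ.+-suc (bit b) ∣ T ∣ =
    excess-∷ʳ S T a b
  excess-∷ʳ (true ∷ S)  (false ∷ T) a b rewrite ℕ.+-suc (bit a) ∣ S ∣ =
    trans (cong suc (excess-∷ʳ S T a b)) (suc-⊔-∸ (excess S T) (bit a + ∣ S ∣) (bit b + ∣ T ∣))
  excess-∷ʳ (false ∷ S) (true ∷ T)  a b rewrite ℕ.+-suc (bit b) ∣ T ∣ =
    trans (cong pred (excess-∷ʳ S T a b)) (pred-⊔-∸ (excess S T) (bit a + ∣ S ∣) (bit b + ∣ T ∣))
  excess-∷ʳ (false ∷ S) (false ∷ T) a b = excess-∷ʳ S T a b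

  ∣S∣≤excess+∣T∣ : (S T : Subset m) → ∣ S ∣ ≤ excess S T + ∣ T ∣
  ∣S∣≤excess+∣T∣ []          []          = z≤n
  ∣S∣≤excess+∣T∣ (true ∷ S)  (true ∷ T)  rewrite ℕ.+-suc (excess S T) ∣ T ∣ = s≤s (∣S∣≤excess+∣T∣ S T)
  ∣S∣≤excess+∣T∣ (true ∷ S)  (false ∷ T) = s≤s (∣S∣≤excess+∣T∣ S T)
  ∣S∣≤excess+∣T∣ (false ∷ S) (true ∷ T)  = ℕ.≤-trans (∣S∣≤excess+∣T∣ S T)
    (ℕ.≤-trans (ℕ.+-monoˡ-≤ ∣ T ∣ (ℕ.m≤n+m∸n (excess S T) 1)) (ℕ.≤-reflexive (sym (ℕ.+-suc _ ∣ T ∣))))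
  ∣S∣≤excess+∣T∣ (false ∷ S) (false ∷ T) = ∣S∣≤excess+∣T∣ S T

  rotate : ∀ {a} {A : Set a} → Vec A (suc m) → Vec A (suc m)
  rotate (x ∷ xs) = xs ∷ʳ x

  ∣∷∣ : (a : Bool) (S : Subset m) → ∣ a ∷ S ∣ ≡ bit a + ∣ S ∣
  ∣∷∣ true  S = refl
  ∣∷∣ false S = refl

  ∣∷ʳ∣ : (a : Bool) (S : Subset m) → ∣ S ∷ʳ a ∣ ≡ ∣ a ∷ S ∣
  ∣∷ʳ∣ a []          = refl
  ∣∷ʳ∣ true  (true ∷ S)  = cong suc (∣∷ʳ∣ true S)
  ∣∷ʳ∣ false (true ∷ S)  = cong suc (∣∷ʳ∣ false S)
  ∣∷ʳ∣ true  (false ∷ S) = ∣∷ʳ∣ true S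
  ∣∷ʳ∣ false (false ∷ S) = ∣∷ʳ∣ false S

  -- Renaming the smallest letter to the largest one, stated without subtraction.
  excess-rotate : ∀ (a b : Bool) (S T : Subset m) → ∣ a ∷ S ∣ ≡ ∣ b ∷ T ∣ →
                  excess (a ∷ S) (b ∷ T) + bit b ≡ excess (S ∷ʳ a) (T ∷ʳ b) + bit a
  excess-rotate a b S T eq = begin
    excess (a ∷ S) (b ∷ T) + bit b          ≡⟨ front a b (∣S∣≤excess+∣T∣ S T) eq ⟩
    excess S T + bit a                      ≡⟨ cong (_+ bit a) (ℕ.⊔-identityʳ (excess S T)) ⟨
    excess S T ⊔ 0 + bit a                  ≡⟨ cong (λ k → excess S T ⊔ k + bit a) (ℕ.m≤n⇒m∸n≡0 (ℕ.≤-reflexive eq′)) ⟨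
    excess S T ⊔ (bit a + ∣ S ∣ ∸ (bit b + ∣ T ∣)) + bit a ≡⟨ cong (_+ bit a) (excess-∷ʳ S T a b) ⟨
    excess (S ∷ʳ a) (T ∷ʳ b) + bit a        ∎
    where
    open ≡-Reasoning
    eq′ = trans (sym (∣∷∣ a S)) (trans eq (∣∷∣ b T))
    front : ∀ a b → ∣ S ∣ ≤ excess S T + ∣ T ∣ → ∣ a ∷ S ∣ ≡ ∣ b ∷ T ∣ →
            excess (a ∷ S) (b ∷ T) + bit b ≡ excess S T + bit a
    front true  true  h eq = refl
    front true  false h eq = trans (ℕ.+-identityʳ (suc (excess S T))) (ℕ.+-comm 1 (excess S T))
    front false false h eq = refl
    -- Here `excess` takes a predecessor. Since `∣ S ∣` is `suc ∣ T ∣`, the excess is positive and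
    -- nothing is truncated.
    front false true  h eq with excess S T
    ... | zero  = ⊥-elim (ℕ.<⇒≱ (ℕ.≤-reflexive (sym eq)) h)
    ... | suc e = trans (ℕ.+-comm e 1) (sym (ℕ.+-identityʳ (suc e)))

  -- Here S is column j, and v consists of the columns after it.
  energy : ℕ → Subset m → Vec (Subset m) r → ℕ
  energy j S []      = 0
  energy j S (T ∷ v) = suc j * excess S T + energy (suc j) T v

  infixr 6 _⊞_

  _⊞_ : Subset m → Vec ℕ m → Vec ℕ m
  S ⊞ c = Vec.zipWith (λ b k → bit b + k) S c

  multiplicities : Vec (Subset m) r → Vec ℕ m
  multiplicities []      = Vec.replicate _ 0
  multiplicities (S ∷ v) = S ⊞ multiplicities v

  headBit : Subset (suc m) → ℕ
  headBit S = bit (Vec.head S)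

  excess-rotate′ : ∀ (S T : Subset (suc m)) → ∣ S ∣ ≡ ∣ T ∣ →
                   excess S T + headBit T ≡ excess (rotate S) (rotate T) + headBit S
  excess-rotate′ (a ∷ S) (b ∷ T) = excess-rotate a b S T

  -- Abel summation: each excess changes by the difference of the head bits of two consecutive
  -- columns, and the weights, growing by 1, turn these differences into the multiplicity of the
  -- smallest letter. For `j = 0` the boundary term at the last column has the number of columns as
  -- a factor, so it disappears modulo the block width.
  energy-rotate : ∀ h j (S : Subset (suc m)) (v : Vec (Subset (suc m)) r) →
    ∣ S ∣ ≡ h → (∀ i → ∣ Vec.lookup v i ∣ ≡ h) →
    energy j S v + suc (j + r) * headBit (Vec.last (S ∷ v)) ≡
    energy j (rotate S) (Vec.map rotate v) + (Vec.head (multiplicities (S ∷ v)) + j * headBit S)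
  energy-rotate h j S@(a ∷ _) [] eq eqs rewrite ℕ.+-identityʳ j | ℕ.+-identityʳ (bit a) = refl
  energy-rotate {r = suc r} h j S@(a ∷ _) (T@(b ∷ _) ∷ v) eq eqs
    with multiplicities v | energy-rotate h (suc j) T v (eqs zero) (eqs ∘ suc)
       | excess-rotate′ S T (trans eq (sym (eqs zero)))
  ... | c ∷ _ | ih | ex rewrite ℕ.+-suc j r = begin
    suc j * e + W + w                                  ≡⟨ ℕ.+-assoc (suc j * e) W w ⟩
    suc j * e + (W + w)                                ≡⟨ cong (suc j * e +_) ih ⟩
    suc j * e + (W′ + (bit b + c + suc j * bit b))     ≡⟨ reorder j e W′ (bit b) c ⟩
    suc j * (e + bit b) + W′ + bit b + c               ≡⟨ cong (λ x → suc j * x + W′ + bit b + c) ex ⟩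
    suc j * (e′ + bit a) + W′ + bit b + c              ≡⟨ reorder′ j e′ W′ (bit a) (bit b) c ⟩
    suc j * e′ + W′ + (bit a + (bit b + c) + j * bit a) ∎
    where
    open ≡-Reasoning
    e  = excess S T
    e′ = excess (rotate S) (rotate T)
    W  = energy (suc j) T v
    W′ = energy (suc j) (rotate T) (Vec.map rotate v)
    w  = suc (suc (j + r)) * headBit (Vec.last (T ∷ v))
    reorder : ∀ j e W′ b c → suc j * e + (W′ + (b + c + suc j * b)) ≡ suc j * (e + b) + W′ + b + c
    reorder = solve-∀
    reorder′ : ∀ j e′ W′ a b c → suc j * (e′ + a) + W′ + b + c ≡ suc j * e′ + W′ + (a + (b + c) + j * a)
    reorder′ = solve-∀

  -- Up to `x` nothing of `T` is counted, so the maximum is at least 1 and is attained at `x` or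
  -- later, where removing `x` lowers every difference by 1.
  excess-remove-below : (S T : Subset m) {x : Fin m} → x ∈ S → (∀ {z} → z ∈ T → x Fin.< z) →
                        excess S T ≡ suc (excess (S - x) T)
  excess-remove-below (true ∷ S) (true ∷ T) {x} x∈ below with () ← below {zero} here
  excess-remove-below (true ∷ S) (false ∷ T) {zero} here below = cong (λ S → suc (excess S T)) (sym (p─⊥≡p S))
  excess-remove-below (false ∷ S) (true ∷ T) {x} x∈ below with () ← below {zero} here
  excess-remove-below (true ∷ S) (false ∷ T) {suc x} (there x∈) below =
    cong suc (excess-remove-below S T x∈ (s≤s⁻¹ ∘ below ∘ there))
  excess-remove-below (false ∷ S) (false ∷ T) {suc x} (there x∈) below =
    excess-remove-below S T x∈ (s≤s⁻¹ ∘ below ∘ there)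

  -- Only the differences from `y` on are raised. There `T` is exhausted, so they grow with t and
  -- the last one stands for all of them.
  excess-remove-max : (S T : Subset m) {y : Fin m} → y ∈ T → (∀ {z} → z ∈ T → z Fin.≤ y) →
                      excess S (T - y) ≡ excess S T ⊔ (suc ∣ S ∣ ∸ ∣ T ∣)
  excess-remove-max {m = suc m} (a ∷ S) (true ∷ T) {zero} here max
    with Empty-unique {p = T} (λ (z , z∈) → ℕ.<⇒≱ z<s (max (there z∈)))
  ... | refl = trans (cong (λ T → excess (a ∷ S) (false ∷ T)) (p─⊥≡p ⊥)) (lemma a)
    where
    lemma : ∀ a → excess (a ∷ S) (false ∷ ⊥) ≡ excess (a ∷ S) (true ∷ ⊥) ⊔ (suc ∣ a ∷ S ∣ ∸ suc ∣ ⊥ {n = m} ∣)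
    lemma true  rewrite excess-⊥ S | ∣⊥∣≡0 m = sym (ℕ.m≤n⇒m⊔n≡n (ℕ.n≤1+n _))
    lemma false rewrite excess-⊥ S | ∣⊥∣≡0 m = sym (ℕ.m≤n⇒m⊔n≡n ℕ.pred[n]≤n)
  excess-remove-max (true ∷ S) (true ∷ T) {suc y} (there y∈) max =
    excess-remove-max S T y∈ (s≤s⁻¹ ∘ max ∘ there)
  excess-remove-max (true ∷ S) (false ∷ T) {suc y} (there y∈) max =
    trans (cong suc (excess-remove-max S T y∈ (s≤s⁻¹ ∘ max ∘ there))) (suc-⊔-∸ _ (suc ∣ S ∣) ∣ T ∣)
  excess-remove-max (false ∷ S) (true ∷ T) {suc y} (there y∈) max =
    trans (cong pred (excess-remove-max S T y∈ (s≤s⁻¹ ∘ max ∘ there))) (pred-⊔-∸ (excess S T) (suc ∣ S ∣) ∣ T ∣)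
  excess-remove-max (false ∷ S) (false ∷ T) {suc y} (there y∈) max =
    excess-remove-max S T y∈ (s≤s⁻¹ ∘ max ∘ there)

  -- The two removals raise the differences by 1 from `y` up to just before `x` and change nothing
  -- else. No further element of `T` lies in that range, so the raised values do not exceed the
  -- value at `x`, where `S` gains an element.
  excess-remove-≤ : (S T : Subset m) {x y : Fin m} → x ∈ S → y ∈ T → y Fin.≤ x →
    (∀ {z} → z ∈ T → z Fin.≤ x → z Fin.≤ y) → excess S T ≡ excess (S - x) (T - y)
  excess-remove-≤ (true ∷ S) (true ∷ T) {zero} {zero} here here _ _ =
    sym (cong₂ excess (p─⊥≡p S) (p─⊥≡p T))
  excess-remove-≤ (a ∷ S) (true ∷ T) {suc x} {zero} (there x∈) here _ max = trans (lemma a) (cong (λ T → excess (a ∷ (S - x)) (false ∷ T)) (sym (p─⊥≡p T)))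
    where
    step : excess S T ≡ suc (excess (S - x) T)
    step = excess-remove-below S T x∈ λ z∈ → ℕ.≰⇒> λ z≤x → ℕ.<⇒≱ z<s (max (there z∈) (s≤s z≤x))
    lemma : ∀ a → excess (a ∷ S) (true ∷ T) ≡ excess (a ∷ (S - x)) (false ∷ T)
    lemma true = step
    lemma false = cong pred step
  excess-remove-≤ (a ∷ S) (b ∷ T) {suc x} {suc y} (there x∈) (there y∈) (s≤s y≤x) max = lemma a b
    where
    ih = excess-remove-≤ S T x∈ y∈ y≤x λ z∈ z≤x → s≤s⁻¹ (max (there z∈) (s≤s z≤x))
    lemma : ∀ a b → excess (a ∷ S) (b ∷ T) ≡ excess (a ∷ (S - x)) (b ∷ (T - y))
    lemma true  true  = ih
    lemma true  false = cong suc ih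
    lemma false true  = cong pred ih
    lemma false false = ih

  descent : (x y : Fin m) → ℕ
  descent x y = bit (does (x Fin.<? y))

  -- Hence the descents between two columns of equal height are counted by the excess,
  -- whatever the order of the rows.
  excess-best : (S T : Subset m) {x y : Fin m} → ∣ S ∣ ≡ ∣ T ∣ → x ∈ S → Best (just x) T y →
                excess S T ≡ descent x y + excess (S - x) (T - y)
  excess-best S T {x} {y} eq x∈ (y∈ , best) with x Fin.<? y
  ... | yes x<y = begin
    excess S T                                          ≡⟨ excess-remove-below S T x∈ above ⟩
    suc (excess (S - x) T)                              ≡⟨ cong suc (ℕ.⊔-identityʳ _) ⟨
    -- Equal heights make the extra term of `excess-remove-max` vanish, because `x` has already been
    -- removed from `S`.
    suc (excess (S - x) T ⊔ 0)                          ≡⟨ cong (λ k → suc (excess (S - x) T ⊔ k))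
                                                             (ℕ.m≤n⇒m∸n≡0 (ℕ.≤-reflexive (trans (∣p-x∣ x∈) eq))) ⟨
    suc (excess (S - x) T ⊔ (suc ∣ S - x ∣ ∸ ∣ T ∣))    ≡⟨ cong suc (excess-remove-max (S - x) T y∈ max) ⟨
    suc (excess (S - x) (T - y))                        ≡⟨ cong (λ b → bit b + excess (S - x) (T - y))
                                                             (dec-true (x Fin.<? y) x<y) ⟨
    descent x y + excess (S - x) (T - y)                ∎
    where
    open ≡-Reasoning
    between : ∀ {z} → z ∈ T → z ≢ y → x Fin.< z × z Fin.< y
    between z∈ z≢y with best z∈ z≢y
    ... | inj₁ (y≤x , _)        = ⊥-elim (ℕ.<⇒≱ x<y y≤x)
    ... | inj₂ (inj₁ x<z<y)     = x<z<y
    ... | inj₂ (inj₂ (_ , y≤x)) = ⊥-elim (ℕ.<⇒≱ x<y y≤x)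
    above : ∀ {z} → z ∈ T → x Fin.< z
    above {z} z∈ with z Fin.≟ y
    ... | yes refl = x<y
    ... | no  z≢y  = proj₁ (between z∈ z≢y)
    max : ∀ {z} → z ∈ T → z Fin.≤ y
    max {z} z∈ with z Fin.≟ y
    ... | yes refl = ℕ.≤-refl
    ... | no  z≢y  = ℕ.<⇒≤ (proj₂ (between z∈ z≢y))
  ... | no x≮y = trans (excess-remove-≤ S T x∈ y∈ (ℕ.≮⇒≥ x≮y) max)
    (sym (cong (λ b → bit b + excess (S - x) (T - y)) (dec-false (x Fin.<? y) x≮y)))
    where
    max : ∀ {z} → z ∈ T → z Fin.≤ x → z Fin.≤ y
    max {z} z∈ z≤x with z Fin.≟ y
    ... | yes refl = ℕ.≤-refl
    ... | no  z≢y with best z∈ z≢y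
    ...   | inj₁ (_ , x<z)        = ⊥-elim (ℕ.<⇒≱ x<z z≤x)
    ...   | inj₂ (inj₁ (x<z , _)) = ⊥-elim (ℕ.<⇒≱ x<z z≤x)
    ...   | inj₂ (inj₂ (z<y , _)) = ℕ.<⇒≤ z<y

  -- Tuples of column sets, their multiplicities, and rotations of the alphabet

  subsets : ∀ m → List (Subset m)
  subsets zero    = [] ∷ []
  subsets (suc m) = List.map (false ∷_) (subsets m) List.++ List.map (true ∷_) (subsets m)

  subsetsOfSize : ∀ m → ℕ → List (Subset m)
  subsetsOfSize m h = filter (λ S → ∣ S ∣ ℕ.≟ h) (subsets m)

  tuples : ∀ m → (ℕ → ℕ) → (r : ℕ) → List (Vec (Subset m) r)
  tuples m h zero    = [] ∷ []
  tuples m h (suc r) = cartesianProductWith _∷_ (subsetsOfSize m (h 0)) (tuples m (h ∘ suc) r)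

  swap : ∀ {a m} {A : Set a} → Vec A (suc (suc m)) → Vec A (suc (suc m))
  swap (a ∷ b ∷ c) = b ∷ a ∷ c

  swap-⊞ : ∀ {m} (S : Subset (suc (suc m))) c → swap (S ⊞ c) ≡ swap S ⊞ swap c
  swap-⊞ (a ∷ b ∷ S) (x ∷ y ∷ c) = refl

  ⊞-∷ʳ : ∀ (S : Subset m) b c x → (S ∷ʳ b) ⊞ (c ∷ʳ x) ≡ (S ⊞ c) ∷ʳ (bit b + x)
  ⊞-∷ʳ []      b []      x = refl
  ⊞-∷ʳ (_ ∷ S) b (_ ∷ c) x = cong (_ ∷_) (⊞-∷ʳ S b c x)

  rotate-⊞ : ∀ (S : Subset (suc m)) c → rotate S ⊞ rotate c ≡ rotate (S ⊞ c)
  rotate-⊞ (a ∷ S) (x ∷ c) = ⊞-∷ʳ S a c x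

  replicate-∷ʳ : ∀ m (x : A) → Vec.replicate m x ∷ʳ x ≡ x ∷ Vec.replicate m x
  replicate-∷ʳ zero    x = refl
  replicate-∷ʳ (suc m) x = cong (x ∷_) (replicate-∷ʳ m x)

  multiplicities-rotate : ∀ (v : Vec (Subset (suc m)) r) →
    multiplicities (Vec.map rotate v) ≡ rotate (multiplicities v)
  multiplicities-rotate []      = sym (replicate-∷ʳ _ 0)
  multiplicities-rotate (S ∷ v) = trans (cong (rotate S ⊞_) (multiplicities-rotate v)) (rotate-⊞ S _)

  lookup-rotate-last : ∀ (c : Vec A (suc m)) → Vec.lookup (rotate c) (Fin.fromℕ m) ≡ Vec.lookup c zero
  lookup-rotate-last (x ∷ c) = go c
    where
    go : ∀ {x : A} {m} (c : Vec A m) → Vec.lookup (c ∷ʳ x) (Fin.fromℕ m) ≡ x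
    go []      = refl
    go (_ ∷ c) = go c

  lookup-rotate-inject₁ : ∀ (c : Vec A (suc m)) i → Vec.lookup (rotate c) (inject₁ i) ≡ Vec.lookup c (suc i)
  lookup-rotate-inject₁ (x ∷ c) i = go c i
    where
    go : ∀ {x : A} {m} (c : Vec A m) i → Vec.lookup (c ∷ʳ x) (inject₁ i) ≡ Vec.lookup c i
    go (_ ∷ c) zero    = refl
    go (_ ∷ c) (suc i) = go c i

  rotations : ℕ → Vec A (suc m) → Vec A (suc m)
  rotations zero    c = c
  rotations (suc i) c = rotations i (rotate c)

  -- The total multiplicity of the letters that the `i` rotations send from the front to the end.
  passed : ℕ → Vec ℕ (suc m) → ℕ
  passed zero    c = 0
  passed (suc i) c = Vec.head c + passed i (rotate c)

  toList-rotate : ∀ {x : A} {xs} (c : Vec A (suc m)) → Vec.toList c ≡ x ∷ xs →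
                  Vec.toList (rotate c) ≡ xs List.++ List.[ x ]
  toList-rotate (x ∷ c) refl = Vec.toList-∷ʳ x c

  toList-rotations : ∀ xs ys (c : Vec A (suc m)) → Vec.toList c ≡ xs List.++ ys →
                     Vec.toList (rotations (List.length xs) c) ≡ ys List.++ xs
  toList-rotations []       ys c eq = trans eq (sym (List.++-identityʳ ys))
  toList-rotations (x ∷ xs) ys c eq = trans
    (toList-rotations xs (ys List.++ List.[ x ]) (rotate c) (trans (toList-rotate c eq) (List.++-assoc xs ys _)))
    (List.++-assoc ys List.[ x ] xs)

  passed-sum : ∀ xs ys (c : Vec ℕ (suc m)) → Vec.toList c ≡ xs List.++ ys → passed (List.length xs) c ≡ sum xs
  passed-sum []       ys c         eq   = refl
  passed-sum (x ∷ xs) ys c@(_ ∷ _) eq = cong₂ _+_ (List.∷-injectiveˡ eq)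
    (passed-sum xs (ys List.++ List.[ x ]) (rotate c) (trans (toList-rotate c eq) (List.++-assoc xs ys _)))

  sum-toList : ∀ (c : Vec ℕ m) → sum (Vec.toList c) ≡ Vec.sum c
  sum-toList []      = refl
  sum-toList (x ∷ c) = cong (x +_) (sum-toList c)

  rotations-full : ∀ (c : Vec A (suc m)) → rotations (suc m) c ≡ c
  rotations-full {m = m} c = trans (sym (Vec.cast-is-id refl _)) (Vec.toList-injective refl _ _
    (trans (cong (λ i → Vec.toList (rotations i c)) (sym (Vec.length-toList c)))
      (toList-rotations (Vec.toList c) [] c (sym (List.++-identityʳ _)))))

  passed-full : ∀ (c : Vec ℕ (suc m)) → passed (suc m) c ≡ Vec.sum c
  passed-full c = trans (cong (λ i → passed i c) (sym (Vec.length-toList c)))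
    (trans (passed-sum (Vec.toList c) [] c (sym (List.++-identityʳ _))) (sum-toList c))

  ∈-tuples-size : ∀ m (h : ℕ → ℕ) r {v : Vec (Subset m) r} → v List.∈ tuples m h r →
                  ∀ i → ∣ Vec.lookup v i ∣ ≡ h (toℕ i)
  ∈-tuples-size m h (suc r) v∈ i
    with List.∈-cartesianProductWith⁻ _∷_ (subsetsOfSize m (h 0)) (tuples m (h ∘ suc) r) v∈
  ... | S , w , S∈ , w∈ , refl with i
  ...   | zero  = proj₂ (List.∈-filter⁻ (λ S → ∣ S ∣ ℕ.≟ h 0) {xs = subsets m} S∈)
  ...   | suc i = ∈-tuples-size m (h ∘ suc) r w∈ i

  sum-⊞ : ∀ (S : Subset m) c → Vec.sum (S ⊞ c) ≡ ∣ S ∣ + Vec.sum c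
  sum-⊞ []          []      = refl
  sum-⊞ (true ∷ S)  (x ∷ c) = cong suc (trans (cong (x +_) (sum-⊞ S c)) (x∙yz≈y∙xz x ∣ S ∣ _))
  sum-⊞ (false ∷ S) (x ∷ c) = trans (cong (x +_) (sum-⊞ S c)) (x∙yz≈y∙xz x ∣ S ∣ _)

  sum-multiplicities : ∀ h (v : Vec (Subset m) r) → (∀ i → ∣ Vec.lookup v i ∣ ≡ h) →
                       Vec.sum (multiplicities v) ≡ r * h
  sum-multiplicities {m = m} h []      eq = go m
    where
    go : ∀ m → Vec.sum (Vec.replicate m 0) ≡ 0
    go zero    = refl
    go (suc m) = go m
  sum-multiplicities h (S ∷ v) eq =
    trans (sum-⊞ S _) (cong₂ _+_ (eq zero) (sum-multiplicities h v (eq ∘ suc)))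

  -- Constant tuples, recognised by their multiplicities

  Constant : ∀ {A : Set} → Vec A r → Set
  Constant []      = ⊤
  Constant (x ∷ v) = AllV.All (x ≡_) v

  -- Gap q x excludes 0 < x ≤ q.
  Gap : ℕ → ℕ → Set
  Gap q x = x ≡ 0 ⊎ q < x

  gap? : ∀ q x → Dec (Gap q x)
  gap? q x = (x ℕ.≟ 0) ⊎-dec (q ℕ.<? x)

  multiplicity : ∀ (S : Subset m) c i → Vec.lookup (S ⊞ c) i ≡ bit (Vec.lookup S i) + Vec.lookup c i
  multiplicity S c i = Vec.lookup-zipWith _ i S c

  multiplicity-const : ∀ {S : Subset m} (v : Vec (Subset m) r) → AllV.All (S ≡_) v → ∀ i →
                       Vec.lookup (multiplicities v) i ≡ r * bit (Vec.lookup S i)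
  multiplicity-const []      []          i = Vec.lookup-replicate i 0
  multiplicity-const (S ∷ v) (refl ∷ eqs) i =
    trans (multiplicity S (multiplicities v) i) (cong (bit (Vec.lookup S i) +_) (multiplicity-const v eqs i))

  constant⇒gap : ∀ (v : Vec (Subset m) (suc r)) → Constant v → ∀ i → Gap r (Vec.lookup (multiplicities v) i)
  constant⇒gap {r = r} (S ∷ v) eqs i
    rewrite multiplicity-const (S ∷ v) (refl ∷ eqs) i with Vec.lookup S i
  ... | true  = inj₂ (ℕ.≤-reflexive (sym (ℕ.*-identityʳ (suc r))))
  ... | false = inj₁ (ℕ.*-zeroʳ (suc r))

  multiplicity-≤ : ∀ (v : Vec (Subset m) r) i → Vec.lookup (multiplicities v) i ≤ r
  multiplicity-≤ []      i = ℕ.≤-reflexive (Vec.lookup-replicate i 0)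
  multiplicity-≤ (S ∷ v) i rewrite multiplicity S (multiplicities v) i with Vec.lookup S i
  ... | true  = s≤s (multiplicity-≤ v i)
  ... | false = ℕ.m≤n⇒m≤1+n (multiplicity-≤ v i)

  multiplicity-full : ∀ (v : Vec (Subset m) r) i → r ≤ Vec.lookup (multiplicities v) i →
                      ∀ j → Vec.lookup (Vec.lookup v j) i ≡ true
  multiplicity-full {r = suc r} (S ∷ v) i r≤ j rewrite multiplicity S (multiplicities v) i with Vec.lookup S i in eq
  ... | false = ⊥-elim (ℕ.<⇒≱ r≤ (multiplicity-≤ v i))
  ... | true with j
  ...   | zero  = eq
  ...   | suc j = multiplicity-full v i (ℕ.s≤s⁻¹ r≤) j

  multiplicity-zero : ∀ (v : Vec (Subset m) r) i → Vec.lookup (multiplicities v) i ≡ 0 →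
                      ∀ j → Vec.lookup (Vec.lookup v j) i ≡ false
  multiplicity-zero {r = suc r} (S ∷ v) i ≡0 j rewrite multiplicity S (multiplicities v) i with Vec.lookup S i in eq
  ... | false with j
  ...   | zero  = eq
  ...   | suc j = multiplicity-zero v i ≡0 j

  lookup-ext : ∀ {S T : Vec A m} → (∀ i → Vec.lookup S i ≡ Vec.lookup T i) → S ≡ T
  lookup-ext {S = S} {T} eq =
    trans (sym (Vec.tabulate∘lookup S)) (trans (Vec.tabulate-cong eq) (Vec.tabulate∘lookup T))

  -- A letter of multiplicity 0 is in no column, and one whose multiplicity reaches the number of
  -- columns is in all of them; so the columns agree letter by letter.
  gap⇒constant : ∀ (v : Vec (Subset m) (suc r)) → (∀ i → Gap r (Vec.lookup (multiplicities v) i)) → Constant v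
  gap⇒constant (S ∷ v) gap = AllV.lookup⁻ λ j → lookup-ext λ i → same i j (gap i)
    where
    same : ∀ i j → Gap _ _ → Vec.lookup S i ≡ Vec.lookup (Vec.lookup v j) i
    same i j (inj₁ ≡0) = trans (multiplicity-zero (S ∷ v) i ≡0 zero) (sym (multiplicity-zero (S ∷ v) i ≡0 (suc j)))
    same i j (inj₂ r<) = trans (multiplicity-full (S ∷ v) i r< zero) (sym (multiplicity-full (S ∷ v) i r< (suc j)))

  energy-constant : ∀ j {S : Subset m} (v : Vec (Subset m) r) → AllV.All (S ≡_) v → energy j S v ≡ 0
  energy-constant j     []      []           = refl
  energy-constant j {S} (_ ∷ v) (refl ∷ eqs) rewrite excess-refl S | ℕ.*-zeroʳ j = energy-constant (suc j) v eqs

  energy₀ : ∀ {m r} → Vec (Subset m) r → ℕ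
  energy₀ []      = 0
  energy₀ (S ∷ v) = energy 0 S v

  constant? : ∀ {m r} → Decidable (Constant {r = r} {A = Subset m})
  constant? []      = yes tt
  constant? (S ∷ v) = AllV.all? (Vec.≡-dec Bool._≟_ S) v

  BlockConstant : ∀ {m} o B → Vec (Subset m) (B * o) → Set
  BlockConstant o zero    v = ⊤
  BlockConstant o (suc B) v = Constant (Vec.take o v) × BlockConstant o B (Vec.drop o v)

  blockConstant? : ∀ {m} o B → Decidable (BlockConstant {m} o B)
  blockConstant? o zero    v = yes tt
  blockConstant? o (suc B) v = constant? (Vec.take o v) ×-dec blockConstant? o B (Vec.drop o v)

  ⊞-+ : ∀ {m} (S : Subset m) c d → S ⊞ Vec.zipWith _+_ c d ≡ Vec.zipWith _+_ (S ⊞ c) d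
  ⊞-+ []      []      []      = refl
  ⊞-+ (b ∷ S) (x ∷ c) (y ∷ d) = cong₂ _∷_ (sym (ℕ.+-assoc (bit b) x y)) (⊞-+ S c d)

  multiplicities-++ : ∀ {m r s} (u : Vec (Subset m) r) (w : Vec (Subset m) s) →
    multiplicities (u ++ w) ≡ Vec.zipWith _+_ (multiplicities u) (multiplicities w)
  multiplicities-++ []      w = sym (Vec.zipWith-identityˡ ℕ.+-identityˡ (multiplicities w))
  multiplicities-++ (S ∷ u) w = trans (cong (S ⊞_) (multiplicities-++ u w)) (⊞-+ S _ _)

  tuples-cong : ∀ m r {h h′ : ℕ → ℕ} → (∀ i → i < r → h i ≡ h′ i) → tuples m h r ≡ tuples m h′ r
  tuples-cong m zero    eq = refl
  tuples-cong m (suc r) eq = cong₂ (cartesianProductWith _∷_)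
    (cong (subsetsOfSize m) (eq 0 (s≤s z≤n))) (tuples-cong m r λ i i<r → eq (suc i) (s≤s i<r))

  prefix : ∀ {a} {A : Set a} N → (ℕ → A) → Vec A N
  prefix zero    f = []
  prefix (suc N) f = f 0 ∷ prefix N (f ∘ suc)

  prefix-cong : ∀ {a} {A : Set a} N {f g : ℕ → A} → (∀ i → i < N → f i ≡ g i) → prefix N f ≡ prefix N g
  prefix-cong zero    eq = refl
  prefix-cong (suc N) eq = cong₂ _∷_ (eq 0 z<s) (prefix-cong N λ i i<N → eq (suc i) (s<s i<N))

  prefix-injective : ∀ {a} {A : Set a} N {f g : ℕ → A} → prefix N f ≡ prefix N g → ∀ i → i < N → f i ≡ g i
  prefix-injective (suc N) eq zero    _   = Vec.∷-injectiveˡ eq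
  prefix-injective (suc N) eq (suc i) i<N = prefix-injective N (Vec.∷-injectiveʳ eq) i (s<s⁻¹ i<N)

  -- The sizes of consecutive columns agree except where a new block of o columns starts.
  Flat : ∀ {m} → ℕ → (ℕ → Subset m) → Set
  Flat o S = ∀ j → o ∤ suc j → ∣ S j ∣ ≡ ∣ S (suc j) ∣

  infixr 5 _◂_

  _◂_ : ∀ {a} {A : Set a} → A → (ℕ → A) → ℕ → A
  (x ◂ f) zero    = x
  (x ◂ f) (suc i) = f i

  [b*o+i]/o≡b : ∀ o .{{_ : NonZero o}} b {i} → i < o → (b * o + i) / o ≡ b
  [b*o+i]/o≡b o b {i} i<o = trans (+-distrib-/-∣ˡ i (divides-refl b))
    (trans (cong₂ _+_ (m*n/n≡m b o) (m<n⇒m/n≡0 i<o)) (ℕ.+-identityʳ b))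

  energy₀-⊥ : ∀ {m} N {S : ℕ → Subset m} → (∀ j → S j ≡ ⊥) → energy₀ (prefix N S) ≡ 0
  energy₀-⊥ zero    eq = refl
  energy₀-⊥ (suc N) {S} eq = energy-constant 0 (prefix N (S ∘ suc)) (all N (S ∘ suc) (eq ∘ suc))
    where
    all : ∀ N (T : ℕ → Subset _) → (∀ j → T j ≡ ⊥) → AllV.All (S 0 ≡_) (prefix N T)
    all zero    T eq′ = AllV.[]
    all (suc N) T eq′ = trans (eq 0) (sym (eq′ 0)) AllV.∷ all N (T ∘ suc) (eq′ ∘ suc)

  -- Coinversion-free fillings and their columns

  columns : ∀ N → Filling μ m → Vec (Subset m) N
  columns N F = prefix N (columnSet F)

  extend : ∀ {N} → Vec (Subset m) N → ℕ → Subset m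
  extend []      j       = ⊥
  extend (S ∷ v) zero    = S
  extend (S ∷ v) (suc j) = extend v j

  prefix-extend : ∀ {N} (v : Vec (Subset m) N) → prefix N (extend v) ≡ v
  prefix-extend []      = refl
  prefix-extend (S ∷ v) = cong (S ∷_) (prefix-extend v)

  subsets-complete : (S : Subset m) → S List.∈ subsets m
  subsets-complete []          = here refl
  subsets-complete (false ∷ S) = List.∈-++⁺ˡ (List.∈-map⁺ (false ∷_) (subsets-complete S))
  subsets-complete {suc m} (true ∷ S)  =
    List.∈-++⁺ʳ (List.map (false ∷_) (subsets m)) (List.∈-map⁺ (true ∷_) (subsets-complete S))

  subsets-unique : ∀ m → Unique (subsets m)
  subsets-unique zero    = [] ∷ []
  subsets-unique (suc m) = Unique.++⁺
    (Unique.map⁺ Vec.∷-injectiveʳ (subsets-unique m)) (Unique.map⁺ Vec.∷-injectiveʳ (subsets-unique m))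
    λ (S∈ , S∈′) → disjoint (List.∈-map⁻ (false ∷_) S∈) (List.∈-map⁻ (true ∷_) S∈′)
    where
    disjoint : ∀ {S} → (∃ λ T → T List.∈ subsets m × S ≡ false ∷ T) → ¬ (∃ λ T → T List.∈ subsets m × S ≡ true ∷ T)
    disjoint (_ , _ , refl) (_ , _ , ())

  ∈-tuples⁺ : ∀ m h N {S : ℕ → Subset m} → (∀ j → j < N → ∣ S j ∣ ≡ h j) → prefix N S List.∈ tuples m h N
  ∈-tuples⁺ m h zero    eq = here refl
  ∈-tuples⁺ m h (suc N) {S} eq = List.∈-cartesianProductWith⁺ _∷_
    (List.∈-filter⁺ (λ S → ∣ S ∣ ≟ h 0) (subsets-complete (S 0)) (eq 0 z<s))
    (∈-tuples⁺ m (h ∘ suc) N λ j j<N → eq (suc j) (s<s j<N))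

  tuples-unique : ∀ m h N → Unique (tuples m h N)
  tuples-unique m h zero    = [] ∷ []
  tuples-unique m h (suc N) = Unique.cartesianProductWith⁺ _∷_ Vec.∷-injective
    (Unique.filter⁺ (λ S → ∣ S ∣ ≟ h 0) (subsets-unique m)) (tuples-unique m (h ∘ suc) N)

  ∣extend∣ : ∀ (h : ℕ → ℕ) {N} (v : Vec (Subset m) N) → (∀ i → ∣ Vec.lookup v i ∣ ≡ h (toℕ i)) →
             (∀ j → N ≤ j → h j ≡ 0) → ∀ j → ∣ extend v j ∣ ≡ h j
  ∣extend∣ {m} h []      eq out j       = trans (∣⊥∣≡0 m) (sym (out j z≤n))
  ∣extend∣     h (S ∷ v) eq out zero    = eq zero
  ∣extend∣     h (S ∷ v) eq out (suc j) = ∣extend∣ (h ∘ suc) v (eq ∘ suc) (λ j N≤j → out (suc j) (s≤s N≤j)) j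

  height-beyond : ∀ {N} → All (_≤ N) μ → ∀ j → N ≤ j → height μ j ≡ 0
  height-beyond []                          j N≤j = refl
  height-beyond {μ = r ∷ μ} (r≤N ∷ bounded) j N≤j =
    trans (height-out {μ} (ℕ.≤⇒≯ (ℕ.≤-trans r≤N N≤j))) (height-beyond bounded j N≤j)

  map-filter-↭ : ∀ {a b p} {A : Set a} {B : Set b} {P : A → Set p} (P? : Decidable P) (f : A → B) {xs ys} →
    Unique xs → Unique ys → (∀ {x y} → P x → P y → f x ≡ f y → x ≡ y) → (∀ {x} → P x → f x List.∈ ys) →
    (∀ {y} → y List.∈ ys → ∃ λ x → x List.∈ xs × P x × f x ≡ y) → List.map f (filter P? xs) ↭ ys
  map-filter-↭ P? f {xs} {ys} unique-xs unique-ys inj into onto = ∼bag⇒↭ (unique∧set⇒bag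
    (unique-map (λ x∈ y∈ → inj (holds x∈) (holds y∈)) (Unique.filter⁺ P? unique-xs)) unique-ys (mk⇔ to from))
    where
    holds : ∀ {x} → x List.∈ filter P? xs → _
    holds x∈ = proj₂ (List.∈-filter⁻ P? {xs = xs} x∈)

    to : ∀ {y} → y List.∈ List.map f (filter P? xs) → y List.∈ ys
    to y∈ with List.∈-map⁻ f y∈
    ... | x , x∈ , refl = into (holds x∈)

    from : ∀ {y} → y List.∈ ys → y List.∈ List.map f (filter P? xs)
    from y∈ with onto y∈
    ... | x , x∈ , px , refl = List.∈-map⁺ f (List.∈-filter⁺ P? x∈ px)

  module _ {N} (bounded : All (_≤ N) μ) where

    columnSet-beyond : {F : Filling μ m} → CoinversionFree F → ∀ {j} → N ≤ j → columnSet F j ≡ ⊥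
    columnSet-beyond cof {j} N≤j = ∣p∣≡0⇒p≡⊥ (trans (∣columnSet∣ cof j) (height-beyond bounded j N≤j))

    columns-injective : {F G : Filling μ m} → CoinversionFree F → CoinversionFree G →
                        columns N F ≡ columns N G → F ≡ G
    columns-injective {F = F} {G} f g eq = columnSets-injective f g agree
      where
      agree : ∀ j → columnSet F j ≡ columnSet G j
      agree j with j <? N
      ... | yes j<N = prefix-injective N eq j j<N
      ... | no  j≮N = trans (columnSet-beyond f (ℕ.≮⇒≥ j≮N)) (sym (columnSet-beyond g (ℕ.≮⇒≥ j≮N)))

    columns-surjective : ∀ {v} → v List.∈ tuples m (height μ) N →
                         ∃ λ (F : Filling μ m) → F List.∈ fillings μ m × CoinversionFree F × columns N F ≡ v
    columns-surjective {m = m} {v} v∈ =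
      let (F , (cof , eq) , _) = cof-exists-unique μ (extend v)
            (∣extend∣ (height μ) v (∈-tuples-size m (height μ) N v∈) (height-beyond bounded))
      in F , fillings-complete F , cof , trans (prefix-cong N λ j _ → eq j) (prefix-extend v)

    -- Turns sums over coinversion-free fillings into sums over tuples of sets, in which the columns
    -- can be chosen independently.
    columns-↭ : List.map (columns N) (filter coinversionFree? (fillings μ m)) ↭ tuples m (height μ) N
    columns-↭ {m = m} = map-filter-↭ coinversionFree? (columns N)
      (fillings-unique μ m) (tuples-unique m (height μ) N)
      columns-injective (λ cof → ∈-tuples⁺ m (height μ) N λ j _ → ∣columnSet∣ cof j) columns-surjective

  multiplicities-count : ∀ N (S : ℕ → Subset m) (f : ℕ → ℕ) t →
    length (filter (λ j → t ∈? S j) (applyUpTo f N)) ≡ Vec.lookup (multiplicities (prefix N (S ∘ f))) t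
  multiplicities-count zero    S f t = sym (Vec.lookup-replicate t 0)
  multiplicities-count (suc N) S f t
    rewrite multiplicity (S (f 0)) (multiplicities (prefix N (S ∘ f ∘ suc))) t
          | sym (multiplicities-count N S (f ∘ suc) t) with t ∈? S (f 0)
  ... | yes t∈ rewrite Vec.[]=⇒lookup t∈ = refl
  ... | no  t∉ with Vec.lookup (S (f 0)) t in eq
  ...   | true  = ⊥-elim (t∉ (Vec.lookup⇒[]= t (S (f 0)) eq))
  ...   | false = refl

  -- The entries of a column are distinct, so counting boxes with entry `t` is counting columns
  -- whose set contains `t`.
  content-multiplicities : ∀ {N} → All (_≤ N) μ → {F : Filling μ m} → CoinversionFree F →
                           content F ≡ multiplicities (columns N F)
  content-multiplicities {μ = μ} {m = m} {N} bounded {F} cof = lookup-ext λ t → begin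
    Vec.lookup (content F) t                                       ≡⟨ Vec.lookup∘tabulate _ t ⟩
    length (occurrences F t)                                       ≡⟨ List.length-map (toℕ ∘ col) (occurrences F t) ⟨
    length (columnsWith F t)                                       ≡⟨ ↭-length (∼bag⇒↭ (unique∧set⇒bag
                                                                        (columnsWith-unique F t cof)
                                                                        (Unique.filter⁺ (λ j → t ∈? columnSet F j) (Unique.upTo⁺ N))
                                                                        (mk⇔ (to t) (from t)))) ⟩
    length (filter (λ j → t ∈? columnSet F j) (upTo N))            ≡⟨ multiplicities-count N (columnSet F) id t ⟩
    Vec.lookup (multiplicities (columns N F)) t                    ∎
    where
    open ≡-Reasoning
    bound : ∀ {j t} → t ∈ columnSet F j → j < N
    bound {j} {t} t∈ with j <? N
    ... | yes j<N = j<N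
    ... | no  j≮N with subst (t ∈_) (∣p∣≡0⇒p≡⊥ (trans (∣columnSet∣ cof j) (height-beyond bounded j (ℕ.≮⇒≥ j≮N)))) t∈
    ...   | t∈⊥ = ⊥-elim (∉⊥ t∈⊥)
    to : ∀ t {j} → j List.∈ columnsWith F t → j List.∈ filter (λ j → t ∈? columnSet F j) (upTo N)
    to t j∈ with Equivalence.to (∈-columnsWith F t) j∈
    ... | t∈ = List.∈-filter⁺ (λ j → t ∈? columnSet F j) (List.∈-upTo⁺ (bound t∈)) t∈
    from : ∀ t {j} → j List.∈ filter (λ j → t ∈? columnSet F j) (upTo N) → j List.∈ columnsWith F t
    from t j∈ = Equivalence.from (∈-columnsWith F t)
      (proj₂ (List.∈-filter⁻ (λ j → t ∈? columnSet F j) {xs = upTo N} j∈))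

  -- The major index, row by row

  -- The weight `suc r` of a descent at `y` is the length of `y ∷ v`, which is the leg of that box
  -- plus 1.
  majFrom : ∀ {r} → Fin m → Vec (Fin m) r → ℕ
  majFrom x []                = 0
  majFrom {r = suc r} x (y ∷ v) = descent x y * suc r + majFrom y v

  rowMaj : ∀ {r} → Vec (Fin m) r → ℕ
  rowMaj []      = 0
  rowMaj (x ∷ v) = majFrom x v

  sum-filter : ∀ {a p} {A : Set a} {P : A → Set p} (P? : Decidable P) (f : A → ℕ) xs →
    sum (List.map f (filter P? xs)) ≡ sum (List.map (λ x → bit (does (P? x)) * f x) xs)
  sum-filter P? f []       = refl
  sum-filter P? f (x ∷ xs) with does (P? x)
  ... | true  = cong₂ _+_ (sym (ℕ.*-identityˡ (f x))) (sum-filter P? f xs)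
  ... | false = sum-filter P? f xs

  DescentAfter : Maybe (Fin m) → Fin m → Set
  DescentAfter nothing  y = Empty
  DescentAfter (just x) y = x Fin.< y

  descentAfter? : (p : Maybe (Fin m)) (y : Fin m) → Dec (DescentAfter p y)
  descentAfter? nothing  y = no λ ()
  descentAfter? (just x) y = x Fin.<? y

  sum-row : ∀ {r} (p : Maybe (Fin m)) (x : Fin m) (v : Vec (Fin m) r) →
    sum (List.tabulate λ i → bit (does (descentAfter? (previous p (x ∷ v) i) (Vec.lookup (x ∷ v) i)))
                             * suc (suc r ∸ suc (toℕ i)))
    ≡ bit (does (descentAfter? p x)) * suc r + majFrom x v
  sum-row p x []                  = refl
  sum-row {r = suc r} p x (y ∷ v) =
    cong (bit (does (descentAfter? p x)) * suc (suc r) +_) (sum-row (just x) y v)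

  maj-∷ : ∀ {r} (v : Vec (Fin m) r) (F : Filling μ m) → maj {r ∷ μ} (v ∷ F) ≡ rowMaj v + maj F
  maj-∷ {m = m} {μ = μ} {r} v F = begin
    maj {r ∷ μ} (v ∷ F)
      ≡⟨ sum-filter (descent? {r ∷ μ} (v ∷ F)) (λ b → suc (leg b)) (boxes (r ∷ μ)) ⟩
    sum (List.map w (List.map (zero ,_) (List.allFin r) List.++ List.map next-row (boxes μ)))
      ≡⟨ cong sum (List.map-++ w (List.map (zero ,_) (List.allFin r)) _) ⟩
    sum (List.map w (List.map (zero ,_) (List.allFin r)) List.++ List.map w (List.map next-row (boxes μ)))
      ≡⟨ sum-++ (List.map w (List.map (zero ,_) (List.allFin r))) _ ⟩
    sum (List.map w (List.map (zero ,_) (List.allFin r))) + sum (List.map w (List.map next-row (boxes μ)))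
      ≡⟨ cong₂ _+_ firstRow laterRows ⟩
    rowMaj v + maj F ∎
    where
    open ≡-Reasoning
    w : Box (r ∷ μ) → ℕ
    w b = bit (does (descent? {r ∷ μ} (v ∷ F) b)) * suc (leg b)

    laterRows : sum (List.map w (List.map next-row (boxes μ))) ≡ maj F
    laterRows = trans (cong sum (trans (sym (List.map-∘ (boxes μ))) (List.map-cong (λ b →
        cong (λ d → bit d * suc (leg b)) (does-⇔ (mk⇔ down up) (descent? {r ∷ μ} (v ∷ F) (next-row b)) (descent? F b))) (boxes μ))))
      (sym (sum-filter (descent? F) (λ b → suc (leg b)) (boxes μ)))
      where
      down : ∀ {b} → Descent {r ∷ μ} (v ∷ F) (next-row b) → Descent F b
      down ((suc i , j) , (eq , eq′) , lt) = (i , j) , (Fin.suc-injective eq , eq′) , lt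
      up : ∀ {b} → Descent F b → Descent {r ∷ μ} (v ∷ F) (next-row b)
      up (a , (eq , eq′) , lt) = next-row a , (cong suc eq , eq′) , lt

    descent⇔ : ∀ i → Descent {r ∷ μ} (v ∷ F) (zero , i) ⇔ DescentAfter (previous nothing v i) (Vec.lookup v i)
    descent⇔ i = mk⇔ to (from v i)
      where
      to : Descent {r ∷ μ} (v ∷ F) (zero , i) → DescentAfter (previous nothing v i) (Vec.lookup v i)
      to ((zero , k) , (refl , eq) , lt) = subst (λ p → DescentAfter p (Vec.lookup v i)) (sym (previous-suc v k i eq)) lt
      from : ∀ {r} (v : Vec (Fin m) r) i → DescentAfter (previous nothing v i) (Vec.lookup v i) → Descent {r ∷ μ} (v ∷ F) (zero , i)
      from (x ∷ v) (suc i) d = (zero , inject₁ i) , (refl , left) ,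
        subst (λ p → DescentAfter p (Vec.lookup (x ∷ v) (suc i))) (previous-suc {p = nothing} (x ∷ v) (inject₁ i) (suc i) left) d
        where left = cong suc (Fin.toℕ-inject₁ i)

    firstRow : sum (List.map w (List.map (zero ,_) (List.allFin r))) ≡ rowMaj v
    firstRow = trans (cong sum (trans (sym (List.map-∘ (List.allFin r))) (trans (List.map-tabulate id _)
        (List.tabulate-cong λ i → cong (λ d → bit d * suc (r ∸ suc (toℕ i)))
          (does-⇔ (descent⇔ i) (descent? {r ∷ μ} (v ∷ F) (zero , i)) (descentAfter? (previous nothing v i) (Vec.lookup v i)))))))
      (weights v)
      where
      weights : ∀ {r} (v : Vec (Fin m) r) → sum (List.tabulate λ i →
        bit (does (descentAfter? (previous nothing v i) (Vec.lookup v i))) * suc (r ∸ suc (toℕ i))) ≡ rowMaj v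
      weights []      = refl
      weights (x ∷ v) = sum-row nothing x v

  -- The share of a row in the energy of the columns, with x in column j.
  descentEnergy : ∀ {r} → ℕ → Fin m → Vec (Fin m) r → ℕ
  descentEnergy j x []      = 0
  descentEnergy j x (y ∷ v) = suc j * descent x y + descentEnergy (suc j) y v

  -- For every box, leg + 1 and the column index add up to the row length, here `suc (j + r)`; each
  -- descent contributes this multiple of `o`.
  ∣majFrom+descentEnergy : ∀ {r} o j (x : Fin m) (v : Vec (Fin m) r) → o ∣ suc (j + r) →
                           o ∣ majFrom x v + descentEnergy j x v
  ∣majFrom+descentEnergy o j x [] o∣ = o ∣0
  ∣majFrom+descentEnergy {r = suc r} o j x (y ∷ v) o∣ = subst (o ∣_) (reorder (descent x y) r j _ _)
    (∣m∣n⇒∣m+n (∣n⇒∣m*n (descent x y) o∣)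
      (∣majFrom+descentEnergy o (suc j) y v (subst (λ k → o ∣ suc k) (ℕ.+-suc j r) o∣)))
    where
    reorder : ∀ d r j a b → d * suc (j + suc r) + (a + b) ≡ (d * suc r + a) + (suc j * d + b)
    reorder = solve-∀

  -- Columns fixed by shifts within blocks

  [b*o+i]%o≡i : ∀ o .{{_ : NonZero o}} b {i} → i < o → (b * o + i) % o ≡ i
  [b*o+i]%o≡i o b {i} i<o = trans (cong (_% o) (ℕ.+-comm (b * o) i)) (trans ([m+kn]%n≡m%n i b o) (m<n⇒m%n≡m i<o))

  b*o+i<a*o : ∀ {o a b i} → b < a → i < o → b * o + i < a * o
  b*o+i<a*o {o} {a} {b} {i} b<a i<o = begin-strict
    b * o + i  <⟨ ℕ.+-monoʳ-< (b * o) i<o ⟩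
    b * o + o  ≡⟨ ℕ.+-comm (b * o) o ⟩
    suc b * o  ≤⟨ ℕ.*-monoˡ-≤ o b<a ⟩
    a * o      ∎
    where open ℕ.≤-Reasoning

  quotient-remainder : ∀ n .{{_ : NonZero n}} j → (j / n) * n + j % n ≡ j
  quotient-remainder n j = trans (ℕ.+-comm ((j / n) * n) (j % n)) (sym (m≡m%n+[m/n]*n j n))

  -- Row-major to column-major order.
  transpose : ∀ o g .{{_ : NonZero o}} → ℕ → ℕ
  transpose o g r = (r % o) * g + r / o

  transpose-+ : ∀ o g .{{_ : NonZero o}} b {i} → i < o → transpose o g (b * o + i) ≡ i * g + b
  transpose-+ o g b i<o = cong₂ (λ x y → x * g + y) ([b*o+i]%o≡i o b i<o) ([b*o+i]/o≡b o b i<o)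

  transpose-< : ∀ o g .{{_ : NonZero o}} {r} → r < g * o → transpose o g r < o * g
  transpose-< o g {r} r< = b*o+i<a*o (m%n<n r o) (m<n*o⇒m/o<n r<)

  transpose-inverse : ∀ o g .{{_ : NonZero o}} .{{_ : NonZero g}} {r} → r < g * o → transpose g o (transpose o g r) ≡ r
  transpose-inverse o g {r} r< = trans (transpose-+ g o (r % o) (m<n*o⇒m/o<n r<)) (quotient-remainder o r)

  module Transposition (o g n : ℕ) .{{_ : NonZero o}} .{{_ : NonZero g}} .{{_ : NonZero n}} (n≡ : n ≡ g * o) where

    columnMajor : ℕ → ℕ
    columnMajor j = (j / n) * n + transpose o g (j % n)

    transpose-<n : ∀ {r} → r < n → transpose o g r < n
    transpose-<n {r} r<n = subst (transpose o g r <_) (trans (ℕ.*-comm o g) (sym n≡)) (transpose-< o g (subst (r <_) n≡ r<n))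

    columnMajor-/ : ∀ j → columnMajor j / n ≡ j / n
    columnMajor-/ j = [b*o+i]/o≡b n (j / n) (transpose-<n (m%n<n j n))

    columnMajor-% : ∀ j → columnMajor j % n ≡ transpose o g (j % n)
    columnMajor-% j = [b*o+i]%o≡i n (j / n) (transpose-<n (m%n<n j n))

    columnMajor-+ : ∀ c b {i} → b < g → i < o → columnMajor (c * n + (b * o + i)) ≡ c * n + (i * g + b)
    columnMajor-+ c b {i} b<g i<o = cong₂ (λ x y → x * n + y) ([b*o+i]/o≡b n c bound)
      (trans (cong (transpose o g) ([b*o+i]%o≡i n c bound)) (transpose-+ o g b i<o))
      where
      bound : b * o + i < n
      bound = subst (b * o + i <_) (sym n≡) (b*o+i<a*o b<g i<o)

  columnMajor-inverse : ∀ o g n .{{_ : NonZero o}} .{{_ : NonZero g}} .{{_ : NonZero n}} (n≡ : n ≡ g * o) (n≡′ : n ≡ o * g) j →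
    Transposition.columnMajor g o n n≡′ (Transposition.columnMajor o g n n≡ j) ≡ j
  columnMajor-inverse o g n n≡ n≡′ j = begin
    (columnMajor j / n) * n + transpose g o (columnMajor j % n) ≡⟨ cong₂ (λ x y → x * n + transpose g o y) (columnMajor-/ j) (columnMajor-% j) ⟩
    (j / n) * n + transpose g o (transpose o g (j % n))         ≡⟨ cong (λ x → (j / n) * n + x) (transpose-inverse o g (subst (j % n <_) n≡ (m%n<n j n))) ⟩
    (j / n) * n + j % n                                         ≡⟨ quotient-remainder n j ⟩
    j                                                           ∎
    where
    open ≡-Reasoning
    open Transposition o g n n≡

  columnMajor-↔ : ∀ o g n .{{_ : NonZero o}} .{{_ : NonZero g}} .{{_ : NonZero n}} (n≡ : n ≡ g * o) → ℕ ↔ ℕ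
  columnMajor-↔ o g n n≡ = mk↔ₛ′ (Transposition.columnMajor o g n n≡) (Transposition.columnMajor g o n n≡′)
    (columnMajor-inverse g o n n≡′ n≡) (columnMajor-inverse o g n n≡ n≡′)
    where n≡′ = trans n≡ (ℕ.*-comm g o)

  module _ (n : ℕ) .{{_ : NonZero n}} where

    -- Cyclic within each block of `n`; `source n` is the case `k = n ∸ 1`.
    shift : ℕ → ℕ → ℕ
    shift k j = (j / n) * n + (j + k) % n

    shift-+ : ∀ c {r k} → r + k < n → shift k (c * n + r) ≡ c * n + (r + k)
    shift-+ c {r} {k} r+k<n = cong₂ (λ x y → x * n + y)
      ([b*o+i]/o≡b n c (ℕ.≤-<-trans (ℕ.m≤m+n r k) r+k<n))
      (trans (cong (_% n) (ℕ.+-assoc (c * n) r k)) ([b*o+i]%o≡i n c r+k<n))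

    shift-∘ : ∀ k l j → shift k (shift l j) ≡ shift (l + k) j
    shift-∘ k l j = cong₂ (λ x y → x * n + y) ([b*o+i]/o≡b n (j / n) (m%n<n (j + l) n)) (begin
      (j / n * n + (j + l) % n + k) % n  ≡⟨ cong (_% n) (trans (ℕ.+-assoc (j / n * n) _ k) (ℕ.+-comm (j / n * n) _)) ⟩
      ((j + l) % n + k + j / n * n) % n  ≡⟨ [m+kn]%n≡m%n ((j + l) % n + k) (j / n) n ⟩
      ((j + l) % n + k) % n              ≡⟨ %-distribˡ-+ ((j + l) % n) k n ⟩
      ((j + l) % n % n + k % n) % n      ≡⟨ cong (λ x → (x + k % n) % n) (m%n%n≡m%n (j + l) n) ⟩
      ((j + l) % n + k % n) % n          ≡⟨ %-distribˡ-+ (j + l) k n ⟨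
      (j + l + k) % n                    ≡⟨ cong (_% n) (ℕ.+-assoc j l k) ⟩
      (j + (l + k)) % n                  ∎)
      where open ≡-Reasoning

  module _ {a} {A : Set a} (n : ℕ) .{{_ : NonZero n}} (S : ℕ → A) where

    Invariant : ℕ → Set a
    Invariant k = ∀ j → S (shift n k j) ≡ S j

    invariant-+ : ∀ {k l} → Invariant k → Invariant l → Invariant (l + k)
    invariant-+ {k} {l} inv inv′ j = trans (cong S (sym (shift-∘ n k l j))) (trans (inv (shift n l j)) (inv′ j))

    invariant-∸ : ∀ {k l} → Invariant k → Invariant (l + k) → Invariant l
    invariant-∸ {k} {l} inv inv′ j = trans (sym (inv (shift n l j))) (trans (cong S (shift-∘ n k l j)) (inv′ j))

    invariant-0 : Invariant 0
    invariant-0 j = cong S (trans (cong (λ x → j / n * n + x % n) (ℕ.+-identityʳ j)) (quotient-remainder n j))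

    invariant-* : ∀ {k} p → Invariant k → Invariant (p * k)
    invariant-* zero    inv = invariant-0
    invariant-* {k} (suc p) inv = invariant-+ {p * k} {k} (invariant-* p inv) inv

    invariant-n : Invariant n
    invariant-n j = trans (cong (λ x → S (j / n * n + x)) ([m+n]%n≡m%n j n)) (cong S (quotient-remainder n j))

    -- Bézout over the natural numbers: `invariant-∸` replaces the inverse of a shift.
    invariant-gcd : ∀ {k} → Invariant k → Invariant (gcd k n)
    invariant-gcd {k} inv with Bézout.identity (gcd-GCD k n)
    ... | Bézout.+- x y eq = invariant-∸ {y * n} (invariant-* y invariant-n) (subst Invariant (sym eq) (invariant-* x inv))
    ... | Bézout.-+ x y eq = invariant-∸ {x * k} (invariant-* x inv) (subst Invariant (sym eq) (invariant-* y invariant-n))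

    module _ (o g : ℕ) .{{_ : NonZero o}} .{{_ : NonZero g}} (n≡ : n ≡ g * o) where

      open Transposition o g n n≡

      -- Column `i * g + b` of a block of `n` columns is read at position `b * o + i`, so period `g`
      -- within the block becomes constancy on runs of length `o`.
      Blockwise : Set a
      Blockwise = ∀ b i → i < o → S (columnMajor (b * o + i)) ≡ S (columnMajor (b * o))

      locate : ∀ b i → b * o + i ≡ (b / g) * n + ((b % g) * o + i)
      locate b i = begin
        b * o + i                            ≡⟨ cong (λ b → b * o + i) (quotient-remainder g b) ⟨
        (b / g * g + b % g) * o + i          ≡⟨ cong (_+ i) (ℕ.*-distribʳ-+ o (b / g * g) (b % g)) ⟩
        b / g * g * o + b % g * o + i        ≡⟨ ℕ.+-assoc (b / g * g * o) (b % g * o) i ⟩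
        b / g * g * o + (b % g * o + i)      ≡⟨ cong (_+ (b % g * o + i)) (trans (ℕ.*-assoc (b / g) g o) (cong (b / g *_) (sym n≡))) ⟩
        b / g * n + (b % g * o + i)          ∎
        where open ≡-Reasoning

      invariant⇒blockwise : Invariant g → Blockwise
      invariant⇒blockwise inv b i i<o = trans (at i i<o) (sym (trans (cong (S ∘ columnMajor) (sym (ℕ.+-identityʳ (b * o)))) (at 0 (ℕ.≤-<-trans z≤n i<o))))
        where
        c = b / g
        b′ = b % g
        b′<g = m%n<n b g
        at : ∀ i → i < o → S (columnMajor (b * o + i)) ≡ S (c * n + b′)
        at i i<o = begin
          S (columnMajor (b * o + i))                ≡⟨ cong (S ∘ columnMajor) (locate b i) ⟩
          S (columnMajor (c * n + (b′ * o + i)))     ≡⟨ cong S (columnMajor-+ c b′ b′<g i<o) ⟩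
          S (c * n + (i * g + b′))                   ≡⟨ cong (λ x → S (c * n + x)) (ℕ.+-comm (i * g) b′) ⟩
          S (c * n + (b′ + i * g))                   ≡⟨ cong S (shift-+ n c bound) ⟨
          S (shift n (i * g) (c * n + b′))             ≡⟨ invariant-* i inv (c * n + b′) ⟩
          S (c * n + b′)                             ∎
          where
          open ≡-Reasoning
          bound : b′ + i * g < n
          bound = subst₂ _<_ (ℕ.+-comm (i * g) b′) (trans (ℕ.*-comm o g) (sym n≡)) (b*o+i<a*o i<o b′<g)

      blockwise⇒mod : Blockwise → ∀ c {r} → r < n → S (c * n + r) ≡ S (c * n + r % g)
      blockwise⇒mod blockwise c {r} r<n = begin
        S (c * n + r)                              ≡⟨ cong (λ r → S (c * n + r)) (quotient-remainder g r) ⟨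
        S (c * n + (p * g + b))                    ≡⟨ cong S (columnMajor-+ c b b<g p<o) ⟨
        S (columnMajor (c * n + (b * o + p)))      ≡⟨ cong (S ∘ columnMajor) (block p) ⟩
        S (columnMajor ((c * g + b) * o + p))      ≡⟨ blockwise (c * g + b) p p<o ⟩
        S (columnMajor ((c * g + b) * o))          ≡⟨ cong (S ∘ columnMajor) (trans (sym (ℕ.+-identityʳ _)) (sym (block 0))) ⟩
        S (columnMajor (c * n + (b * o + 0)))      ≡⟨ cong S (columnMajor-+ c b b<g (ℕ.≤-<-trans z≤n p<o)) ⟩
        S (c * n + b)                              ∎
        where
        open ≡-Reasoning
        p = r / g
        b = r % g
        b<g = m%n<n r g
        p<o : p < o
        p<o = m<n*o⇒m/o<n (subst (r <_) (trans n≡ (ℕ.*-comm g o)) r<n)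
        block : ∀ i → c * n + (b * o + i) ≡ (c * g + b) * o + i
        block i = sym (trans (cong (_+ i) (trans (ℕ.*-distribʳ-+ o (c * g) b) (cong (_+ b * o) (trans (ℕ.*-assoc c g o) (cong (c *_) (sym n≡))))))
          (ℕ.+-assoc (c * n) (b * o) i))

      -- Within a block of `n` columns only the index modulo `g` matters, and as `g` divides `n`,
      -- wrapping around modulo `n` keeps that residue.
      blockwise⇒invariant : Blockwise → ∀ {k} → g ∣ k → Invariant k
      blockwise⇒invariant blockwise {k} (divides p refl) j = begin
        S (j / n * n + (j + p * g) % n)        ≡⟨ blockwise⇒mod blockwise (j / n) (m%n<n (j + p * g) n) ⟩
        S (j / n * n + (j + p * g) % n % g)    ≡⟨ cong (λ x → S (j / n * n + x)) same ⟩
        S (j / n * n + j % n % g)              ≡⟨ blockwise⇒mod blockwise (j / n) (m%n<n j n) ⟨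
        S (j / n * n + j % n)                  ≡⟨ cong S (quotient-remainder n j) ⟩
        S j                                    ∎
        where
        open ≡-Reasoning
        g∣n : g ∣ n
        g∣n = divides o (trans n≡ (ℕ.*-comm g o))
        same : (j + p * g) % n % g ≡ j % n % g
        same = trans (m∣n⇒o%n%m≡o%m g n (j + p * g) g∣n) (trans ([m+kn]%n≡m%n j p g) (sym (m∣n⇒o%n%m≡o%m g n j g∣n)))

  -- Fixed points of a power of the action, counted as block-constant fillings

  count-cong : ∀ {X : Set} (finite : Finite X) {P Q : X → Set} (P? : Decidable P) (Q? : Decidable Q) →
               (∀ x → P x → Q x) → (∀ x → Q x → P x) → Finite.count finite P? ≡ Finite.count finite Q?
  count-cong finite P? Q? P⇒Q Q⇒P =
    cong length (List.filter-≐ P? Q? ((λ {x} → P⇒Q x) , (λ {x} → Q⇒P x)) (Finite.elements finite))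

  count-↔ : ∀ {X : Set} (finite : Finite X) (f : X ↔ X) {P Q : X → Set} (P? : Decidable P) (Q? : Decidable Q) →
            (∀ x → P x → Q (Inverse.to f x)) → (∀ x → Q (Inverse.to f x) → P x) → Finite.count finite P? ≡ Finite.count finite Q?
  count-↔ finite f {P} {Q} P? Q? P⇒Q Q⇒P = trans (sym (List.length-map to (filter P? elements)))
    (↭-length (map-filter-↭ P? to unique (Unique.filter⁺ Q? unique)
      (λ _ _ → injective)
      (λ {x} p → List.∈-filter⁺ Q? (complete (to x)) (P⇒Q x p))
      (λ {y} y∈ → from y , complete (from y)
                , Q⇒P (from y) (subst Q (sym (strictlyInverseˡ y)) (proj₂ (List.∈-filter⁻ Q? {xs = elements} y∈)))
                , strictlyInverseˡ y)))
    where
    open Finite finite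
    open Inverse f using (to; from; strictlyInverseˡ; strictlyInverseʳ)
    injective : ∀ {x y} → to x ≡ to y → x ≡ y
    injective {x} {y} e = trans (sym (strictlyInverseʳ x)) (trans (cong from e) (strictlyInverseʳ y))

  prefix-++ : ∀ {a} {A : Set a} r s (f : ℕ → A) → prefix (r + s) f ≡ prefix r f ++ prefix s (f ∘ (r +_))
  prefix-++ zero    s f = refl
  prefix-++ (suc r) s f = cong (f 0 ∷_) (prefix-++ r s (f ∘ suc))

  all-prefix : ∀ {A : Set} (x : A) r (f : ℕ → A) → AllV.All (x ≡_) (prefix r f) ⇔ (∀ i → i < r → x ≡ f i)
  all-prefix x zero    f = mk⇔ (λ _ _ ()) (λ _ → [])
  all-prefix x (suc r) f = mk⇔
    (λ { (eq ∷ eqs) zero _ → eq ; (eq ∷ eqs) (suc i) i<r → Equivalence.to (all-prefix x r (f ∘ suc)) eqs i (s<s⁻¹ i<r) })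
    (λ h → h 0 z<s ∷ Equivalence.from (all-prefix x r (f ∘ suc)) λ i i<r → h (suc i) (s<s i<r))

  constant-prefix : ∀ {A : Set} r (f : ℕ → A) → Constant (prefix r f) ⇔ (∀ i → i < r → f 0 ≡ f i)
  constant-prefix zero    f = mk⇔ (λ _ _ ()) (λ _ → tt)
  constant-prefix (suc r) f = mk⇔
    (λ { eqs zero _ → refl ; eqs (suc i) i<r → Equivalence.to (all-prefix (f 0) r (f ∘ suc)) eqs i (s<s⁻¹ i<r) })
    (λ h → Equivalence.from (all-prefix (f 0) r (f ∘ suc)) λ i i<r → h (suc i) (s<s i<r))

  blockConstant-prefix : ∀ o B (S : ℕ → Subset m) →
    BlockConstant o B (prefix (B * o) S) ⇔ (∀ b i → b < B → i < o → S (b * o + i) ≡ S (b * o))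
  blockConstant-prefix o zero    S = mk⇔ (λ _ _ _ ()) (λ _ → tt)
  blockConstant-prefix o (suc B) S = mk⇔ to from
    where
    v = prefix (o + B * o) S
    halves = Vec.++-injective (Vec.take o v) (prefix o S)
      (trans (Vec.take++drop≡id o v) (prefix-++ o (B * o) S))
    rest = blockConstant-prefix o B (S ∘ (o +_))

    to : BlockConstant o (suc B) v → ∀ b i → b < suc B → i < o → S (b * o + i) ≡ S (b * o)
    to (c , bc) zero    i _   i<o = sym (Equivalence.to (constant-prefix o S) (subst Constant (proj₁ halves) c) i i<o)
    to (c , bc) (suc b) i b<B i<o = trans (cong S (ℕ.+-assoc o (b * o) i))
      (Equivalence.to rest (subst (BlockConstant o B) (proj₂ halves) bc) b i (s<s⁻¹ b<B) i<o)

    from : (∀ b i → b < suc B → i < o → S (b * o + i) ≡ S (b * o)) → BlockConstant o (suc B) v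
    from h = subst Constant (sym (proj₁ halves)) (Equivalence.from (constant-prefix o S) λ i i<o → sym (h 0 i z<s i<o))
           , subst (BlockConstant o B) (sym (proj₂ halves)) (Equivalence.from rest λ b i b<B i<o →
               trans (cong S (sym (ℕ.+-assoc o (b * o) i))) (h (suc b) i (s<s b<B) i<o))

  module _ (μ : List ℕ) (ν : Vec ℕ m) where

    cof : (x : COF[ μ , ν ]) → CoinversionFree (value x)
    cof (F , [ h ]) = proj₁ (recompute (inCOF? ν F) h)

    hasContent : (x : COF[ μ , ν ]) → content (value x) ≡ ν
    hasContent (F , [ h ]) = proj₂ (recompute (inCOF? ν F) h)

    module _ (σ : ℕ ↔ ℕ) (heights : ∀ j → height μ (Inverse.to σ j) ≡ height μ j) where

      permuted : (x : COF[ μ , ν ]) → ∃ λ G → CoinversionFree G × (∀ j → columnSet G j ≡ columnSet (value x) (Inverse.to σ j))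
      permuted x = let (G , props , _) = cof-exists-unique μ (columnSet (value x) ∘ Inverse.to σ)
                         (λ j → trans (∣columnSet∣ (cof x) (Inverse.to σ j)) (heights j))
                   in G , props

      opaque

        permute : COF[ μ , ν ] → COF[ μ , ν ]
        permute x = let (G , cofG , cols) = permuted x in
          G , [ cofG , trans (content-permuted σ (cof x) cofG cols) (hasContent x) ]

        columnSet-permute : ∀ x j → columnSet (value (permute x)) j ≡ columnSet (value x) (Inverse.to σ j)
        columnSet-permute x = let (_ , _ , cols) = permuted x in cols

    cof-ext : (x y : COF[ μ , ν ]) → (∀ j → columnSet (value x) j ≡ columnSet (value y) j) → x ≡ y
    cof-ext x y eq = Refinement.value-injective (columnSets-injective (cof x) (cof y) eq)

  module _ {m} (μ : List ℕ) (ν : Vec ℕ m) (n : ℕ) .{{_ : NonZero n}} where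

    source^≡shift : ∀ e j → (source n ^∘ e) j ≡ shift n (e * (n ∸ 1)) j
    source^≡shift e j = source^ n e j

    columns-shifted : ∀ e (x : COF[ n · μ , ν ]) j → columnSet (value ((φ n μ ν ^∘ e) x)) j ≡
                      columnSet (value x) (shift n (e * (n ∸ 1)) j)
    columns-shifted e x j = trans (columnSet-φ^ n μ ν e x j)
      (cong (columnSet (value x)) (source^≡shift e j))

    fixed⇒invariant : ∀ e (x : COF[ n · μ , ν ]) → (φ n μ ν ^∘ e) x ≡ x → Invariant n (columnSet (value x)) (e * (n ∸ 1))
    fixed⇒invariant e x eq j = trans (sym (columns-shifted e x j)) (cong (λ x → columnSet (value x) j) eq)

    invariant⇒fixed : ∀ e (x : COF[ n · μ , ν ]) → Invariant n (columnSet (value x)) (e * (n ∸ 1)) → (φ n μ ν ^∘ e) x ≡ x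
    invariant⇒fixed e x inv = cof-ext (n · μ) ν ((φ n μ ν ^∘ e) x) x λ j → trans (columns-shifted e x j) (inv j)

    module _ (o g : ℕ) .{{_ : NonZero o}} .{{_ : NonZero g}} (n≡ : n ≡ g * o) where

      private
        n≡′ = trans n≡ (ℕ.*-comm g o)
        σ  = columnMajor-↔ o g n n≡
        σ′ = columnMajor-↔ g o n n≡′
        heights : ∀ j → height (n · μ) (Inverse.to σ j) ≡ height (n · μ) j
        heights j = height-block n μ (Transposition.columnMajor-/ o g n n≡ j)
        heights′ : ∀ j → height (n · μ) (Inverse.to σ′ j) ≡ height (n · μ) j
        heights′ j = height-block n μ (Transposition.columnMajor-/ g o n n≡′ j)

      private
        to   = permute (n · μ) ν σ heights
        from = permute (n · μ) ν σ′ heights′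

      to∘from : ∀ x → to (from x) ≡ x
      to∘from x = cof-ext (n · μ) ν (to (from x)) x λ j →
        trans (columnSet-permute (n · μ) ν σ heights (from x) j)
          (trans (columnSet-permute (n · μ) ν σ′ heights′ x (Inverse.to σ j))
            (cong (columnSet (value x)) (columnMajor-inverse o g n n≡ n≡′ j)))

      from∘to : ∀ x → from (to x) ≡ x
      from∘to x = cof-ext (n · μ) ν (from (to x)) x λ j →
        trans (columnSet-permute (n · μ) ν σ′ heights′ (to x) j)
          (trans (columnSet-permute (n · μ) ν σ heights x (Inverse.to σ′ j))
            (cong (columnSet (value x)) (columnMajor-inverse g o n n≡′ n≡ j)))

      reorder : COF[ n · μ , ν ] ↔ COF[ n · μ , ν ]
      reorder = mk↔ₛ′ to from to∘from from∘to

      blocks⇔ : ∀ B (x : COF[ n · μ , ν ]) → BlockConstant o B (columns (B * o) (value (to x))) ⇔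
        (∀ b i → b < B → i < o → columnSet (value (to x)) (b * o + i) ≡ columnSet (value (to x)) (b * o))
      blocks⇔ B x = blockConstant-prefix o B (columnSet (value (to x)))

      blockwise⇒ : ∀ {B} (x : COF[ n · μ , ν ]) → Blockwise n (columnSet (value x)) o g n≡ →
                   BlockConstant o B (columns (B * o) (value (to x)))
      blockwise⇒ {B} x bw = Equivalence.from (blocks⇔ B x) λ b i _ i<o →
        trans (cols (b * o + i)) (trans (bw b i i<o) (sym (cols (b * o))))
        where cols = columnSet-permute (n · μ) ν σ heights x

      ⇒blockwise : ∀ {B} → All (_≤ B * o) (n · μ) → ∀ (x : COF[ n · μ , ν ]) →
                   BlockConstant o B (columns (B * o) (value (to x))) → Blockwise n (columnSet (value x)) o g n≡
      ⇒blockwise {B} bounded x bc b i i<o =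
        trans (sym (cols (b * o + i))) (trans (everywhere b i i<o) (cols (b * o)))
        where
        cols = columnSet-permute (n · μ) ν σ heights x
        everywhere : ∀ b i → i < o → columnSet (value (to x)) (b * o + i) ≡ columnSet (value (to x)) (b * o)
        everywhere b i i<o with b <? B
        ... | yes b<B = Equivalence.to (blocks⇔ B x) bc b i b<B i<o
        -- Blocks from `B` on lie to the right of every row, so their columns are all empty.
        ... | no  b≮B = trans (columnSet-beyond bounded (cof (n · μ) ν (to x)) (ℕ.≤-trans beyond (ℕ.m≤m+n (b * o) i)))
                              (sym (columnSet-beyond bounded (cof (n · μ) ν (to x)) beyond))
          where beyond = ℕ.*-monoˡ-≤ o (ℕ.≮⇒≥ b≮B)

      module _ {B} e (g≡ : g ≡ gcd (e * (n ∸ 1)) n) (bounded : All (_≤ B * o) (n · μ)) where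

        fixed⇒blockConstant : ∀ x → (φ n μ ν ^∘ e) x ≡ x → BlockConstant o B (columns (B * o) (value (to x)))
        fixed⇒blockConstant x eq = blockwise⇒ x (invariant⇒blockwise n (columnSet (value x)) o g n≡
          (subst (Invariant n (columnSet (value x))) (sym g≡) (invariant-gcd n (columnSet (value x)) (fixed⇒invariant e x eq))))

        blockConstant⇒fixed : ∀ x → BlockConstant o B (columns (B * o) (value (to x))) → (φ n μ ν ^∘ e) x ≡ x
        blockConstant⇒fixed x bc = invariant⇒fixed e x (blockwise⇒invariant n (columnSet (value x)) o g n≡
          (⇒blockwise bounded x bc) (subst (_∣ e * (n ∸ 1)) (sym g≡) (gcd[m,n]∣m (e * (n ∸ 1)) n)))

        -- Being fixed means invariance under the shift by `e * (n ∸ 1)`, hence under the shift by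
        -- its gcd `g` with `n`, and conversely; `reorder` converts period `g` into constant blocks.
        count-fixed : (finite : Finite COF[ n · μ , ν ]) (fixed? : Decidable (λ x → (φ n μ ν ^∘ e) x ≡ x)) →
          Finite.count finite fixed? ≡ Finite.count finite (λ x → blockConstant? o B (columns (B * o) (value x)))
        count-fixed finite fixed? = count-↔ finite reorder fixed?
          (λ x → blockConstant? o B (columns (B * o) (value x))) fixed⇒blockConstant blockConstant⇒fixed

  iterate-+ : ∀ {a} {X : Set a} (f : X → X) k l x → (f ^∘ (k + l)) x ≡ (f ^∘ k) ((f ^∘ l) x)
  iterate-+ f zero    l x = refl
  iterate-+ f (suc k) l x = cong f (iterate-+ f k l x)

  iterate-* : ∀ {a} {X : Set a} (f : X → X) k l x → ((f ^∘ l) ^∘ k) x ≡ (f ^∘ (k * l)) x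
  iterate-* f zero    l x = refl
  iterate-* f (suc k) l x = trans (cong (f ^∘ l) (iterate-* f k l x)) (sym (iterate-+ f l (k * l) x))

  -- A crude number of blocks is enough, since surplus blocks consist of empty columns and are
  -- constant.
  ·-bounded : ∀ o μ → All (_≤ sum μ * o) (o · μ)
  ·-bounded o μ = All.map⁺ (All.map (λ {r} r≤ → ℕ.≤-trans (ℕ.≤-reflexive (ℕ.*-comm o r)) (ℕ.*-monoˡ-≤ o r≤)) (bounded μ))
    where
    bounded : ∀ μ → All (_≤ sum μ) μ
    bounded []      = []
    bounded (r ∷ μ) = ℕ.m≤m+n r (sum μ) ∷ All.map (λ s≤ → ℕ.≤-trans s≤ (ℕ.m≤n+m (sum μ) r)) (bounded μ)

  ·-assoc : ∀ o g n μ → n ≡ g * o → n · μ ≡ o · (g · μ)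
  ·-assoc o g n μ refl = trans (List.map-cong (λ r → trans (cong (ℕ._* r) (ℕ.*-comm g o)) (ℕ.*-assoc o g r)) μ) (List.map-∘ μ)

module OverRing {c ℓ} (R : CommutativeRing c ℓ) where

  open CommutativeRing R hiding (zero; _-_; -_)
  open import Algebra.Properties.Semiring.Mult semiring using () renaming (_×_ to _⊛_)
  open import Algebra.Properties.CommutativeSemiring.Exp commutativeSemiring
  open import Algebra.Properties.Group +-group using (∙-cancelʳ)
  open CommutativeSemigroupProperties +-commutativeSemigroup using () renaming (interchange to +-interchange)
  open CommutativeSemigroupProperties *-commutativeSemigroup using (interchange; x∙yz≈y∙xz)
  open import Relation.Binary.Reasoning.Setoid setoid
  open RingSolver commutativeSemiring using (solve; _:+_; _:*_; _:=_)

  -- Sums over lists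

  ∑∈ : List A → (A → Carrier) → Carrier
  ∑∈ xs f = List.foldr (λ x s → f x + s) 0# xs

  ∑-cong-∈ : ∀ (xs : List A) {f g : A → Carrier} → (∀ {x} → x List.∈ xs → f x ≈ g x) → ∑∈ xs f ≈ ∑∈ xs g
  ∑-cong-∈ []       eq = refl
  ∑-cong-∈ (x ∷ xs) eq = +-cong (eq (here ≡.refl)) (∑-cong-∈ xs (eq ∘ there))

  ∑-cong : ∀ (xs : List A) {f g : A → Carrier} → (∀ x → f x ≈ g x) → ∑∈ xs f ≈ ∑∈ xs g
  ∑-cong xs eq = ∑-cong-∈ xs λ {x} _ → eq x

  ∑-++ : ∀ (xs ys : List A) (f : A → Carrier) → ∑∈ (xs List.++ ys) f ≈ ∑∈ xs f + ∑∈ ys f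
  ∑-++ []       ys f = sym (+-identityˡ _)
  ∑-++ (x ∷ xs) ys f = trans (+-congˡ (∑-++ xs ys f)) (sym (+-assoc _ _ _))

  ∑-map : ∀ (h : A → B) (xs : List A) (f : B → Carrier) → ∑∈ (List.map h xs) f ≡ ∑∈ xs (f ∘ h)
  ∑-map h []       f = ≡.refl
  ∑-map h (x ∷ xs) f = ≡.cong (f (h x) +_) (∑-map h xs f)

  ∑-cartesianProductWith : ∀ {d} {D : Set d} (_⊗_ : A → B → D) xs ys (f : D → Carrier) →
    ∑∈ (cartesianProductWith _⊗_ xs ys) f ≈ ∑∈ xs λ x → ∑∈ ys λ y → f (x ⊗ y)
  ∑-cartesianProductWith _⊗_ []       ys f = refl
  ∑-cartesianProductWith _⊗_ (x ∷ xs) ys f = trans (∑-++ (List.map (x ⊗_) ys) _ f)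
    (+-cong (reflexive (∑-map (x ⊗_) ys f)) (∑-cartesianProductWith _⊗_ xs ys f))

  ∑-+ : ∀ (xs : List A) (f g : A → Carrier) → ∑∈ xs (λ x → f x + g x) ≈ ∑∈ xs f + ∑∈ xs g
  ∑-+ []       f g = sym (+-identityˡ _)
  ∑-+ (x ∷ xs) f g = trans (+-congˡ (∑-+ xs f g)) (+-interchange _ _ _ _)

  ∑-*ˡ : ∀ (xs : List A) k (f : A → Carrier) → ∑∈ xs (λ x → k * f x) ≈ k * ∑∈ xs f
  ∑-*ˡ []       k f = sym (zeroʳ k)
  ∑-*ˡ (x ∷ xs) k f = trans (+-congˡ (∑-*ˡ xs k f)) (sym (distribˡ _ _ _))

  ∑-↭ : ∀ {xs ys : List A} (f : A → Carrier) → xs ↭ ys → ∑∈ xs f ≈ ∑∈ ys f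
  ∑-↭ {xs = xs} {ys} f p = begin
    ∑∈ xs f                           ≡⟨ ∑-map f xs (λ x → x) ⟨
    List.foldr _+_ 0# (List.map f xs) ≈⟨ Permutationₛ.foldr-commMonoid setoid +-isCommutativeMonoid
                                           (Permutationₛ.map⁺ (≡.setoid _) setoid (λ { ≡.refl → refl }) (↭⇒↭ₛ p)) ⟩
    List.foldr _+_ 0# (List.map f ys) ≡⟨ ∑-map f ys (λ x → x) ⟩
    ∑∈ ys f                           ∎

  χ : ∀ {p} {P : Set p} → Dec P → Carrier
  χ p? = if does p? then 1# else 0#

  χ-yes : ∀ {p} {P : Set p} (p? : Dec P) → P → χ p? ≡ 1#
  χ-yes p? p = ≡.cong (if_then 1# else 0#) (dec-true p? p)

  χ-no : ∀ {p} {P : Set p} (p? : Dec P) → ¬ P → χ p? ≡ 0#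
  χ-no p? ¬p = ≡.cong (if_then 1# else 0#) (dec-false p? ¬p)

  χ-⇔ : ∀ {p q} {P : Set p} {Q : Set q} → P ⇔ Q → (p? : Dec P) (q? : Dec Q) → χ p? ≡ χ q?
  χ-⇔ P⇔Q p? q? = ≡.cong (if_then 1# else 0#) (does-⇔ P⇔Q p? q?)

  χ-× : ∀ {p q} {P : Set p} {Q : Set q} (p? : Dec P) (q? : Dec Q) → χ (p? ×-dec q?) ≈ χ p? * χ q?
  χ-× p? q? with does p?
  ... | true  = sym (*-identityˡ _)
  ... | false = sym (zeroˡ _)

  χ-cong : ∀ {p} {P : Set p} (p? : Dec P) {x y} → (P → x ≈ y) → χ p? * x ≈ χ p? * y
  χ-cong (yes p) eq = *-congˡ (eq p)
  χ-cong (no _)  eq = trans (zeroˡ _) (sym (zeroˡ _))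

  ∑-filter : ∀ {p} {P : A → Set p} (P? : Decidable P) xs (f : A → Carrier) →
             ∑∈ (filter P? xs) f ≈ ∑∈ xs λ x → χ (P? x) * f x
  ∑-filter P? []       f = refl
  ∑-filter P? (x ∷ xs) f with does (P? x)
  ... | true  = +-cong (sym (*-identityˡ _)) (∑-filter P? xs f)
  ... | false = trans (∑-filter P? xs f) (trans (sym (+-identityˡ _)) (+-congʳ (sym (zeroˡ _))))

  ∑-χ-cong : ∀ {p} {P : A → Set p} (P? : Decidable P) xs {f g : A → Carrier} → (∀ x → P x → f x ≈ g x) →
             ∑∈ xs (λ x → χ (P? x) * f x) ≈ ∑∈ xs (λ x → χ (P? x) * g x)
  ∑-χ-cong P? xs eq = ∑-cong xs λ x → χ-cong (P? x) (eq x)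

  ∑-reindex : ∀ {p} {P : A → Set p} (P? : Decidable P) (h : A → B) xs ys → List.map h (filter P? xs) ↭ ys →
              (f : B → Carrier) → ∑∈ xs (λ x → χ (P? x) * f (h x)) ≈ ∑∈ ys f
  ∑-reindex P? h xs ys perm f = begin
    ∑∈ xs (λ x → χ (P? x) * f (h x))    ≈⟨ ∑-filter P? xs (f ∘ h) ⟨
    ∑∈ (filter P? xs) (f ∘ h)           ≡⟨ ∑-map h (filter P? xs) f ⟨
    ∑∈ (List.map h (filter P? xs)) f    ≈⟨ ∑-↭ f perm ⟩
    ∑∈ ys f                             ∎

  ∑-select : ∀ {A : Set} {P : A → Set} (P? : Decidable P) xs (f : A → Carrier) →
             ∑∈ (select P? xs) (f ∘ value) ≈ ∑∈ xs λ x → χ (P? x) * f x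
  ∑-select P? []       f = refl
  ∑-select P? (x ∷ xs) f with P? x
  ... | yes _ = +-cong (sym (*-identityˡ _)) (∑-select P? xs f)
  ... | no  _ = trans (∑-select P? xs f) (trans (sym (+-identityˡ _)) (+-congʳ (sym (zeroˡ _))))

  length-filter : ∀ {p} {P : A → Set p} (P? : Decidable P) xs →
                  length (filter P? xs) ⊛ 1# ≈ ∑∈ xs (χ ∘ P?)
  length-filter P? []       = refl
  length-filter P? (x ∷ xs) with does (P? x)
  ... | true  = +-congˡ (length-filter P? xs)
  ... | false = trans (length-filter P? xs) (sym (+-identityˡ _))

  -- Sums over subsets and over tuples of subsets

  ∑-subsets-∷ : ∀ m (f : Subset (suc m) → Carrier) →
                ∑∈ (subsets (suc m)) f ≈ ∑∈ (subsets m) λ S → f (false ∷ S) + f (true ∷ S)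
  ∑-subsets-∷ m f = trans (∑-++ (List.map (false ∷_) (subsets m)) _ f)
    (trans (reflexive (≡.cong₂ _+_ (∑-map _ (subsets m) f) (∑-map _ (subsets m) f))) (sym (∑-+ (subsets m) _ _)))

  ∑-subsets₂ : ∀ m (f : Subset (suc (suc m)) → Carrier) → ∑∈ (subsets (suc (suc m))) f ≈
    ∑∈ (subsets m) λ T → (f (false ∷ false ∷ T) + f (false ∷ true ∷ T))
                        + (f (true ∷ false ∷ T) + f (true ∷ true ∷ T))
  ∑-subsets₂ m f = begin
    ∑∈ (subsets (suc (suc m))) f
      ≈⟨ trans (∑-subsets-∷ (suc m) f) (∑-+ (subsets (suc m)) _ _) ⟩
    ∑∈ (subsets (suc m)) (f ∘ (false ∷_)) + ∑∈ (subsets (suc m)) (f ∘ (true ∷_))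
      ≈⟨ +-cong (∑-subsets-∷ m _) (∑-subsets-∷ m _) ⟩
    _ ≈⟨ ∑-+ (subsets m) _ _ ⟨
    _ ∎

  -- Splitting off the largest letter, against the smallest in `∑-subsets-∷`, is what makes rotating
  -- the alphabet a reindexing of the sum.
  ∑-subsets-∷ʳ : ∀ m (f : Subset (suc m) → Carrier) →
                 ∑∈ (subsets (suc m)) f ≈ ∑∈ (subsets m) λ S → f (S ∷ʳ false) + f (S ∷ʳ true)
  ∑-subsets-∷ʳ zero    f = sym (+-assoc _ _ _)
  ∑-subsets-∷ʳ (suc m) f = begin
    ∑∈ (subsets (suc (suc m))) f
      ≈⟨ trans (∑-subsets-∷ (suc m) f) (∑-+ (subsets (suc m)) _ _) ⟩
    ∑∈ (subsets (suc m)) (f ∘ (false ∷_)) + ∑∈ (subsets (suc m)) (f ∘ (true ∷_))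
      ≈⟨ +-cong (∑-subsets-∷ʳ m _) (∑-subsets-∷ʳ m _) ⟩
    _ ≈⟨ trans (∑-subsets-∷ m _) (∑-+ (subsets m) _ _) ⟨
    ∑∈ (subsets (suc m)) (λ S → f (S ∷ʳ false) + f (S ∷ʳ true)) ∎

  ∑-tuples-suc : ∀ m h r (f : Vec (Subset m) (suc r) → Carrier) → ∑∈ (tuples m h (suc r)) f ≈
    ∑∈ (subsets m) λ S → χ (∣ S ∣ ℕ.≟ h 0) * ∑∈ (tuples m (h ∘ suc) r) (f ∘ (S ∷_))
  ∑-tuples-suc m h r f = trans (∑-cartesianProductWith _∷_ (subsetsOfSize m (h 0)) (tuples m (h ∘ suc) r) f)
    (∑-filter (λ S → ∣ S ∣ ℕ.≟ h 0) (subsets m) _)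

  ∑-tuples-rotate : ∀ m h r (f : Vec (Subset (suc m)) r → Carrier) →
                    ∑∈ (tuples (suc m) h r) f ≈ ∑∈ (tuples (suc m) h r) (f ∘ Vec.map rotate)
  ∑-tuples-rotate m h zero    f = refl
  ∑-tuples-rotate m h (suc r) f = begin
    _ ≈⟨ trans (∑-tuples-suc (suc m) h r f) (∑-subsets-∷ʳ m _) ⟩
    _ ≈⟨ ∑-cong (subsets m) (λ S → +-cong (turn false S) (turn true S)) ⟩
    _ ≈⟨ trans (∑-tuples-suc (suc m) h r (f ∘ Vec.map rotate)) (∑-subsets-∷ m _) ⟨
    _ ∎
    where
    turn : ∀ b S → χ (∣ S ∷ʳ b ∣ ℕ.≟ h 0) * ∑∈ (tuples (suc m) (h ∘ suc) r) (f ∘ ((S ∷ʳ b) ∷_)) ≈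
                   χ (∣ b ∷ S ∣ ℕ.≟ h 0) * ∑∈ (tuples (suc m) (h ∘ suc) r) (f ∘ Vec.map rotate ∘ ((b ∷ S) ∷_))
    turn b S = *-cong (reflexive (≡.cong (λ k → χ (k ℕ.≟ h 0)) (∣∷ʳ∣ b S)))
      (∑-tuples-rotate m (h ∘ suc) r (f ∘ ((S ∷ʳ b) ∷_)))

  ∑-tuples-++ : ∀ m (h : ℕ → ℕ) r s (f : Vec (Subset m) (r ℕ.+ s) → Carrier) → ∑∈ (tuples m h (r ℕ.+ s)) f ≈
    ∑∈ (tuples m h r) λ u → ∑∈ (tuples m (h ∘ (r ℕ.+_)) s) λ w → f (u ++ w)
  ∑-tuples-++ m h zero    s f = sym (+-identityʳ _)
  ∑-tuples-++ m h (suc r) s f = begin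
    _ ≈⟨ ∑-cartesianProductWith _∷_ (subsetsOfSize m (h 0)) (tuples m (h ∘ suc) (r ℕ.+ s)) f ⟩
    _ ≈⟨ ∑-cong (subsetsOfSize m (h 0)) (λ S → ∑-tuples-++ m (h ∘ suc) r s (f ∘ (S ∷_))) ⟩
    _ ≈⟨ ∑-cartesianProductWith _∷_ (subsetsOfSize m (h 0)) (tuples m (h ∘ suc) r) _ ⟨
    _ ∎

  1^ : ∀ k → 1# ^ k ≈ 1#
  1^ zero    = refl
  1^ (suc k) = trans (*-identityˡ _) (1^ k)

  -- The major index at a root of unity as the energy of the columns

  module RootOfUnity (y : Carrier) (q : ℕ) (y^o : y ^ suc q ≈ 1#) where

    private
      o = suc q
      z = y ^ q

    z^k*y^k : ∀ k → z ^ k * y ^ k ≈ 1#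
    z^k*y^k k = begin
      z ^ k * y ^ k   ≈⟨ ^-distrib-* z y k ⟨
      (z * y) ^ k     ≈⟨ ^-congˡ k (trans (*-comm z y) y^o) ⟩
      1# ^ k          ≈⟨ 1^ k ⟩
      1#              ∎

    y^[o*k] : ∀ k → y ^ (suc q ℕ.* k) ≈ 1#
    y^[o*k] k = trans (sym (^-assocʳ y (suc q) k)) (trans (^-congˡ k y^o) (1^ k))

    ∣⇒y^≈1 : ∀ {k} → o ∣ k → y ^ k ≈ 1#
    ∣⇒y^≈1 (divides p ≡.refl) = trans (reflexive (≡.cong (y ^_) (ℕ.*-comm p o))) (y^[o*k] p)

    z^≈y^ : ∀ a b → o ∣ a ℕ.+ b → z ^ a ≈ y ^ b
    z^≈y^ a b o∣ = begin
      z ^ a                     ≈⟨ *-identityʳ _ ⟨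
      z ^ a * 1#                ≈⟨ *-congˡ (∣⇒y^≈1 o∣) ⟨
      z ^ a * y ^ (a ℕ.+ b)     ≈⟨ *-congˡ (^-homo-* y a b) ⟩
      z ^ a * (y ^ a * y ^ b)   ≈⟨ *-assoc _ _ _ ⟨
      z ^ a * y ^ a * y ^ b     ≈⟨ *-congʳ (z^k*y^k a) ⟩
      1# * y ^ b                ≈⟨ *-identityˡ _ ⟩
      y ^ b                     ∎

    y^[j*] : ∀ {j} → o ∣ j → ∀ k → y ^ (j ℕ.* k) ≈ 1#
    y^[j*] {j} o∣j k = ∣⇒y^≈1 (∣m⇒∣m*n k o∣j)

    -- Detaches one row, with `x` its entry in column `j`. Between columns of equal height this is
    -- `excess-best`. Where heights may differ, and where the row ends, the index of the next column
    -- is a multiple of `o`, so the power of `y` is 1 whatever the excess is.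
    energy-row : ∀ {m r} k j (x : Fin m) (v : Vec (Fin m) r) (S : Subset m) (f : ℕ → Subset m) →
      r ≤ k → o ∣ suc (j ℕ.+ r) → x ∈ S → RowFits (just x) f v →
      (∀ i → o ∤ suc (j ℕ.+ i) → ∣ (S ◂ f) i ∣ ≡ ∣ f i ∣) →
      y ^ energy j S (prefix k f) ≈ y ^ descentEnergy j x v * y ^ energy j (S - x) (prefix k (remove f v))
    energy-row zero    j x []      S f r≤k o∣ x∈ fits flat = sym (*-identityˡ _)
    energy-row (suc k) j x []      S f r≤k o∣ x∈ fits flat = begin
      y ^ (suc j ℕ.* excess S (f 0) ℕ.+ W)        ≈⟨ drop (excess S (f 0)) ⟩
      y ^ W                                       ≈⟨ drop (excess (S - x) (f 0)) ⟨
      y ^ (suc j ℕ.* excess (S - x) (f 0) ℕ.+ W)  ≈⟨ *-identityˡ _ ⟨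
      _                                           ∎
      where
      W = energy (suc j) (f 0) (prefix k (f ∘ suc))
      drop : ∀ e → y ^ (suc j ℕ.* e ℕ.+ W) ≈ y ^ W
      drop e = trans (^-homo-* y (suc j ℕ.* e) W)
        (trans (*-congʳ (y^[j*] (≡.subst (λ i → o ∣ suc i) (ℕ.+-identityʳ j) o∣) e)) (*-identityˡ _))
    energy-row {r = suc r} (suc k) j x (t ∷ v) S f (s≤s r≤k) o∣ x∈ fits flat = begin
      y ^ (suc j ℕ.* excess S (f 0) ℕ.+ energy (suc j) (f 0) (prefix k (f ∘ suc)))
        ≈⟨ ^-homo-* y (suc j ℕ.* excess S (f 0)) _ ⟩
      y ^ (suc j ℕ.* excess S (f 0)) * y ^ energy (suc j) (f 0) (prefix k (f ∘ suc))
        ≈⟨ *-cong step (energy-row k (suc j) t v (f 0) (f ∘ suc) r≤k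
             (≡.subst (λ i → o ∣ suc i) (ℕ.+-suc j r) o∣) (proj₁ (fits zero)) (fits ∘ suc) flat′) ⟩
      (y ^ (suc j ℕ.* descent x t) * y ^ (suc j ℕ.* e′)) * (y ^ D * y ^ W′)
        ≈⟨ interchange _ _ _ _ ⟩
      (y ^ (suc j ℕ.* descent x t) * y ^ D) * (y ^ (suc j ℕ.* e′) * y ^ W′)
        ≈⟨ *-cong (^-homo-* y (suc j ℕ.* descent x t) D) (^-homo-* y (suc j ℕ.* e′) W′) ⟨
      y ^ (suc j ℕ.* descent x t ℕ.+ D) * y ^ (suc j ℕ.* e′ ℕ.+ W′) ∎
      where
      e′ = excess (S - x) (f 0 - t)
      D  = descentEnergy (suc j) t v
      W′ = energy (suc j) (f 0 - t) (prefix k (remove (f ∘ suc) v))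
      step : y ^ (suc j ℕ.* excess S (f 0)) ≈ y ^ (suc j ℕ.* descent x t) * y ^ (suc j ℕ.* e′)
      step with o ∣? suc j
      ... | yes o∣j = trans (y^[j*] o∣j (excess S (f 0)))
        (sym (trans (*-cong (y^[j*] o∣j (descent x t)) (y^[j*] o∣j e′)) (*-identityˡ _)))
      ... | no  o∤j = trans (reflexive (≡.cong (y ^_) (≡.trans
          (≡.cong (suc j ℕ.*_) (excess-best S (f 0) (flat 0 (o∤j ∘ ≡.subst (λ i → o ∣ suc i) (ℕ.+-identityʳ j))) x∈ (fits zero)))
          (ℕ.*-distribˡ-+ (suc j) (descent x t) e′))))
        (^-homo-* y (suc j ℕ.* descent x t) (suc j ℕ.* e′))
      flat′ : ∀ i → o ∤ suc (suc j ℕ.+ i) → ∣ (f 0 ◂ f ∘ suc) i ∣ ≡ ∣ f (suc i) ∣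
      flat′ zero    o∤ = flat 1 (o∤ ∘ ≡.subst (λ i → o ∣ suc i) (ℕ.+-suc j 0))
      flat′ (suc i) o∤ = flat (suc (suc i)) (o∤ ∘ ≡.subst (λ i → o ∣ suc i) (ℕ.+-suc j (suc i)))

    energy₀-row : ∀ {m r} N (v : Vec (Fin m) r) (S : ℕ → Subset m) → o ∣ r → r ≤ N → RowFits nothing S v → Flat o S →
      y ^ energy₀ (prefix N S) ≈ z ^ rowMaj v * y ^ energy₀ (prefix N (remove S v))
    energy₀-row N [] S o∣ r≤N fits flat = sym (*-identityˡ _)
    energy₀-row (suc N) (x ∷ v) S o∣ (s≤s r≤N) fits flat = trans
      (energy-row N 0 x v (S 0) (S ∘ suc) r≤N o∣ (proj₁ (fits zero)) (later x v fits) flat′)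
      (*-congʳ (sym (z^≈y^ (majFrom x v) (descentEnergy 0 x v) (∣majFrom+descentEnergy o 0 x v o∣))))
      where
      later : ∀ {r} (x : Fin _) (v : Vec (Fin _) r) → RowFits nothing S (x ∷ v) → RowFits (just x) (S ∘ suc) v
      later x v fits = fits ∘ suc
      flat′ : ∀ i → o ∤ suc i → ∣ (S 0 ◂ S ∘ suc) i ∣ ≡ ∣ S (suc i) ∣
      flat′ zero    = flat 0
      flat′ (suc i) = flat (suc i)

    height-flat : ∀ μ j → o ∤ suc j → height (o · μ) j ≡ height (o · μ) (suc j)
    height-flat μ j o∤ = height-block o μ (sameBlock j o∤)
      where
      sameBlock : ∀ j → o ∤ suc j → j / o ≡ suc j / o
      sameBlock j o∤ = ≡.sym (≡.trans (≡.cong (_/ o) (≡.trans (≡.cong suc (m≡m%n+[m/n]*n j o)) (ℕ.+-comm (suc (j % o)) (j / o ℕ.* o))))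
        ([b*o+i]/o≡b o (j / o) (ℕ.≤∧≢⇒< (m%n<n j o) λ eq → o∤ (divides (suc (j / o))
          (≡.trans (≡.cong suc (m≡m%n+[m/n]*n j o)) (≡.cong (ℕ._+ j / o ℕ.* o) eq))))))

    -- Induction on the rows: `remove S v` gives the column sets of the remaining rows, and all row
    -- lengths are multiples of `o`.
    maj-energy : ∀ {m N} μ (F : Filling (o · μ) m) (S : ℕ → Subset m) → All (_≤ N) (o · μ) → Fits S F →
                 y ^ energy₀ (prefix N S) ≈ z ^ maj F
    maj-energy {N = N} []      []      S bounded fits = reflexive (≡.cong (y ^_) (energy₀-⊥ N fits))
    maj-energy {N = N} (r ∷ μ) (v ∷ F) S (r≤N ∷ bounded) (v-fits , F-fits) = begin
      y ^ energy₀ (prefix N S)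
        ≈⟨ energy₀-row N v S (m∣m*n r) r≤N v-fits flat ⟩
      z ^ rowMaj v * y ^ energy₀ (prefix N (remove S v))
        ≈⟨ *-congˡ (maj-energy μ F (remove S v) bounded F-fits) ⟩
      z ^ rowMaj v * z ^ maj F
        ≈⟨ ^-homo-* z (rowMaj v) (maj F) ⟨
      z ^ (rowMaj v ℕ.+ maj F)
        ≡⟨ ≡.cong (z ^_) (maj-∷ v F) ⟨
      z ^ maj (v ∷ F) ∎
      where
      flat : Flat o S
      flat j o∤ = ≡.trans (fits-height {F = v ∷ F} (v-fits , F-fits) j) (≡.trans (height-flat (r ∷ μ) j o∤)
        (≡.sym (fits-height {F = v ∷ F} (v-fits , F-fits) (suc j))))

    energy-periodic : ∀ {m r} j (S : Subset m) (w : Vec (Subset m) r) → y ^ energy (o ℕ.+ j) S w ≈ y ^ energy j S w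
    energy-periodic j S []      = refl
    energy-periodic j S (T ∷ w) = begin
      y ^ (suc (o ℕ.+ j) ℕ.* e ℕ.+ energy (suc (o ℕ.+ j)) T w) ≈⟨ ^-homo-* y (suc (o ℕ.+ j) ℕ.* e) _ ⟩
      y ^ (suc (o ℕ.+ j) ℕ.* e) * y ^ energy (suc (o ℕ.+ j)) T w ≡⟨ ≡.cong₂ (λ a b → y ^ a * y ^ energy b T w)
             (≡.trans (≡.cong (ℕ._* e) (≡.sym (ℕ.+-suc o j))) (ℕ.*-distribʳ-+ e o (suc j))) (≡.sym (ℕ.+-suc o j)) ⟩
      y ^ (o ℕ.* e ℕ.+ suc j ℕ.* e) * y ^ energy (o ℕ.+ suc j) T w ≈⟨ *-cong
             (trans (^-homo-* y (o ℕ.* e) (suc j ℕ.* e)) (trans (*-congʳ (y^[o*k] e)) (*-identityˡ _)))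
             (energy-periodic (suc j) T w) ⟩
      y ^ (suc j ℕ.* e) * y ^ energy (suc j) T w ≈⟨ ^-homo-* y (suc j ℕ.* e) _ ⟨
      y ^ (suc j ℕ.* e ℕ.+ energy (suc j) T w) ∎
      where e = excess S T

    -- At the seam the column index is `o`, so the excess across it has no effect, and by
    -- `energy-periodic` the indices may restart at 0.
    energy-++ : ∀ {m r s} j (S : Subset m) (u : Vec (Subset m) r) (w : Vec (Subset m) s) → suc (j ℕ.+ r) ≡ o →
                y ^ energy j S (u ++ w) ≈ y ^ energy j S u * y ^ energy₀ w
    energy-++ j S []      []      eq = sym (*-identityˡ _)
    energy-++ j S []      (T ∷ w) eq with ≡.trans (≡.cong suc (≡.sym (ℕ.+-identityʳ j))) eq
    ... | ≡.refl = begin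
      y ^ (o ℕ.* excess S T ℕ.+ energy o T w) ≈⟨ ^-homo-* y (o ℕ.* excess S T) _ ⟩
      y ^ (o ℕ.* excess S T) * y ^ energy o T w ≈⟨ *-cong (y^[o*k] (excess S T)) (trans
             (reflexive (≡.cong (λ j → y ^ energy j T w) (≡.sym (ℕ.+-identityʳ o)))) (energy-periodic 0 T w)) ⟩
      1# * y ^ energy 0 T w ∎
    energy-++ {r = suc r} j S (T ∷ u) w eq = begin
      y ^ (e ℕ.+ energy (suc j) T (u ++ w)) ≈⟨ ^-homo-* y e _ ⟩
      y ^ e * y ^ energy (suc j) T (u ++ w) ≈⟨ *-congˡ (energy-++ (suc j) T u w (≡.trans (≡.cong suc (≡.sym (ℕ.+-suc j r))) eq)) ⟩
      y ^ e * (y ^ energy (suc j) T u * y ^ energy₀ w) ≈⟨ *-assoc _ _ _ ⟨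
      y ^ e * y ^ energy (suc j) T u * y ^ energy₀ w ≈⟨ *-congʳ (^-homo-* y e _) ⟨
      y ^ (e ℕ.+ energy (suc j) T u) * y ^ energy₀ w ∎
      where e = suc j ℕ.* excess S T

    energy₀-++ : ∀ {m s} (u : Vec (Subset m) o) (w : Vec (Subset m) s) →
                 y ^ energy₀ (u ++ w) ≈ y ^ energy₀ u * y ^ energy₀ w
    energy₀-++ (S ∷ u) w = energy-++ 0 S u w ≡.refl

    -- What remains of the primitivity of y over a ring.
    Cancels : Set _
    Cancels = ∀ k → k < q → ∀ a → y ^ suc k * a ≈ a → a ≈ 0#

    -- One block of columns of equal height

    module Block (h : ℕ) where

      -- The continuations of column j with set S by r columns of size h.
      Φ : ∀ {m} → ℕ → (r : ℕ) → Subset m → (Vec ℕ m → Carrier) → Carrier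
      Φ {m} j r S g = ∑∈ (tuples m (const h) r) λ v → y ^ energy j S v * g (multiplicities v)

      Φ-cong : ∀ {m} j r (S : Subset m) {f g} → (∀ c → f c ≈ g c) → Φ j r S f ≈ Φ j r S g
      Φ-cong j r S eq = ∑-cong (tuples _ (const h) r) λ v → *-congˡ (eq (multiplicities v))

      size : ∀ {m} → Subset m → Carrier
      size T = χ (∣ T ∣ ℕ.≟ h)

      Φ-suc : ∀ {m} j r (S : Subset m) g → Φ j (suc r) S g ≈
              ∑∈ (subsets m) λ T → size T * (y ^ (suc j ℕ.* excess S T) * Φ (suc j) r T (g ∘ (T ⊞_)))
      Φ-suc {m} j r S g = begin
        _ ≈⟨ ∑-tuples-suc m (const h) r _ ⟩
        _ ≈⟨ ∑-cong (subsets m) (λ T → *-congˡ (trans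
               (∑-cong (tuples m (const h) r) λ v → trans (*-congʳ (^-homo-* y (suc j ℕ.* excess S T) _)) (*-assoc _ _ _))
               (∑-*ˡ (tuples m (const h) r) (y ^ (suc j ℕ.* excess S T)) _))) ⟩
        _ ∎

      -- This can fail only if S contains the first letter and not the second.
      SwapFree : ∀ {m} → Subset (suc (suc m)) → Set
      SwapFree S = ∀ T → excess S (true ∷ false ∷ T) ≡ excess S (false ∷ true ∷ T)

      -- If the next column contains both letters or neither, it is swap-free and equal to its own
      -- mirror image, so induction applies to it alone. The two mixed columns have equal weight
      -- because `S` is swap-free, and are handled together by `Φ-swap₂`.
      Φ-swap : ∀ {m} r j (S : Subset (suc (suc m))) → SwapFree S → ∀ g → Φ j r S g ≈ Φ j r S (g ∘ swap)
      Φ-swap₂ : ∀ {m} r j (S : Subset m) g →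
        Φ j r (true ∷ false ∷ S) (g ∘ ((true ∷ false ∷ S) ⊞_)) +
        Φ j r (false ∷ true ∷ S) (g ∘ ((false ∷ true ∷ S) ⊞_)) ≈
        Φ j r (true ∷ false ∷ S) (g ∘ swap ∘ ((true ∷ false ∷ S) ⊞_)) +
        Φ j r (false ∷ true ∷ S) (g ∘ swap ∘ ((false ∷ true ∷ S) ⊞_))

      Φ-swap zero j S free g = refl
      Φ-swap {m} (suc r) j S free g = begin
        Φ j (suc r) S g           ≈⟨ trans (Φ-suc j r S g) (∑-subsets₂ m _) ⟩
        _                         ≈⟨ ∑-cong (subsets m) summand ⟩
        _                         ≈⟨ trans (Φ-suc j r S (g ∘ swap)) (∑-subsets₂ m _) ⟨
        Φ j (suc r) S (g ∘ swap)  ∎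
        where
        F : Subset (suc (suc m)) → (Vec ℕ (suc (suc m)) → Carrier) → Carrier
        F T g = size T * (y ^ (suc j ℕ.* excess S T) * Φ (suc j) r T (g ∘ (T ⊞_)))
        fixed : ∀ T → SwapFree T → swap T ≡ T → F T g ≈ F T (g ∘ swap)
        fixed T free eq = *-congˡ (*-congˡ (trans (Φ-swap r (suc j) T free (g ∘ (T ⊞_)))
          (Φ-cong (suc j) r T {g ∘ (T ⊞_) ∘ swap} {g ∘ swap ∘ (T ⊞_)}
            λ c → reflexive (≡.cong g (≡.sym (≡.trans (swap-⊞ T c) (≡.cong (_⊞ swap c) eq)))))))
        gather : ∀ k e u v → k * (e * u) + k * (e * v) ≈ k * (e * (v + u))
        gather = solve 4 (λ k e u v → k :* (e :* u) :+ k :* (e :* v) := k :* (e :* (v :+ u))) refl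
        summand : ∀ T → _
        summand T = begin
          (F OO g + F OI g) + (F IO g + F II g) ≈⟨ middle (F OO g) (F OI g) (F IO g) (F II g) ⟩
          (F OO g + F II g) + (F OI g + F IO g) ≈⟨ +-cong (+-cong (fixed OO (λ _ → ≡.refl) ≡.refl) (fixed II (λ _ → ≡.refl) ≡.refl)) mixed ⟩
          (F OO g′ + F II g′) + (F OI g′ + F IO g′) ≈⟨ middle (F OO g′) (F OI g′) (F IO g′) (F II g′) ⟨
          (F OO g′ + F OI g′) + (F IO g′ + F II g′) ∎
          where
          g′ = g ∘ swap
          OO = false ∷ false ∷ T
          OI = false ∷ true ∷ T
          IO = true ∷ false ∷ T
          II = true ∷ true ∷ T
          middle : ∀ a b c d → (a + b) + (c + d) ≈ (a + d) + (b + c)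
          middle = solve 4 (λ a b c d → (a :+ b) :+ (c :+ d) := (a :+ d) :+ (b :+ c)) refl
          F-IO : ∀ g → F IO g ≡ size OI * (y ^ (suc j ℕ.* excess S OI) * Φ (suc j) r IO (g ∘ (IO ⊞_)))
          F-IO g = ≡.cong (λ e → size OI * (y ^ (suc j ℕ.* e) * Φ (suc j) r IO (g ∘ (IO ⊞_)))) (free T)
          mixed : F OI g + F IO g ≈ F OI g′ + F IO g′
          mixed = begin
            F OI g + F IO g ≈⟨ +-congˡ (reflexive (F-IO g)) ⟩
            _ ≈⟨ gather _ _ _ _ ⟩
            _ ≈⟨ *-congˡ (*-congˡ (Φ-swap₂ r (suc j) T g)) ⟩
            _ ≈⟨ gather _ _ _ _ ⟨
            _ ≈⟨ +-congˡ (reflexive (F-IO g′)) ⟨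
            F OI g′ + F IO g′ ∎

      -- Only the step from IO to OI has an exceptional weight; what it adds to the sum is
      -- invariant under the swap by itself (Q≈Q′).
      Φ-swap₂ zero j S g = +-comm (Φ j zero (true ∷ false ∷ S) (g ∘ ((true ∷ false ∷ S) ⊞_))) (Φ j zero (false ∷ true ∷ S) (g ∘ ((false ∷ true ∷ S) ⊞_)))
      Φ-swap₂ {m} (suc r) j S g = begin
        Φ j (suc r) IO g₁ + Φ j (suc r) OI g₂ ≈⟨ expand g₁ g₂ ⟩
        ∑∈ (subsets m) (λ T → summand T g₁ g₂)  ≈⟨ ∑-cong (subsets m) (λ T → regroup T) ⟩
        ∑∈ (subsets m) (λ T → summand T g₁′ g₂′) ≈⟨ expand g₁′ g₂′ ⟨
        Φ j (suc r) IO g₁′ + Φ j (suc r) OI g₂′ ∎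
        where
        IO = true ∷ false ∷ S
        OI = false ∷ true ∷ S
        g₁ = g ∘ (IO ⊞_)
        g₂ = g ∘ (OI ⊞_)
        g₁′ = g ∘ swap ∘ (IO ⊞_)
        g₂′ = g ∘ swap ∘ (OI ⊞_)
        F : Subset (suc (suc m)) → Subset (suc (suc m)) → (Vec ℕ (suc (suc m)) → Carrier) → Carrier
        F S T g = size T * (y ^ (suc j ℕ.* excess S T) * Φ (suc j) r T (g ∘ (T ⊞_)))
        quad : Subset (suc (suc m)) → Subset m → (Vec ℕ (suc (suc m)) → Carrier) → Carrier
        quad S T g = (F S (false ∷ false ∷ T) g + F S (false ∷ true ∷ T) g) + (F S (true ∷ false ∷ T) g + F S (true ∷ true ∷ T) g)
        summand : Subset m → (g₁ g₂ : Vec ℕ (suc (suc m)) → Carrier) → Carrier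
        summand T g₁ g₂ = quad IO T g₁ + quad OI T g₂
        expand : ∀ g₁ g₂ → Φ j (suc r) IO g₁ + Φ j (suc r) OI g₂ ≈ ∑∈ (subsets m) λ T → summand T g₁ g₂
        expand g₁ g₂ = trans (+-cong (trans (Φ-suc j r IO g₁) (∑-subsets₂ m _)) (trans (Φ-suc j r OI g₂) (∑-subsets₂ m _)))
          (sym (∑-+ (subsets m) _ _))
        swap₁ : ∀ c → g (IO ⊞ swap c) ≈ g (swap (OI ⊞ c))
        swap₁ c = reflexive (≡.cong g (≡.sym (swap-⊞ OI c)))
        swap₂ : ∀ c → g (OI ⊞ swap c) ≈ g (swap (IO ⊞ c))
        swap₂ c = reflexive (≡.cong g (≡.sym (swap-⊞ IO c)))
        regroup : ∀ T → summand T g₁ g₂ ≈ summand T g₁′ g₂′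
        regroup T = begin
          summand T g₁ g₂ ≈⟨ collect _ _ _ _ _ _ _ _ _ _ _ _ _ _ _ ⟩
          _ ≈⟨ +-cong (+-cong (*-congˡ (*-congˡ (pair OO (λ _ → ≡.refl) ≡.refl))) (*-congˡ (*-congˡ (pair II (λ _ → ≡.refl) ≡.refl))))
                 -- The three mixed terms of ordinary weight are symmetric by subtraction: together
                 -- with `Ψ OIᵀ g₁` they form the symmetric total `sum`, and that term is symmetric
                 -- by `Q≈Q′`.
                 (*-congˡ (+-cong (*-congˡ Q≈Q′) (*-congˡ (∙-cancelʳ _ _ _ (trans sum (+-congˡ (sym Q≈Q′))))))) ⟩
          _ ≈⟨ collect _ _ _ _ _ _ _ _ _ _ _ _ _ _ _ ⟨
          summand T g₁′ g₂′ ∎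
          where
          OO = false ∷ false ∷ T
          II = true ∷ true ∷ T
          OIᵀ = false ∷ true ∷ T
          IOᵀ = true ∷ false ∷ T
          Ψ : Subset (suc (suc m)) → (Vec ℕ (suc (suc m)) → Carrier) → Carrier
          Ψ T g = Φ (suc j) r T (g ∘ (T ⊞_))
          -- `e₁′` is the exceptional weight, from `IO` to `OIᵀ`; the other three mixed transitions
          -- share `e₁`.
          collect : ∀ k₀ k₁ k₂ e₀ e₁ e₁′ e₂ a b c d a′ b′ c′ d′ →
            ((k₀ * (e₀ * a) + k₁ * (e₁′ * b)) + (k₁ * (e₁ * c) + k₂ * (e₂ * d))) +
            ((k₀ * (e₀ * a′) + k₁ * (e₁ * b′)) + (k₁ * (e₁ * c′) + k₂ * (e₂ * d′))) ≈
            (k₀ * (e₀ * (a + a′)) + k₂ * (e₂ * (d + d′))) + k₁ * (e₁′ * b + e₁ * (c + (c′ + b′)))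
          collect = solve 15 (λ k₀ k₁ k₂ e₀ e₁ e₁′ e₂ a b c d a′ b′ c′ d′ →
            ((k₀ :* (e₀ :* a) :+ k₁ :* (e₁′ :* b)) :+ (k₁ :* (e₁ :* c) :+ k₂ :* (e₂ :* d))) :+
            ((k₀ :* (e₀ :* a′) :+ k₁ :* (e₁ :* b′)) :+ (k₁ :* (e₁ :* c′) :+ k₂ :* (e₂ :* d′))) :=
            (k₀ :* (e₀ :* (a :+ a′)) :+ k₂ :* (e₂ :* (d :+ d′))) :+ k₁ :* (e₁′ :* b :+ e₁ :* (c :+ (c′ :+ b′)))) refl
          pair : ∀ T → SwapFree T → swap T ≡ T → Ψ T g₁ + Ψ T g₂ ≈ Ψ T g₁′ + Ψ T g₂′
          pair T free eq = trans (+-cong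
              (trans (Φ-swap r (suc j) T free (g₁ ∘ (T ⊞_))) (Φ-cong (suc j) r T {g₁ ∘ (T ⊞_) ∘ swap} {g₂′ ∘ (T ⊞_)} λ c →
                trans (reflexive (≡.cong g₁ (through c))) (swap₁ (T ⊞ c))))
              (trans (Φ-swap r (suc j) T free (g₂ ∘ (T ⊞_))) (Φ-cong (suc j) r T {g₂ ∘ (T ⊞_) ∘ swap} {g₁′ ∘ (T ⊞_)} λ c →
                trans (reflexive (≡.cong g₂ (through c))) (swap₂ (T ⊞ c)))))
            (+-comm _ _)
            where
            through : ∀ c → T ⊞ swap c ≡ swap (T ⊞ c)
            through c = ≡.sym (≡.trans (swap-⊞ T c) (≡.cong (_⊞ swap c) eq))
          -- One of the two consecutive columns has the first letter and the other the second, so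
          -- jointly they add 1 to both multiplicities; the continuations of the swap-free column
          -- `OIᵀ` are symmetric.
          Q≈Q′ : Ψ OIᵀ g₁ ≈ Ψ OIᵀ g₁′
          Q≈Q′ = trans (Φ-swap r (suc j) OIᵀ (λ _ → ≡.refl) (g₁ ∘ (OIᵀ ⊞_))) (Φ-cong (suc j) r OIᵀ {g₁ ∘ (OIᵀ ⊞_) ∘ swap} {g₁′ ∘ (OIᵀ ⊞_)} λ { (_ ∷ _ ∷ _) → refl })
          sum : (Ψ IOᵀ g₁ + (Ψ IOᵀ g₂ + Ψ OIᵀ g₂)) + Ψ OIᵀ g₁ ≈ (Ψ IOᵀ g₁′ + (Ψ IOᵀ g₂′ + Ψ OIᵀ g₂′)) + Ψ OIᵀ g₁′
          sum = begin
            (Ψ IOᵀ g₁ + (Ψ IOᵀ g₂ + Ψ OIᵀ g₂)) + Ψ OIᵀ g₁ ≈⟨ shuffle _ _ _ _ ⟩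
            (Ψ IOᵀ g₁ + Ψ OIᵀ g₁) + (Ψ IOᵀ g₂ + Ψ OIᵀ g₂) ≈⟨ +-cong (Φ-swap₂ r (suc j) T g₁) (Φ-swap₂ r (suc j) T g₂) ⟩
            (Ψ IOᵀ (g₁ ∘ swap) + Ψ OIᵀ (g₁ ∘ swap)) + (Ψ IOᵀ (g₂ ∘ swap) + Ψ OIᵀ (g₂ ∘ swap)) ≈⟨ +-cong
                (+-cong (Φ-cong (suc j) r IOᵀ (λ c → swap₁ (IOᵀ ⊞ c))) (Φ-cong (suc j) r OIᵀ (λ c → swap₁ (OIᵀ ⊞ c))))
                (+-cong (Φ-cong (suc j) r IOᵀ (λ c → swap₂ (IOᵀ ⊞ c))) (Φ-cong (suc j) r OIᵀ (λ c → swap₂ (OIᵀ ⊞ c)))) ⟩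
            (Ψ IOᵀ g₂′ + Ψ OIᵀ g₂′) + (Ψ IOᵀ g₁′ + Ψ OIᵀ g₁′) ≈⟨ shuffle′ _ _ _ _ ⟩
            (Ψ IOᵀ g₁′ + (Ψ IOᵀ g₂′ + Ψ OIᵀ g₂′)) + Ψ OIᵀ g₁′ ∎
            where
            shuffle : ∀ a b c d → (a + (b + c)) + d ≈ (a + d) + (b + c)
            shuffle = solve 4 (λ a b c d → (a :+ (b :+ c)) :+ d := (a :+ d) :+ (b :+ c)) refl
            shuffle′ : ∀ a b c d → (a + b) + (c + d) ≈ (c + (a + b)) + d
            shuffle′ = solve 4 (λ a b c d → (a :+ b) :+ (c :+ d) := (c :+ (a :+ b)) :+ d) refl

      opaque

        L : ∀ {m} → (Vec ℕ m → Carrier) → Carrier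
        L {m} g = ∑∈ (tuples m (const h) (suc q)) λ v → y ^ energy₀ v * g (multiplicities v)

        L-unfold : ∀ {m} (g : Vec ℕ m → Carrier) →
                   L g ≡ ∑∈ (tuples m (const h) (suc q)) λ v → y ^ energy₀ v * g (multiplicities v)
        L-unfold g = ≡.refl

        L-cong-size : ∀ {m} {f g : Vec ℕ m → Carrier} →
          (∀ v → (∀ i → ∣ Vec.lookup v i ∣ ≡ h) → f (multiplicities {r = suc q} v) ≈ g (multiplicities v)) → L f ≈ L g
        L-cong-size {m} eq = ∑-cong-∈ (tuples m (const h) (suc q)) λ {v} v∈ →
          *-congˡ (eq v (∈-tuples-size m (const h) (suc q) v∈))

        L-cong : ∀ {m} {f g : Vec ℕ m → Carrier} → (∀ c → f c ≈ g c) → L f ≈ L g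
        L-cong {m} eq = ∑-cong (tuples m (const h) (suc q)) λ v → *-congˡ (eq (multiplicities v))

        L-+ : ∀ {m} (f g : Vec ℕ m → Carrier) → L (λ c → f c + g c) ≈ L f + L g
        L-+ {m} f g = trans (∑-cong (tuples m (const h) (suc q)) λ v → distribˡ _ _ _)
          (∑-+ (tuples m (const h) (suc q)) _ _)

        L-*ˡ : ∀ {m} k (g : Vec ℕ m → Carrier) → L (λ c → k * g c) ≈ k * L g
        L-*ˡ {m} k g = trans (∑-cong (tuples m (const h) (suc q)) λ v → x∙yz≈y∙xz _ k _)
          (∑-*ˡ (tuples m (const h) (suc q)) k _)

        L-suc : ∀ {m} (g : Vec ℕ m → Carrier) → L g ≈ ∑∈ (subsets m) λ S → size S * Φ 0 q S (g ∘ (S ⊞_))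
        L-suc {m} g = ∑-tuples-suc m (const h) q _

      -- The first column carries no weight, so the two mixed choices for it enter with the same
      -- factor, as `Φ-swap₂` requires.
      L-swap : ∀ {m} (g : Vec ℕ (suc (suc m)) → Carrier) → L g ≈ L (g ∘ swap)
      L-swap {m} g = begin
        L g          ≈⟨ trans (L-suc g) (∑-subsets₂ m _) ⟩
        _            ≈⟨ ∑-cong (subsets m) summand ⟩
        _            ≈⟨ trans (L-suc (g ∘ swap)) (∑-subsets₂ m _) ⟨
        L (g ∘ swap) ∎
        where
        F : (g : Vec ℕ (suc (suc m)) → Carrier) → Subset (suc (suc m)) → Carrier
        F g S = size S * Φ 0 q S (g ∘ (S ⊞_))
        collect : ∀ a k x z d → (a + k * x) + (k * z + d) ≈ a + d + k * (z + x)
        collect = solve 5 (λ a k x z d → (a :+ k :* x) :+ (k :* z :+ d) := a :+ d :+ k :* (z :+ x)) refl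
        fixed : ∀ S → SwapFree S → swap S ≡ S → F g S ≈ F (g ∘ swap) S
        fixed S free eq = *-congˡ (trans (Φ-swap q 0 S free (g ∘ (S ⊞_)))
          (Φ-cong 0 q S {g ∘ (S ⊞_) ∘ swap} {g ∘ swap ∘ (S ⊞_)}
            λ c → reflexive (≡.cong g (≡.sym (≡.trans (swap-⊞ S c) (≡.cong (_⊞ swap c) eq))))))
        summand : ∀ S → (F g (false ∷ false ∷ S) + F g (false ∷ true ∷ S)) + (F g (true ∷ false ∷ S) + F g (true ∷ true ∷ S))
          ≈ (F (g ∘ swap) (false ∷ false ∷ S) + F (g ∘ swap) (false ∷ true ∷ S)) + (F (g ∘ swap) (true ∷ false ∷ S) + F (g ∘ swap) (true ∷ true ∷ S))
        summand S = trans (collect _ _ _ _ _) (trans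
          (+-cong (+-cong (fixed (false ∷ false ∷ S) (λ _ → ≡.refl) ≡.refl) (fixed (true ∷ true ∷ S) (λ _ → ≡.refl) ≡.refl))
            (*-congˡ (Φ-swap₂ q 0 S g)))
          (sym (collect _ _ _ _ _)))

      -- Renaming the letters permutes the tuples, and by `energy-rotate` the energy drops by the
      -- multiplicity of the smallest letter, up to a multiple of `o`.
      L-rotate : ∀ {m} (g : Vec ℕ (suc m) → Carrier) → L g ≈ L (λ c → z ^ Vec.head c * g (rotate c))
      L-rotate {m} g = begin
        L g ≡⟨ L-unfold g ⟩
        _   ≈⟨ ∑-tuples-rotate m (const h) (suc q) _ ⟩
        _   ≈⟨ ∑-cong-∈ (tuples (suc m) (const h) (suc q)) (λ {v} v∈ →
                 trans (*-congˡ (reflexive (≡.cong g (multiplicities-rotate v))))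
                   (trans (*-congʳ (weight v (∈-tuples-size (suc m) (const h) (suc q) v∈))) (*-assoc _ _ _))) ⟩
        _   ≡⟨ L-unfold (λ c → z ^ Vec.head c * g (rotate c)) ⟨
        L (λ c → z ^ Vec.head c * g (rotate c)) ∎
        where
        weight : ∀ (v : Vec (Subset (suc m)) (suc q)) → (∀ i → ∣ Vec.lookup v i ∣ ≡ h) →
                 y ^ energy₀ (Vec.map rotate v) ≈ y ^ energy₀ v * z ^ Vec.head (multiplicities v)
        weight v@(S ∷ w) sizes = sym (begin
          y ^ e * z ^ k                             ≈⟨ *-congʳ (*-identityʳ _) ⟨
          y ^ e * 1# * z ^ k                        ≈⟨ *-congʳ (*-congˡ (y^[o*k] b)) ⟨
          y ^ e * y ^ (suc q ℕ.* b) * z ^ k         ≈⟨ *-congʳ (^-homo-* y e (suc q ℕ.* b)) ⟨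
          y ^ (e ℕ.+ suc q ℕ.* b) * z ^ k           ≡⟨ ≡.cong (λ x → y ^ x * z ^ k) (≡.trans
                                                         (energy-rotate h 0 S w (sizes zero) (sizes ∘ suc))
                                                         (≡.cong (e′ ℕ.+_) (ℕ.+-identityʳ k))) ⟩
          y ^ (e′ ℕ.+ k) * z ^ k                    ≈⟨ *-congʳ (^-homo-* y e′ k) ⟩
          y ^ e′ * y ^ k * z ^ k                    ≈⟨ *-assoc _ _ _ ⟩
          y ^ e′ * (y ^ k * z ^ k)                  ≈⟨ *-congˡ (trans (*-comm _ _) (z^k*y^k k)) ⟩
          y ^ e′ * 1#                               ≈⟨ *-identityʳ _ ⟩
          y ^ e′                                    ∎)
          where
          e  = energy 0 S w
          e′ = energy₀ (Vec.map rotate v)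
          k  = Vec.head (multiplicities v)
          b  = headBit (Vec.last v)

      -- Swapping the first two letters and then rotating fixes the first letter and
      -- rotates the others; V i is what i such moves do to a test function.
      V : ∀ {m} → ℕ → (Vec ℕ (suc (suc m)) → Carrier) → Vec ℕ (suc (suc m)) → Carrier
      V i g (a ∷ c) = z ^ passed i c * g (a ∷ rotations i c)

      L-V : ∀ {m} i (g : Vec ℕ (suc (suc m)) → Carrier) → L g ≈ L (V i g)
      L-V zero    g = L-cong λ { (a ∷ c) → sym (*-identityˡ _) }
      L-V (suc i) g = begin
        L g                                                      ≈⟨ L-V i g ⟩
        L (V i g)                                                ≈⟨ L-rotate (V i g) ⟩
        L (λ c → z ^ Vec.head c * V i g (rotate c))              ≈⟨ L-swap _ ⟩
        L (λ c → z ^ Vec.head (swap c) * V i g (rotate (swap c))) ≈⟨ L-cong (λ { (a ∷ b ∷ c) →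
          trans (sym (*-assoc _ _ _)) (*-congʳ (sym (^-homo-* z b (passed i (rotate (b ∷ c)))))) }) ⟩
        L (V (suc i) g) ∎

      -- After as many moves as there are other letters, each of them has gone round once: the test
      -- function is restored, and the factor has collected all their multiplicities.
      L-tail : ∀ {m} (g : Vec ℕ (suc m) → Carrier) → L g ≈ L (λ c → z ^ Vec.sum (Vec.tail c) * g c)
      L-tail {zero}  g = L-cong λ { (a ∷ []) → sym (*-identityˡ _) }
      L-tail {suc m} g = trans (L-V (suc m) g) (L-cong λ { (a ∷ c) → reflexive
        (≡.cong₂ (λ s c → z ^ s * g (a ∷ c)) (passed-full c) (rotations-full c)) })

      -- All multiplicities together make `o * h`, so the sum over the other letters is minus the
      -- first multiplicity modulo `o`.
      L-head : ∀ {m} (g : Vec ℕ (suc m) → Carrier) → L g ≈ L (λ c → y ^ Vec.head c * g c)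
      L-head {m} g = trans (L-tail g) (L-cong-size λ v sizes →
        *-congʳ (weight (multiplicities v) (sum-multiplicities h v sizes)))
        where
        weight : ∀ (c : Vec ℕ (suc m)) → Vec.sum c ≡ suc q ℕ.* h → z ^ Vec.sum (Vec.tail c) ≈ y ^ Vec.head c
        weight (a ∷ c) eq = begin
          z ^ s                      ≈⟨ *-identityʳ _ ⟨
          z ^ s * 1#                 ≈⟨ *-congˡ (trans (reflexive (≡.cong (y ^_) eq)) (y^[o*k] h)) ⟨
          z ^ s * y ^ (a ℕ.+ s)      ≈⟨ *-congˡ (^-homo-* y a s) ⟩
          z ^ s * (y ^ a * y ^ s)    ≈⟨ x∙yz≈y∙xz _ _ _ ⟩
          y ^ a * (z ^ s * y ^ s)    ≈⟨ *-congˡ (z^k*y^k s) ⟩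
          y ^ a * 1#                 ≈⟨ *-identityʳ _ ⟩
          y ^ a                      ∎
          where
          s = Vec.sum c

      -- The contents that contribute

      module _ (cancel : Cancels) where

        gap-suc : ∀ k x → χ (gap? k x) ≈ χ (gap? (suc k) x) + χ (x ℕ.≟ suc k)
        gap-suc k zero    = sym (+-identityʳ 1#)
        gap-suc k (suc x) with ℕ.<-cmp x k
        ... | tri< x<k x≢k _ = begin
          χ (gap? k (suc x))  ≡⟨ χ-no (gap? k (suc x)) (λ { (inj₂ (s≤s k≤x)) → ℕ.<⇒≱ x<k k≤x }) ⟩
          0#                  ≈⟨ +-identityʳ 0# ⟨
          0# + 0#             ≡⟨ ≡.cong₂ _+_ (χ-no (gap? (suc k) (suc x)) (λ { (inj₂ (s≤s k<x)) → ℕ.<-asym x<k k<x }))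
                                             (χ-no (suc x ℕ.≟ suc k) (x≢k ∘ ℕ.suc-injective)) ⟨
          _                   ∎
        ... | tri≈ _ ≡.refl _ = begin
          χ (gap? k (suc x))  ≡⟨ χ-yes (gap? k (suc x)) (inj₂ ℕ.≤-refl) ⟩
          1#                  ≈⟨ +-identityˡ 1# ⟨
          0# + 1#             ≡⟨ ≡.cong₂ _+_ (χ-no (gap? (suc k) (suc x)) (λ { (inj₂ lt) → ℕ.<-irrefl ≡.refl lt }))
                                             (χ-yes (suc x ℕ.≟ suc k) ≡.refl) ⟨
          _                   ∎
        ... | tri> _ x≢k k<x = begin
          χ (gap? k (suc x))  ≡⟨ χ-yes (gap? k (suc x)) (inj₂ (ℕ.m≤n⇒m≤1+n k<x)) ⟩
          1#                  ≈⟨ +-identityʳ 1# ⟨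
          1# + 0#             ≡⟨ ≡.cong₂ _+_ (χ-yes (gap? (suc k) (suc x)) (inj₂ (s≤s k<x)))
                                             (χ-no (suc x ℕ.≟ suc k) (x≢k ∘ ℕ.suc-injective)) ⟨
          _                   ∎

        -- Restricted to multiplicity `suc k`, the factor of `L-head` is the constant `y ^ suc k`,
        -- which is then cancelled.
        L-vanish : ∀ {m} k → k < q → (g : Vec ℕ (suc m) → Carrier) →
                   L (λ c → χ (Vec.head c ℕ.≟ suc k) * g c) ≈ 0#
        L-vanish k k<q g = cancel k k<q _ (sym (begin
          L f                             ≈⟨ L-head f ⟩
          L (λ c → y ^ Vec.head c * f c)  ≈⟨ L-cong (λ c → trans (x∙yz≈y∙xz _ _ _)
                                               (trans (χ-cong (Vec.head c ℕ.≟ suc k) (λ eq → *-congʳ (reflexive (≡.cong (y ^_) eq))))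
                                                 (x∙yz≈y∙xz _ _ _))) ⟩
          L (λ c → y ^ suc k * f c)       ≈⟨ L-*ˡ (y ^ suc k) f ⟩
          y ^ suc k * L f                 ∎))
          where
          f = λ c → χ (Vec.head c ℕ.≟ suc k) * g c

        L-gap-head : ∀ {m} k → k ≤ q → (g : Vec ℕ (suc m) → Carrier) →
                     L g ≈ L (λ c → χ (gap? k (Vec.head c)) * g c)
        L-gap-head zero    k≤q g = L-cong λ { (a ∷ c) → trans (sym (*-identityˡ _)) (*-congʳ (reflexive (≡.sym (χ-yes (gap? 0 a) (pos a))))) }
          where
          pos : ∀ a → Gap 0 a
          pos zero    = inj₁ ≡.refl
          pos (suc a) = inj₂ (s≤s z≤n)
        L-gap-head (suc k) k<q g = begin
          L g ≈⟨ L-gap-head k (ℕ.<⇒≤ k<q) g ⟩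
          L (λ c → χ (gap? k (Vec.head c)) * g c) ≈⟨ L-cong (λ c → trans (*-congʳ (gap-suc k (Vec.head c))) (distribʳ _ _ _)) ⟩
          L (λ c → χ (gap? (suc k) (Vec.head c)) * g c + χ (Vec.head c ℕ.≟ suc k) * g c) ≈⟨ L-+ _ _ ⟩
          L (λ c → χ (gap? (suc k) (Vec.head c)) * g c) + L (λ c → χ (Vec.head c ℕ.≟ suc k) * g c)
            ≈⟨ trans (+-congˡ (L-vanish k k<q g)) (+-identityʳ _) ⟩
          L (λ c → χ (gap? (suc k) (Vec.head c)) * g c) ∎

        Supported : ∀ {m} → Fin m → Set _
        Supported {m} i = ∀ g → L {m} g ≈ L (λ c → χ (gap? q (Vec.lookup c i)) * g c)

        -- The factor produced by `L-rotate` is absorbed into the test function; this is why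
        -- `Supported` quantifies over all of them.
        supported-rotate : ∀ {m} {i j : Fin (suc m)} → (∀ (c : Vec ℕ (suc m)) → Vec.lookup (rotate c) j ≡ Vec.lookup c i) →
                           Supported i → Supported j
        supported-rotate {i = i} {j} eq supp g = sym (begin
          L (λ c → χ (gap? q (Vec.lookup c j)) * g c) ≈⟨ L-rotate _ ⟩
          L (λ c → z ^ Vec.head c * (χ (gap? q (Vec.lookup (rotate c) j)) * g (rotate c)))
            ≈⟨ L-cong (λ c → trans (x∙yz≈y∙xz _ _ _) (*-congʳ (reflexive (≡.cong (χ ∘ gap? q) (eq c))))) ⟩
          L (λ c → χ (gap? q (Vec.lookup c i)) * (z ^ Vec.head c * g (rotate c))) ≈⟨ supp (λ c → z ^ Vec.head c * g (rotate c)) ⟨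
          L (λ c → z ^ Vec.head c * g (rotate c)) ≈⟨ L-rotate g ⟨
          L g ∎)

        -- A rotation takes the first letter to the last place and letter `suc i` to place
        -- `inject₁ i`, hence an induction downwards from the last letter.
        supported : ∀ {m} (i : Fin m) → Supported i
        supported {suc m} = Fin.>-weakInduction Supported
          (supported-rotate lookup-rotate-last λ g → trans (L-gap-head q ℕ.≤-refl g)
            (L-cong λ { (a ∷ c) → refl }))
          (λ i → supported-rotate (λ c → lookup-rotate-inject₁ c i))

        L-gap : ∀ {m} (is : List (Fin m)) (g : Vec ℕ m → Carrier) →
                L g ≈ L (λ c → χ (All.all? (gap? q ∘ Vec.lookup c) is) * g c)
        L-gap []       g = L-cong λ c → sym (*-identityˡ _)
        L-gap (i ∷ is) g = trans (supported i g) (trans (L-gap is _) (L-cong λ c →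
          trans (sym (*-assoc _ _ _)) (*-congʳ (trans (*-comm _ _)
            (sym (χ-× (gap? q (Vec.lookup c i)) (All.all? (gap? q ∘ Vec.lookup c) is)))))))

        -- If every multiplicity is 0 or at least `o`, the tuple is constant, and a constant tuple
        -- has energy 0.
        block : ∀ m (g : Vec ℕ m → Carrier) →
          ∑∈ (tuples m (const h) (suc q)) (λ v → y ^ energy₀ v * g (multiplicities v)) ≈
          ∑∈ (tuples m (const h) (suc q)) (λ v → χ (constant? v) * g (multiplicities v))
        block m g = trans (reflexive (≡.sym (L-unfold g))) (trans (L-gap (List.allFin m) g) (trans (reflexive (L-unfold _)) (∑-cong (tuples m (const h) (suc q)) λ v →
          trans (x∙yz≈y∙xz _ _ _) (trans (*-congʳ (reflexive (χ-⇔ (mk⇔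
              (λ gaps → gap⇒constant v λ i → All.lookup gaps (List.∈-allFin i))
              (λ const → All.tabulate λ {i} _ → constant⇒gap v const i))
              (All.all? (gap? q ∘ Vec.lookup (multiplicities v)) (List.allFin m)) (constant? v))))
            (χ-cong (constant? v) (λ const → trans (*-congʳ (reflexive (≡.cong (y ^_) (energy₀-constant v const)))) (*-identityˡ _)))))))
          where
          energy₀-constant : ∀ (v : Vec (Subset m) (suc q)) → Constant v → energy₀ v ≡ 0
          energy₀-constant (S ∷ v) = energy-constant 0 v

    -- Gluing the blocks and returning to fillings

    module _ (cancel : Cancels) where

      blocks : ∀ m B (h : ℕ → ℕ) → (∀ b i → i < o → h (b ℕ.* o ℕ.+ i) ≡ h (b ℕ.* o)) → ∀ (g : Vec ℕ m → Carrier) →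
        ∑∈ (tuples m h (B ℕ.* o)) (λ v → y ^ energy₀ v * g (multiplicities v)) ≈
        ∑∈ (tuples m h (B ℕ.* o)) (λ v → χ (blockConstant? o B v) * g (multiplicities v))
      blocks m zero    h flat g = refl
      blocks m (suc B) h flat g = begin
        ∑∈ (tuples m h (o ℕ.+ B ℕ.* o)) (λ v → y ^ energy₀ v * g (multiplicities v))
          ≈⟨ ∑-tuples-++ m h o (B ℕ.* o) _ ⟩
        ∑∈ us (λ u → ∑∈ ws λ w → y ^ energy₀ (u ++ w) * g (multiplicities (u ++ w)))
          ≈⟨ ∑-cong us (λ u → trans (∑-cong ws λ w → trans (*-cong (energy₀-++ u w) (mult u w)) (*-assoc _ _ _)) (∑-*ˡ ws _ _)) ⟩
        ∑∈ us (λ u → y ^ energy₀ u * ∑∈ ws λ w → y ^ energy₀ w * g (Vec.zipWith ℕ._+_ (multiplicities u) (multiplicities w)))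
          ≈⟨ ∑-cong us (λ u → *-congˡ (blocks m B (h ∘ (o ℕ.+_)) flat′ (g ∘ Vec.zipWith ℕ._+_ (multiplicities u)))) ⟩
        ∑∈ us (λ u → y ^ energy₀ u * G (multiplicities u))
          ≡⟨ ≡.cong (λ us → ∑∈ us λ u → y ^ energy₀ u * G (multiplicities u)) us≡ ⟩
        ∑∈ (tuples m (const (h 0)) o) (λ u → y ^ energy₀ u * G (multiplicities u))
          ≈⟨ Block.block (h 0) cancel m G ⟩
        ∑∈ (tuples m (const (h 0)) o) (λ u → χ (constant? u) * G (multiplicities u))
          ≡⟨ ≡.cong (λ us → ∑∈ us λ u → χ (constant? u) * G (multiplicities u)) us≡ ⟨
        ∑∈ us (λ u → χ (constant? u) * G (multiplicities u))
          ≈⟨ ∑-cong us (λ u → trans (sym (∑-*ˡ ws _ _)) (∑-cong ws λ w → trans (sym (*-assoc _ _ _)) (*-cong (indicator u w) (sym (mult u w))))) ⟩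
        ∑∈ us (λ u → ∑∈ ws λ w → χ (blockConstant? o (suc B) (u ++ w)) * g (multiplicities (u ++ w)))
          ≈⟨ ∑-tuples-++ m h o (B ℕ.* o) _ ⟨
        ∑∈ (tuples m h (o ℕ.+ B ℕ.* o)) (λ v → χ (blockConstant? o (suc B) v) * g (multiplicities v)) ∎
        where
        us = tuples m h o
        ws = tuples m (h ∘ (o ℕ.+_)) (B ℕ.* o)
        us≡ : us ≡ tuples m (const (h 0)) o
        us≡ = tuples-cong m o (flat 0)
        flat′ : ∀ b i → i < o → h (o ℕ.+ (b ℕ.* o ℕ.+ i)) ≡ h (o ℕ.+ b ℕ.* o)
        flat′ b i i<o = ≡.trans (≡.cong h (≡.sym (ℕ.+-assoc o (b ℕ.* o) i))) (flat (suc b) i i<o)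
        -- The sum over all later columns, seen as a test function of the content of the first
        -- block.
        G : Vec ℕ m → Carrier
        G c = ∑∈ ws λ w → χ (blockConstant? o B w) * g (Vec.zipWith ℕ._+_ c (multiplicities w))
        mult : ∀ (u : Vec (Subset m) o) (w : Vec (Subset m) (B ℕ.* o)) →
               g (multiplicities (u ++ w)) ≈ g (Vec.zipWith ℕ._+_ (multiplicities u) (multiplicities w))
        mult u w = reflexive (≡.cong g (multiplicities-++ u w))
        indicator : ∀ (u : Vec (Subset m) o) (w : Vec (Subset m) (B ℕ.* o)) →
                    χ (constant? u) * χ (blockConstant? o B w) ≈ χ (blockConstant? o (suc B) (u ++ w))
        indicator u w = trans (reflexive (≡.cong₂ (λ u w → χ (constant? u) * χ (blockConstant? o B w))
            (≡.sym (take-++ u w)) (≡.sym (drop-++ u w))))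
          (sym (χ-× (constant? (Vec.take o (u ++ w))) (blockConstant? o B (Vec.drop o (u ++ w)))))
          where
          split = λ (u : Vec (Subset m) o) (w : Vec (Subset m) (B ℕ.* o)) →
            Vec.++-injective (Vec.take o (u ++ w)) u (Vec.take++drop≡id o (u ++ w))
          take-++ = λ u w → proj₁ (split u w)
          drop-++ = λ u w → proj₂ (split u w)

      ∑-maj : ∀ {m} μ B → All (_≤ B ℕ.* o) (o · μ) → (g : Vec ℕ m → Carrier) →
        ∑∈ (fillings (o · μ) m) (λ F → χ (coinversionFree? F) * (z ^ maj F * g (content F))) ≈
        ∑∈ (fillings (o · μ) m) (λ F → χ (coinversionFree? F) * (χ (blockConstant? o B (columns (B ℕ.* o) F)) * g (content F)))
      ∑-maj {m} μ B bounded g = begin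
        _ ≈⟨ ∑-χ-cong coinversionFree? (fillings (o · μ) m) (λ F cof → *-cong
               (sym (maj-energy μ F (columnSet F) bounded (fits-complete cof (∈-columnSet F))))
               (reflexive (≡.cong g (content-multiplicities bounded cof)))) ⟩
        _ ≈⟨ ∑-reindex coinversionFree? (columns N) (fillings (o · μ) m) (tuples m (height (o · μ)) N) (columns-↭ bounded) (λ v → y ^ energy₀ v * g (multiplicities v)) ⟩
        _ ≈⟨ blocks m B (height (o · μ)) flat g ⟩
        _ ≈⟨ ∑-reindex coinversionFree? (columns N) (fillings (o · μ) m) (tuples m (height (o · μ)) N) (columns-↭ bounded) (λ v → χ (blockConstant? o B v) * g (multiplicities v)) ⟨
        _ ≈⟨ ∑-χ-cong coinversionFree? (fillings (o · μ) m) (λ F cof → *-congˡ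
               (reflexive (≡.cong g (content-multiplicities bounded cof)))) ⟨
        _ ∎
        where
        N = B ℕ.* o
        flat : ∀ b i → i < o → height (o · μ) (b ℕ.* o ℕ.+ i) ≡ height (o · μ) (b ℕ.* o)
        flat b i i<o = height-block o μ (≡.trans ([b*o+i]/o≡b o b i<o) (≡.sym (m*n/n≡m b o)))

open import Data.Integer.Base using (ℤ; +_; -[1+_])

-- Evaluation at roots of unity

module Field {c ℓ₁ ℓ₂} (K : HeytingField c ℓ₁ ℓ₂) where

  open HeytingField K using (_#_; tight; #⇒invertible; heytingCommutativeRing)
  R = HeytingCommutativeRing.commutativeRing heytingCommutativeRing
  open CommutativeRing R hiding (zero; _-_; -_)
  open import Relation.Binary.Reasoning.Setoid setoid
  open import Algebra.Properties.CommutativeSemiring.Exp commutativeSemiring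
  open import Algebra.Properties.Ring (CommutativeRing.ring R) using (-0#≈0#)
  open OverRing R

  evaluate-cong : ∀ f {x y} → x ≈ y → evaluate K f x ≈ evaluate K f y
  evaluate-cong []      eq = refl
  evaluate-cong (a ∷ f) eq = +-congˡ (*-cong eq (evaluate-cong f eq))

  evaluate-⊕ : ∀ f g x → evaluate K (f ⊕ g) x ≈ evaluate K f x + evaluate K g x
  evaluate-⊕ []      g       x = sym (+-identityˡ _)
  evaluate-⊕ (a ∷ f) []      x = sym (+-identityʳ _)
  evaluate-⊕ (a ∷ f) (b ∷ g) x = begin
    fromℕ K (a ℕ.+ b) + x * evaluate K (f ⊕ g) x                       ≈⟨ +-cong (×-homo-+ 1# a b) (trans (*-congˡ (evaluate-⊕ f g x)) (distribˡ _ _ _)) ⟩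
    (fromℕ K a + fromℕ K b) + (x * evaluate K f x + x * evaluate K g x) ≈⟨ interchange _ _ _ _ ⟩
    (fromℕ K a + x * evaluate K f x) + (fromℕ K b + x * evaluate K g x) ∎
    where
    open import Algebra.Properties.Semiring.Mult semiring using (×-homo-+)
    open CommutativeSemigroupProperties +-commutativeSemigroup using (interchange)

  evaluate-q^ : ∀ k x → evaluate K (q^ k) x ≈ x ^ k
  evaluate-q^ zero    x = trans (+-cong (+-identityʳ 1#) (zeroʳ x)) (+-identityʳ 1#)
  evaluate-q^ (suc k) x = trans (+-identityˡ _) (*-congˡ (evaluate-q^ k x))

  evaluate-term : ∀ {m} k (α β : Vec ℕ m) x → evaluate K (term k α β) x ≈ x ^ k * χ (Vec.≡-dec ℕ._≟_ α β)
  evaluate-term k α β x with does (Vec.≡-dec ℕ._≟_ α β)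
  ... | true  = trans (evaluate-q^ k x) (sym (*-identityʳ _))
  ... | false = sym (zeroʳ _)

  evaluate-∑ : ∀ {m} (fs : List ℕ[q][x m ]) ν x → evaluate K (∑ fs ν) x ≈ ∑∈ fs λ f → evaluate K (f ν) x
  evaluate-∑ []       ν x = refl
  evaluate-∑ (f ∷ fs) ν x = trans (evaluate-⊕ (f ν) (∑ fs ν) x) (+-congˡ (evaluate-∑ fs ν x))

  evaluate-E : ∀ μ {m} (ν : Vec ℕ m) x → evaluate K ([𝐦 ν ] E μ m) x ≈
    ∑∈ (fillings μ m) λ F → χ (coinversionFree? F) * (x ^ maj F * χ (Vec.≡-dec ℕ._≟_ (content F) ν))
  evaluate-E μ {m} ν x = begin
    evaluate K (∑ (List.map g xs) ν) x                 ≈⟨ evaluate-∑ (List.map g xs) ν x ⟩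
    ∑∈ (List.map g xs) (λ f → evaluate K (f ν) x)      ≡⟨ ∑-map g xs _ ⟩
    ∑∈ xs (λ F → evaluate K (g F ν) x)                 ≈⟨ ∑-cong xs (λ F → evaluate-term (maj (value F)) (content (value F)) ν x) ⟩
    ∑∈ xs (w ∘ value)                                  ≈⟨ ∑-select coinversionFree? (fillings μ m) w ⟩
    ∑∈ (fillings μ m) (λ F → χ (coinversionFree? F) * w F) ∎
    where
    xs = Finite.elements (COF-finite μ m)
    g  = λ (F : COF μ m) → term (maj (value F)) (content (value F))
    w  = λ (F : Filling μ m) → x ^ maj F * χ (Vec.≡-dec ℕ._≟_ (content F) ν)

  count-COF : ∀ μ {m} (ν : Vec ℕ m) {P : Filling μ m → Set} (P? : Decidable P) →
    fromℕ K (Finite.count (COF[,]-finite μ ν) (P? ∘ value)) ≈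
    ∑∈ (fillings μ m) λ F → χ (coinversionFree? F) * (χ (P? F) * χ (Vec.≡-dec ℕ._≟_ (content F) ν))
  count-COF μ {m} ν P? = begin
    fromℕ K (length (filter (P? ∘ value) xs))          ≈⟨ length-filter (P? ∘ value) xs ⟩
    ∑∈ xs (χ ∘ P? ∘ value)                             ≈⟨ ∑-select (inCOF? ν) (fillings μ m) (χ ∘ P?) ⟩
    ∑∈ (fillings μ m) (λ F → χ (inCOF? ν F) * χ (P? F)) ≈⟨ ∑-cong (fillings μ m) (λ F →
      trans (*-congʳ (χ-× (coinversionFree? F) (Vec.≡-dec ℕ._≟_ (content F) ν))) (trans (*-assoc _ _ _) (*-congˡ (*-comm _ _)))) ⟩
    _ ∎
    where xs = Finite.elements (COF[,]-finite μ ν)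

  -- By tightness it is enough to refute that `a` is apart from 0; equality in the field need not be
  -- decidable.
  x*a≈a⇒a≈0 : ∀ {x a} → ¬ x ≈ 1# → x * a ≈ a → a ≈ 0#
  x*a≈a⇒a≈0 {x} {a} x≉1 eq = proj₁ (tight a 0#) λ a#0 →
    let (b , _ , ab≈1) = #⇒invertible a#0
        -- `#⇒invertible` provides an inverse of the difference of `a` and 0.
        a*b = trans (*-congʳ (sym (trans (+-congˡ -0#≈0#) (+-identityʳ a)))) ab≈1
    in x≉1 (begin
      x             ≈⟨ *-identityʳ x ⟨
      x * 1#        ≈⟨ *-congˡ a*b ⟨
      x * (a * b)   ≈⟨ *-assoc x a b ⟨
      x * a * b     ≈⟨ *-congʳ eq ⟩
      a * b         ≈⟨ a*b ⟩
      1#            ∎)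

  -- Powers of the primitive root and fixed points

  module _ {n} .{{_ : NonZero n}} (ζ : PrimitiveRoot K n) where

    open PrimitiveRoot ζ

    ξ^[k*n] : ∀ k → ξ ^ (k ℕ.* n) ≈ 1#
    ξ^[k*n] k = begin
      ξ ^ (k ℕ.* n)  ≡⟨ ≡.cong (ξ ^_) (ℕ.*-comm k n) ⟩
      ξ ^ (n ℕ.* k)  ≈⟨ ^-assocʳ ξ n k ⟨
      (ξ ^ n) ^ k    ≈⟨ ^-congˡ k root ⟩
      1# ^ k         ≈⟨ 1^ k ⟩
      1#             ∎

    ξ^≈1⇒∣ : ∀ k → ξ ^ k ≈ 1# → n ∣ k
    ξ^≈1⇒∣ k eq with k % n in r | m%n<n k n
    ... | zero  | _   = m%n≡0⇒n∣m k n r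
    ... | suc i | i<n = ⊥-elim (minimal (suc i) (s≤s z≤n) i<n (begin
      ξ ^ suc i                           ≈⟨ *-identityʳ _ ⟨
      ξ ^ suc i * 1#                      ≈⟨ *-congˡ (ξ^[k*n] (k / n)) ⟨
      ξ ^ suc i * ξ ^ (k / n ℕ.* n)       ≈⟨ ^-homo-* ξ (suc i) (k / n ℕ.* n) ⟨
      ξ ^ (suc i ℕ.+ k / n ℕ.* n)         ≡⟨ ≡.cong (λ r → ξ ^ (r ℕ.+ k / n ℕ.* n)) r ⟨
      ξ ^ (k % n ℕ.+ k / n ℕ.* n)         ≡⟨ ≡.cong (ξ ^_) (m≡m%n+[m/n]*n k n) ⟨
      ξ ^ k                               ≈⟨ eq ⟩
      1#                                  ∎))

    ξ⁻¹≈ξ^[n-1] : ξ⁻¹ ≈ ξ ^ (n ∸ 1)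
    ξ⁻¹≈ξ^[n-1] = begin
      ξ⁻¹                       ≈⟨ *-identityʳ _ ⟨
      ξ⁻¹ * 1#                  ≈⟨ *-congˡ root ⟨
      ξ⁻¹ * ξ ^ n               ≡⟨ ≡.cong (λ k → ξ⁻¹ * ξ ^ k) (ℕ.suc-pred n) ⟨
      ξ⁻¹ * (ξ * ξ ^ (n ∸ 1))   ≈⟨ *-assoc _ _ _ ⟨
      ξ⁻¹ * ξ * ξ ^ (n ∸ 1)     ≈⟨ *-congʳ (trans (*-comm ξ⁻¹ ξ) inverse) ⟩
      1# * ξ ^ (n ∸ 1)          ≈⟨ *-identityˡ _ ⟩
      ξ ^ (n ∸ 1)               ∎

    sieving : ∀ e μ {m} (ν : Vec ℕ m) (fixed? : Decidable (λ x → (φ n μ ν ^∘ e) x ≡ x)) →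
      fromℕ K (Finite.count (COF[,]-finite (n · μ) ν) fixed?) ≈ evaluate K ([𝐦 ν ] E (n · μ) m) (ξ ^ e)
    sieving e μ {m} ν fixed? = go (gcd e′ n) ≡.refl (gcd[m,n]∣n e′ n)
      where
      -- Plays the role of -e modulo `n`: it is both the shift performed by `φ ^∘ e` and the
      -- exponent that makes `y` inverse to `ξ ^ e`.
      e′ = e ℕ.* (n ∸ 1)
      finite = COF[,]-finite (n · μ) ν
      Goal = fromℕ K (Finite.count finite fixed?) ≈ evaluate K ([𝐦 ν ] E (n · μ) m) (ξ ^ e)
      y = ξ ^ e′

      y*ξ^e≈1 : y * ξ ^ e ≈ 1#
      y*ξ^e≈1 = begin
        ξ ^ e′ * ξ ^ e                  ≈⟨ ^-homo-* ξ e′ e ⟨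
        ξ ^ (e ℕ.* (n ∸ 1) ℕ.+ e)       ≡⟨ ≡.cong (ξ ^_) (≡.trans (ℕ.+-comm e′ e) (≡.trans (≡.sym (ℕ.*-suc e (n ∸ 1))) (≡.cong (e ℕ.*_) (ℕ.suc-pred n)))) ⟩
        ξ ^ (e ℕ.* n)                   ≈⟨ ξ^[k*n] e ⟩
        1#                              ∎

      -- The gcd and its cofactor are positive because `n` is; matching on successors supplies the
      -- `NonZero` instances and the `q` with `o = suc q`.
      go : ∀ g → g ≡ gcd e′ n → g ∣ n → Goal
      go zero      g≡ (divides o n≡) = ⊥-elim (ℕ.≢-nonZero⁻¹ n (≡.trans n≡ (ℕ.*-zeroʳ o)))
      go (suc g-1) g≡ (divides zero n≡) = ⊥-elim (ℕ.≢-nonZero⁻¹ n n≡)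
      go g@(suc _) g≡ (divides o@(suc q) n≡) = trans
        (reflexive (≡.cong (fromℕ K) (count-fixed μ ν n o g n≡′ {β} e g≡ bounded finite fixed?)))
        (trans (count-COF (n · μ) ν constantBlocks?) (trans (sym (equation (n · μ) μ≡ bounded))
          (trans (∑-cong (fillings (n · μ) m) (λ F → *-congˡ (*-congʳ (^-congˡ (maj F) y^q≈ξ^e))))
            (sym (evaluate-E (n · μ) ν (ξ ^ e))))))
        where
        n≡′ = ≡.trans n≡ (ℕ.*-comm o g)
        β = ℕ.sum (g · μ)
        μ≡ : n · μ ≡ o · (g · μ)
        μ≡ = ·-assoc o g n μ n≡′
        bounded : All (_≤ β ℕ.* o) (n · μ)
        bounded = ≡.subst (All (_≤ β ℕ.* o)) (≡.sym μ≡) (·-bounded o (g · μ))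
        constantBlocks? : ∀ {κ} → Decidable (λ (F : Filling κ m) → BlockConstant o β (columns (β ℕ.* o) F))
        constantBlocks? F = blockConstant? o β (columns (β ℕ.* o) F)

        y^o : y ^ o ≈ 1#
        y^o with ≡.subst (_∣ e′) (≡.sym g≡) (gcd[m,n]∣m e′ n)
        ... | divides a eq = begin
          (ξ ^ e′) ^ o           ≈⟨ ^-assocʳ ξ e′ o ⟩
          ξ ^ (e′ ℕ.* o)         ≡⟨ ≡.cong (ξ ^_) (≡.trans (≡.cong (ℕ._* o) eq) (≡.trans (ℕ.*-assoc a g o) (≡.cong (a ℕ.*_) (≡.sym n≡′)))) ⟩
          ξ ^ (a ℕ.* n)          ≈⟨ ξ^[k*n] a ⟩
          1#                     ∎

        y^q≈ξ^e : y ^ q ≈ ξ ^ e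
        y^q≈ξ^e = begin
          y ^ q                  ≈⟨ *-identityʳ _ ⟨
          y ^ q * 1#             ≈⟨ *-congˡ y*ξ^e≈1 ⟨
          y ^ q * (y * ξ ^ e)    ≈⟨ *-assoc _ _ _ ⟨
          y ^ q * y * ξ ^ e      ≈⟨ *-congʳ (trans (*-comm _ _) y^o) ⟩
          1# * ξ ^ e             ≈⟨ *-identityˡ _ ⟩
          ξ ^ e                  ∎

        -- `n` divides `k * e′` and `k * n`, hence their gcd `k * g`; now cancel `g` from
        -- `n ≡ o * g`.
        o∣ : ∀ k → n ∣ e′ ℕ.* k → o ∣ k
        o∣ k n∣ = *-cancelʳ-∣ g (≡.subst₂ _∣_ n≡ (≡.trans (≡.sym (c*gcd[m,n]≡gcd[cm,cn] k e′ n)) (≡.cong (k ℕ.*_) (≡.sym g≡)))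
          (gcd-greatest (≡.subst (n ∣_) (ℕ.*-comm e′ k) n∣) (n∣m*n k)))

        -- By `o∣` a power of `y` with positive exponent below `o` is not 1.
        cancel : ∀ k → k < q → ∀ a → y ^ suc k * a ≈ a → a ≈ 0#
        cancel k k<q a = x*a≈a⇒a≈0 λ eq → ℕ.<⇒≱ (s≤s k<q)
          (∣⇒≤ (o∣ (suc k) (ξ^≈1⇒∣ (e′ ℕ.* suc k) (trans (sym (^-assocʳ ξ e′ (suc k))) eq))))

        -- A variable `κ` in place of `n · μ` allows matching on the equation with `o · (g · μ)`,
        -- which does not hold by computation.
        equation : ∀ κ → κ ≡ o · (g · μ) → All (_≤ β ℕ.* o) κ →
          ∑∈ (fillings κ m) (λ F → χ (coinversionFree? F) * ((y ^ q) ^ maj F * χ (Vec.≡-dec ℕ._≟_ (content F) ν))) ≈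
          ∑∈ (fillings κ m) (λ F → χ (coinversionFree? F) * (χ (constantBlocks? F) * χ (Vec.≡-dec ℕ._≟_ (content F) ν)))
        equation _ ≡.refl bounded = RootOfUnity.∑-maj y q y^o cancel (g · μ) β bounded (λ c → χ (Vec.≡-dec ℕ._≟_ c ν))

    -- Negative powers become nonnegative ones: the inverse of the generator is by construction its
    -- power `n ∸ 1`, and likewise for `ξ⁻¹`.
    power-act : ∀ μ {m} (ν : Vec ℕ m) (d : ℤ) → ∃ λ e →
      (∀ x → CyclicAction.act (⟨φ⟩ n μ ν) d x ≡ (φ n μ ν ^∘ e) x) × ξ ^ e ≈ power d
    power-act μ ν (+ k)    = k , (λ _ → ≡.refl) , refl
    power-act μ ν -[1+ k ] = suc k ℕ.* (n ∸ 1) , iterate-* (φ n μ ν) (suc k) (n ∸ 1) , (begin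
      ξ ^ (suc k ℕ.* (n ∸ 1))    ≡⟨ ≡.cong (ξ ^_) (ℕ.*-comm (suc k) (n ∸ 1)) ⟩
      ξ ^ ((n ∸ 1) ℕ.* suc k)    ≈⟨ ^-assocʳ ξ (n ∸ 1) (suc k) ⟨
      (ξ ^ (n ∸ 1)) ^ suc k      ≈⟨ ^-congˡ (suc k) ξ⁻¹≈ξ^[n-1] ⟨
      ξ⁻¹ ^ suc k                ∎)

    cyclicSieving : ∀ μ {m} (ν : Vec ℕ m) (d : ℤ) (fixed? : Decidable (λ x → CyclicAction.act (⟨φ⟩ n μ ν) d x ≡ x)) →
      fromℕ K (Finite.count (COF[,]-finite (n · μ) ν) fixed?) ≈ evaluate K ([𝐦 ν ] E (n · μ) m) (power d)
    cyclicSieving μ {m} ν d fixed? = trans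
      (reflexive (≡.cong (fromℕ K) (count-cong (COF[,]-finite (n · μ) ν) fixed? fixed′?
        (λ x eq → ≡.trans (≡.sym (act≡ x)) eq) (λ x eq → ≡.trans (act≡ x) eq))))
      (trans (sieving e μ ν fixed′?) (evaluate-cong ([𝐦 ν ] E (n · μ) m) power≈))
      where
      e      = proj₁ (power-act μ ν d)
      act≡   = proj₁ (proj₂ (power-act μ ν d))
      power≈ = proj₂ (proj₂ (power-act μ ν d))
      fixed′? : Decidable (λ x → (φ n μ ν ^∘ e) x ≡ x)
      fixed′? x = Finite._≟ᵉ_ (COF[,]-finite (n · μ) ν) ((φ n μ ν ^∘ e) x) x

open import Data.Nat.Base using (_*_)
open import Data.Vec.Base using (sum)

theorem28 : ∀ (n : ℕ) .{{_ : NonZero n}} (k : ℕ) (μ : List ℕ) → μ ⊢ k → (m : ℕ) (ν : Vec ℕ m) → sum ν ≡ n * k → ExhibitsCyclicSieving (COF[,]-finite (n · μ) ν) (⟨φ⟩ n μ ν) ([𝐦 ν ] E (n · μ) m)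
theorem28 n k μ μ⊢k m ν sum≡ K char0 ζ d = Field.cyclicSieving K ζ μ ν d
  λ x → Finite._≟ᵉ_ (COF[,]-finite (n · μ) ν) (CyclicAction.act (⟨φ⟩ n μ ν) d x) x
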